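{- There is a bijective correspondence between equinumerosities $\approx$ on $\mathbb W$ and gauge ideals $\mathfrak I$ of $\mathcal R$ such that, if $\approx$ corresponds to $\mathfrak I$, then for all $X,Y\in\mathbb W$: $$X\approx Y\iff S_X-S_Y\in\mathfrak I.$$ Moreover, if $\approx$ corresponds to $\mathfrak I$, $\mathfrak n:\mathbb W\to\mathfrak N=\mathbb W/\approx$ is the canonical map and $\pi:\mathcal R\to\mathcal R/\mathfrak I$ the canonical projection, then there is a unique order-preserving embedding $j$ of $\mathfrak N$ (ordered by the total order induced by $\prec$) onto the non-negative part of $\mathcal R/\mathfrak I$ such that $j(\mathfrak n(X))=\pi(S_X)$ for all $X\in\mathbb W$. The ordered semiring structure induced on $\mathfrak N$ by $j$ satisfies, for all $X,Y\in\mathbb W$: (1) $\mathfrak n(X)+\mathfrak n(Y)=\mathfrak n(X\cup Y)$ whenever $X\cap Y=\emptyset$; (2) $\mathfrak n(X)\cdot\mathfrak n(Y)=\mathfrak n(X\times Y)$ whenever $X,Y$ are multipliable; (3) $\mathfrak n(X)<\mathfrak n(Y)$ if and only if $Y\approx Y'$ for some proper superset $Y'\in\mathbb W$ of $X$.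
   Context: Let $\mathbb N=\{0,1,2,\dots\}$. Let $\mathbb{W}$ be the family of finitary point sets: sets $A\subseteq\bigcup_{k\ge1}\mathbb N^k$ of finite tuples of natural numbers (tuples of different lengths allowed) such that for every $n\in\mathbb N$ there is $h$ with $A\cap\{0,\dots,n\}^k=\emptyset$ for all $k>h$. Cartesian products are identified with concatenations: $A\times B=\{(a_1,\dots,a_k,b_1,\dots,b_h):(a_1,\dots,a_k)\in A,\ (b_1,\dots,b_h)\in B\}$; $\{n\}$ denotes the set whose only element is the 1-tuple $(n)$. $A,B\in\mathbb W$ are multipliable if distinct pairs $(a,b)\in A\times B$ have distinct concatenations. Given an equivalence relation $\approx$ on $\mathbb W$, write $A\succ B$, equivalently $B\prec A$, if there exist $A',B'\in\mathbb W$ with $B'\subsetneq A'$, $A\approx A'$ and $B\approx B'$. An equinumerosity is an equivalence relation $\approx$ on $\mathbb W$ such that for all $A,B\in\mathbb W$: (AP) $A\approx B$ iff $A\setminus B\approx B\setminus A$; (ZP) exactly one of $A\approx B$, $A\succ B$, $A\prec B$ holds; (TP) if $T$ is injective on $A$ and $T(a)$ is a permutation of the coordinates of $a$ for every $a\in A$, then $A\approx T[A]$; (UP) $A\times\{n\}\approx A$ for all $n\in\mathbb N$; (PP) if $A,B$ are multipliable, $A',B'$ are multipliable, $A\approx A'$ and $B\approx B'$, then $A\times B\approx A'\times B'$. Series: let $t_0,t_1,\dots$ be indeterminates; $\mathbf A$ the set of eventually zero sequences $\mathbf a=(a_0,a_1,\dots)$ of non-negative integers; $t^{\mathbf a}=\prod_i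 t_i^{a_i}$; formal series $S=\sum_{\mathbf a}n_{\mathbf a}t^{\mathbf a}$, $n_{\mathbf a}\in\mathbb Z$. $\mathcal R$ is the ring of formal series $S$ for which there exist $d_n\in\mathbb N$ with $n_{\mathbf a}=0$ whenever $a_n>d_n$ for some $n$, and $b\in\mathbb N$ with $|n_{\mathbf a}|\le b(\sum_ia_i)!/\prod_ia_i!$ for all $\mathbf a$. $\mathcal R^+$ is the set of nonzero series in $\mathcal R$ with all coefficients non-negative. $\mathfrak I_0$ is the ideal of $\mathcal R$ generated by $\{t_n-1:n\in\mathbb N\}$. For a tuple $x=(x_1,\dots,x_d)$, $t_x=t^{\mathbf a}$ with $a_i=|\{j:x_j=i\}|$; the characteristic series of $X\in\mathbb W$ is $S_X=\sum_{x\in X}t_x$, $S_\emptyset=0$. An ideal $\mathfrak I$ of $\mathcal R$ is a gauge ideal if $\mathfrak I_0\subseteq\mathfrak I$, $\mathcal R^+\cap\mathfrak I=\emptyset$, and for every $S\in\mathcal R\setminus\mathfrak I$ there is $P\in\mathcal R^+$ with $S+P\in\mathfrak I$ or $S-P\in\mathfrak I$. For a gauge ideal, $\mathcal R/\mathfrak I$ is a discretely ordered ring whose positive elements are the cosets $P+\mathfrak I$, $P\in\mathcal R^+$; its non-negative part consists of these cosets together with $0$.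
   Formalization: The series with the stated bounds are not closed under products and do not contain S_X for every X (e.g. X = {(0,…,0,k) with k zeros}), so 𝓡 is taken to be the least ring of formal series containing the bounded series and all S_X. -}

module Defs where

open import Algebra.Bundles using (CommutativeRing; RawRing; RawSemiring)
open import Algebra.Morphism.Structures using (module SemiringMorphisms)
open import Algebra.Structures using (IsCommutativeSemiring; IsCommutativeRing)
import Algebra.Properties.Ring as RingProperties
open import Data.Bool.Base using (Bool; true; false; T; _∧_; _∨_; not; if_then_else_)
open import Data.Bool.Properties using (T-∧; T-∨; T?)
open import Data.Empty using (⊥-elim) renaming (⊥ to Empty)
open import Data.Integer.Base using (ℤ; +_; 0ℤ; 1ℤ; ∣_∣) renaming (_+_ to _+ᶻ_; _*_ to _*ᶻ_; -_ to -ᶻ_; _≤_ to _≤ᶻ_)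
import Data.Integer.Properties as ℤₚ
open import Data.List.Base using (List; []; _∷_; _++_; length; map; filter; upTo; applyUpTo; cartesianProductWith; replicate)
open import Data.List.Properties using (length-++; ≡-dec)
open import Data.List.Relation.Binary.Permutation.Propositional using (_↭_)
open import Data.List.Relation.Unary.All using (All)
open import Data.List.Relation.Unary.All.Properties using (++⁻)
open import Data.Nat.ListAction using (sum; product)
open import Data.Nat.Base using (ℕ; zero; suc; _+_; _*_; _≤_; _<_; _⊔_; _!; z≤n)
import Data.Nat.Properties as ℕₚ
open import Data.Product.Base using (Σ; ∃; ∃₂; _×_; _,_; proj₁; proj₂)
open import Data.Sum.Base using (_⊎_; inj₁; inj₂)
open import Function.Base using (_∘_; _on_; flip)
open import Function.Bundles using (Equivalence; _⇔_; mk⇔)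
open import Level using (0ℓ) renaming (suc to lsuc; _⊔_ to _⊔ˡ_)
open import Relation.Binary.Bundles using (Setoid)
open import Relation.Binary.Core using (Rel)
open import Relation.Binary.Definitions using (Trichotomous)
open import Relation.Binary.Morphism.Structures using (IsOrderMonomorphism)
open import Relation.Binary.PropositionalEquality using (_≡_; refl; sym; trans; cong; cong₂; subst; module ≡-Reasoning)
open import Relation.Binary.Structures using (IsEquivalence; IsStrictTotalOrder)
open import Relation.Nullary.Decidable using (Dec; yes; no; ⌊_⌋; toWitness; _×-dec_)
open import Relation.Nullary.Negation using (¬_)
open import Relation.Unary using (Pred; _∈_; _∉_; _⊆_; _⊂_; _≐_; _⊥_)

-- Point sets contain non-empty tuples only; see []∉ below.
Tuple : Set
Tuple = List ℕ

-- Under excluded middle, Bool-valued characteristic functions give all subsets.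
record 𝕎 : Set where
  field
    χ        : Tuple → Bool
    []∉      : χ [] ≡ false
    finitary : ∀ n → ∃ λ h → ∀ x → h < length x → All (_≤ n) x → ¬ T (χ x)

open 𝕎 public

⟦_⟧ : 𝕎 → Pred Tuple 0ℓ
⟦ A ⟧ x = T (χ A x)

infixr 6 _∪ʷ_
infixr 7 _×ʷ_
infix  7 _∖ʷ_

_∪ʷ_ : 𝕎 → 𝕎 → 𝕎
A ∪ʷ B = record
  { χ        = λ x → χ A x ∨ χ B x
  ; []∉      = cong₂ _∨_ ([]∉ A) ([]∉ B)
  ; finitary = fin
  }
  where
  fin : ∀ n → ∃ λ h → ∀ x → h < length x → All (_≤ n) x → ¬ T (χ A x ∨ χ B x)
  fin n with finitary A n | finitary B n
  ... | hA , pA | hB , pB = hA ⊔ hB , λ x h< x≤n x∈ → go x h< x≤n (Equivalence.to T-∨ x∈)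
    where
    go : ∀ x → hA ⊔ hB < length x → All (_≤ n) x → T (χ A x) ⊎ T (χ B x) → Empty
    go x h< x≤n (inj₁ x∈A) = pA x (ℕₚ.≤-<-trans (ℕₚ.m≤m⊔n hA hB) h<) x≤n x∈A
    go x h< x≤n (inj₂ x∈B) = pB x (ℕₚ.≤-<-trans (ℕₚ.m≤n⊔m hA hB) h<) x≤n x∈B

_∖ʷ_ : 𝕎 → 𝕎 → 𝕎
A ∖ʷ B = record
  { χ        = λ x → χ A x ∧ not (χ B x)
  ; []∉      = cong (_∧ not (χ B [])) ([]∉ A)
  ; finitary = λ n → proj₁ (finitary A n) , λ x h< x≤n x∈ →
                 proj₂ (finitary A n) x h< x≤n (proj₁ (Equivalence.to T-∧ x∈))
  }

｛_｝ʷ : ℕ → 𝕎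
｛ n ｝ʷ = record
  { χ        = λ x → ⌊ ≡-dec ℕₚ._≟_ x (n ∷ []) ⌋
  ; []∉      = refl
  ; finitary = λ _ → 1 , λ x 1< _ x∈ →
                 ℕₚ.<-irrefl refl (subst (1 <_) (cong length (toWitness x∈)) 1<)
  }

-- catχ f g x holds when x = a ++ b for some a, b with f a and g b.
catχ : (Tuple → Bool) → (Tuple → Bool) → Tuple → Bool
catχ f g []       = f [] ∧ g []
catχ f g (x ∷ xs) = (f [] ∧ g (x ∷ xs)) ∨ catχ (f ∘ (x ∷_)) g xs

catχ⁻ : ∀ f g x → T (catχ f g x) → ∃₂ λ a b → T (f a) × T (g b) × x ≡ a ++ b
catχ⁻ f g []       p = [] , [] , proj₁ q , proj₂ q , refl
  where q = Equivalence.to (T-∧ {f []}) p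
catχ⁻ f g (x ∷ xs) p with Equivalence.to (T-∨ {f [] ∧ g (x ∷ xs)}) p
... | inj₁ q = [] , x ∷ xs , proj₁ r , proj₂ r , refl
  where r = Equivalence.to (T-∧ {f []}) q
... | inj₂ q with catχ⁻ (f ∘ (x ∷_)) g xs q
...   | a , b , fa , gb , eq = x ∷ a , b , fa , gb , cong (x ∷_) eq

catχ⁺ : ∀ f g a b → T (f a) → T (g b) → T (catχ f g (a ++ b))
catχ⁺ f g []      []      fa gb = Equivalence.from T-∧ (fa , gb)
catχ⁺ f g []      (x ∷ b) fa gb = Equivalence.from T-∨ (inj₁ (Equivalence.from T-∧ (fa , gb)))
catχ⁺ f g (x ∷ a) b       fa gb =
  Equivalence.from (T-∨ {f [] ∧ g (x ∷ a ++ b)}) (inj₂ (catχ⁺ (f ∘ (x ∷_)) g a b fa gb))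

_×ʷ_ : 𝕎 → 𝕎 → 𝕎
A ×ʷ B = record
  { χ        = catχ (χ A) (χ B)
  ; []∉      = cong (_∧ χ B []) ([]∉ A)
  ; finitary = fin
  }
  where
  fin : ∀ n → ∃ λ h → ∀ x → h < length x → All (_≤ n) x → ¬ T (catχ (χ A) (χ B) x)
  fin n with finitary A n | finitary B n
  ... | hA , pA | hB , pB = hA + hB , λ x h< x≤n x∈ → go x h< x≤n (catχ⁻ (χ A) (χ B) x x∈)
    where
    go : ∀ x → hA + hB < length x → All (_≤ n) x →
         (∃₂ λ a b → T (χ A a) × T (χ B b) × x ≡ a ++ b) → Empty
    go _ h< x≤n (a , b , a∈ , b∈ , refl) with length a ℕₚ.≤? hA
    ... | no-or-yes with ++⁻ a x≤n
    ...   | a≤n , b≤n = split no-or-yes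
      where
      split : Dec (length a ≤ hA) → Empty
      split (no a≰)  = pA a (ℕₚ.≰⇒> a≰) a≤n a∈
      split (yes a≤) = pB b (ℕₚ.+-cancelˡ-< hA _ _ (ℕₚ.<-≤-trans h<
        (ℕₚ.≤-trans (ℕₚ.≤-reflexive (length-++ a)) (ℕₚ.+-monoˡ-≤ (length b) a≤)))) b≤n b∈

∈-×ʷ : ∀ A B x → x ∈ ⟦ A ×ʷ B ⟧ ⇔ (∃₂ λ a b → a ∈ ⟦ A ⟧ × b ∈ ⟦ B ⟧ × x ≡ a ++ b)
∈-×ʷ A B x = mk⇔ (catχ⁻ (χ A) (χ B) x)
  λ { (a , b , a∈ , b∈ , refl) → catχ⁺ (χ A) (χ B) a b a∈ b∈ }

Multipliable : Rel 𝕎 0ℓ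
Multipliable A B = ∀ {a a′ b b′} → a ∈ ⟦ A ⟧ → a′ ∈ ⟦ A ⟧ → b ∈ ⟦ B ⟧ → b′ ∈ ⟦ B ⟧ →
                   a ++ b ≡ a′ ++ b′ → a ≡ a′ × b ≡ b′

module _ (_≈_ : Rel 𝕎 0ℓ) where

  Succ : Rel 𝕎 0ℓ
  Succ A B = ∃₂ λ A′ B′ → ⟦ B′ ⟧ ⊂ ⟦ A′ ⟧ × A ≈ A′ × B ≈ B′

  record IsEquinumerosity : Set where
    field
      isEquivalence : IsEquivalence _≈_
      -- Elements of 𝕎 are sets, so _≈_ cannot separate extensionally equal ones.
      extensional   : ∀ {A B} → ⟦ A ⟧ ≐ ⟦ B ⟧ → A ≈ B
      AP            : ∀ A B → A ≈ B ⇔ (A ∖ʷ B) ≈ (B ∖ʷ A)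
      ZP            : Trichotomous _≈_ (flip Succ)
      -- The third hypothesis says that B = t [ A ].
      TP            : ∀ A B (t : Tuple → Tuple) →
                      (∀ {a a′} → a ∈ ⟦ A ⟧ → a′ ∈ ⟦ A ⟧ → t a ≡ t a′ → a ≡ a′) →
                      (∀ {a} → a ∈ ⟦ A ⟧ → t a ↭ a) →
                      (∀ y → y ∈ ⟦ B ⟧ ⇔ (∃ λ a → a ∈ ⟦ A ⟧ × t a ≡ y)) →
                      A ≈ B
      UP            : ∀ A n → (A ×ʷ ｛ n ｝ʷ) ≈ A
      PP            : ∀ A B A′ B′ → Multipliable A B → Multipliable A′ B′ →
                      A ≈ A′ → B ≈ B′ → (A ×ʷ B) ≈ (A′ ×ʷ B′)

record Equinumerosity : Set₁ where
  infix 4 _≈_ _≻_ _≺_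
  field
    _≈_              : Rel 𝕎 0ℓ
    isEquinumerosity : IsEquinumerosity _≈_

  open IsEquinumerosity isEquinumerosity public

  _≻_ _≺_ : Rel 𝕎 0ℓ
  _≻_   = Succ _≈_
  A ≺ B = B ≻ A

  𝔑 : Setoid 0ℓ 0ℓ
  𝔑 = record { Carrier = 𝕎 ; _≈_ = _≈_ ; isEquivalence = isEquivalence }

  𝔫 : 𝕎 → Setoid.Carrier 𝔑
  𝔫 X = X

equinumerositySetoid : Setoid (lsuc 0ℓ) 0ℓ
equinumerositySetoid = record
  { Carrier       = Equinumerosity
  ; _≈_           = λ E F → ∀ A B → Equinumerosity._≈_ E A B ⇔ Equinumerosity._≈_ F A B
  ; isEquivalence = record
    { refl  = λ A B → mk⇔ (λ p → p) (λ p → p)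
    ; sym   = λ p A B → mk⇔ (Equivalence.from (p A B)) (Equivalence.to (p A B))
    ; trans = λ p q A B → mk⇔ (Equivalence.to (q A B) ∘ Equivalence.to (p A B))
                              (Equivalence.from (p A B) ∘ Equivalence.from (q A B))
    }
  }

-- The list a₀ ∷ … ∷ aₖ ∷ [] stands for the sequence (a₀, …, aₖ, 0, 0, …), so
-- lists differing by trailing zeros are identified.
𝐀 : Set
𝐀 = List ℕ

infixl 9 _‼_
_‼_ : 𝐀 → ℕ → ℕ
[]      ‼ _     = 0
(n ∷ _) ‼ zero  = n
(_ ∷ a) ‼ suc i = a ‼ i

infix 4 _≋_
_≋_ : Rel 𝐀 0ℓ
a ≋ b = ∀ i → a ‼ i ≡ b ‼ i

record Series : Set where
  field
    coeff      : 𝐀 → ℤ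
    coeff-resp : ∀ {a b} → a ≋ b → coeff a ≡ coeff b

open Series public

infix 4 _≈ˢ_
_≈ˢ_ : Rel Series 0ℓ
S ≈ˢ S′ = ∀ a → coeff S a ≡ coeff S′ a

-- Σ_{i+j=n} h i j
antidiag : ℕ → (ℕ → ℕ → ℤ) → ℤ
antidiag zero    h = h 0 0
antidiag (suc n) h = h 0 (suc n) +ᶻ antidiag n (λ i j → h (suc i) j)

-- The Cauchy product, Σ_{a+b=c} f a * g b, summed one coordinate at a time.
conv : (𝐀 → ℤ) → (𝐀 → ℤ) → 𝐀 → ℤ
conv f g []       = f [] *ᶻ g []
conv f g (n ∷ c) = antidiag n (λ i j → conv (f ∘ (i ∷_)) (g ∘ (j ∷_)) c)

interchange : ∀ a b c d → (a +ᶻ b) +ᶻ (c +ᶻ d) ≡ (a +ᶻ c) +ᶻ (b +ᶻ d)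
interchange a b c d = begin
  (a +ᶻ b) +ᶻ (c +ᶻ d)  ≡⟨ ℤₚ.+-assoc a b _ ⟩
  a +ᶻ (b +ᶻ (c +ᶻ d))  ≡⟨ cong (a +ᶻ_) (sym (ℤₚ.+-assoc b c d)) ⟩
  a +ᶻ ((b +ᶻ c) +ᶻ d)  ≡⟨ cong (λ z → a +ᶻ (z +ᶻ d)) (ℤₚ.+-comm b c) ⟩
  a +ᶻ ((c +ᶻ b) +ᶻ d)  ≡⟨ cong (a +ᶻ_) (ℤₚ.+-assoc c b d) ⟩
  a +ᶻ (c +ᶻ (b +ᶻ d))  ≡⟨ sym (ℤₚ.+-assoc a c _) ⟩
  (a +ᶻ c) +ᶻ (b +ᶻ d)  ∎
  where open ≡-Reasoning

antidiag-cong : ∀ n {h h′ : ℕ → ℕ → ℤ} → (∀ i j → h i j ≡ h′ i j) → antidiag n h ≡ antidiag n h′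
antidiag-cong zero    p = p 0 0
antidiag-cong (suc n) p = cong₂ _+ᶻ_ (p 0 (suc n)) (antidiag-cong n (λ i j → p (suc i) j))

antidiag-0 : ∀ n → antidiag n (λ _ _ → 0ℤ) ≡ 0ℤ
antidiag-0 zero    = refl
antidiag-0 (suc n) = trans (ℤₚ.+-identityˡ _) (antidiag-0 n)

antidiag-+ : ∀ n (h h′ : ℕ → ℕ → ℤ) →
             antidiag n (λ i j → h i j +ᶻ h′ i j) ≡ antidiag n h +ᶻ antidiag n h′
antidiag-+ zero    h h′ = refl
antidiag-+ (suc n) h h′ = trans
  (cong (h 0 (suc n) +ᶻ h′ 0 (suc n) +ᶻ_) (antidiag-+ n (λ i → h (suc i)) (λ i → h′ (suc i))))
  (interchange (h 0 (suc n)) (h′ 0 (suc n)) _ _)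

antidiag-last : ∀ n (h : ℕ → ℕ → ℤ) →
                antidiag (suc n) h ≡ antidiag n (λ i j → h i (suc j)) +ᶻ h (suc n) 0
antidiag-last zero    h = refl
antidiag-last (suc n) h = trans
  (cong (h 0 (suc (suc n)) +ᶻ_) (antidiag-last n (λ i → h (suc i))))
  (sym (ℤₚ.+-assoc (h 0 (suc (suc n))) _ _))

antidiag-flip : ∀ n (h : ℕ → ℕ → ℤ) → antidiag n h ≡ antidiag n (flip h)
antidiag-flip zero    h = refl
antidiag-flip (suc n) h = begin
  h 0 (suc n) +ᶻ antidiag n (λ i j → h (suc i) j)
    ≡⟨ cong (h 0 (suc n) +ᶻ_) (antidiag-flip n (λ i → h (suc i))) ⟩
  h 0 (suc n) +ᶻ antidiag n (λ i j → h (suc j) i)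
    ≡⟨ ℤₚ.+-comm (h 0 (suc n)) _ ⟩
  antidiag n (λ i j → h (suc j) i) +ᶻ h 0 (suc n)
    ≡⟨ sym (antidiag-last n (flip h)) ⟩
  antidiag (suc n) (flip h) ∎
  where open ≡-Reasoning

antidiag-assoc : ∀ n (h : ℕ → ℕ → ℕ → ℤ) →
                 antidiag n (λ i j → antidiag i (λ k l → h k l j)) ≡
                 antidiag n (λ k m → antidiag m (λ l j → h k l j))
antidiag-assoc zero    h = refl
antidiag-assoc (suc n) h = begin
  h 0 0 (suc n) +ᶻ
    antidiag n (λ i j → h 0 (suc i) j +ᶻ antidiag i (λ k l → h (suc k) l j))
    ≡⟨ cong (h 0 0 (suc n) +ᶻ_) (antidiag-+ n _ _) ⟩
  h 0 0 (suc n) +ᶻ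
    (antidiag n (λ i j → h 0 (suc i) j) +ᶻ
     antidiag n (λ i j → antidiag i (λ k l → h (suc k) l j)))
    ≡⟨ sym (ℤₚ.+-assoc (h 0 0 (suc n)) _ _) ⟩
  antidiag (suc n) (h 0) +ᶻ antidiag n (λ i j → antidiag i (λ k l → h (suc k) l j))
    ≡⟨ cong (antidiag (suc n) (h 0) +ᶻ_) (antidiag-assoc n (λ k → h (suc k))) ⟩
  antidiag (suc n) (λ k m → antidiag m (λ l j → h k l j)) ∎
  where open ≡-Reasoning

conv-cong : ∀ {f f′ g g′ : 𝐀 → ℤ} → (∀ a → f a ≡ f′ a) → (∀ a → g a ≡ g′ a) →
            ∀ c → conv f g c ≡ conv f′ g′ c
conv-cong p q []      = cong₂ _*ᶻ_ (p []) (q [])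
conv-cong p q (n ∷ c) = antidiag-cong n (λ i j → conv-cong (p ∘ (i ∷_)) (q ∘ (j ∷_)) c)

conv-comm : ∀ f g c → conv f g c ≡ conv g f c
conv-comm f g []      = ℤₚ.*-comm (f []) (g [])
conv-comm f g (n ∷ c) = trans (antidiag-flip n _)
  (antidiag-cong n (λ i j → conv-comm (f ∘ (j ∷_)) (g ∘ (i ∷_)) c))

conv-distribʳ : ∀ h f g c → conv (λ a → f a +ᶻ g a) h c ≡ conv f h c +ᶻ conv g h c
conv-distribʳ h f g []      = ℤₚ.*-distribʳ-+ (h []) (f []) (g [])
conv-distribʳ h f g (n ∷ c) = trans
  (antidiag-cong n (λ i j → conv-distribʳ (h ∘ (j ∷_)) (f ∘ (i ∷_)) (g ∘ (i ∷_)) c))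
  (antidiag-+ n _ _)

conv-distribˡ : ∀ h f g c → conv h (λ a → f a +ᶻ g a) c ≡ conv h f c +ᶻ conv h g c
conv-distribˡ h f g c = trans (conv-comm h _ c)
  (trans (conv-distribʳ h f g c) (cong₂ _+ᶻ_ (conv-comm f h c) (conv-comm g h c)))

conv-zeroˡ : ∀ g c → conv (λ _ → 0ℤ) g c ≡ 0ℤ
conv-zeroˡ g []      = ℤₚ.*-zeroˡ (g [])
conv-zeroˡ g (n ∷ c) =
  trans (antidiag-cong n (λ i j → conv-zeroˡ (g ∘ (j ∷_)) c)) (antidiag-0 n)

conv-antidiagˡ : ∀ n (F : ℕ → ℕ → 𝐀 → ℤ) g c →
                 conv (λ a → antidiag n (λ i j → F i j a)) g c ≡
                 antidiag n (λ i j → conv (F i j) g c)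
conv-antidiagˡ zero    F g c = refl
conv-antidiagˡ (suc n) F g c = trans (conv-distribʳ g (F 0 (suc n)) _ c)
  (cong (conv (F 0 (suc n)) g c +ᶻ_) (conv-antidiagˡ n (λ i → F (suc i)) g c))

conv-antidiagʳ : ∀ n (F : ℕ → ℕ → 𝐀 → ℤ) g c →
                 conv g (λ a → antidiag n (λ i j → F i j a)) c ≡
                 antidiag n (λ i j → conv g (F i j) c)
conv-antidiagʳ n F g c = trans (conv-comm g _ c) (trans (conv-antidiagˡ n F g c)
  (antidiag-cong n (λ i j → conv-comm (F i j) g c)))

conv-assoc : ∀ f g h c → conv (conv f g) h c ≡ conv f (conv g h) c
conv-assoc f g h []      = ℤₚ.*-assoc (f []) (g []) (h [])
conv-assoc f g h (n ∷ c) = begin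
  antidiag n (λ i j → conv (λ a → antidiag i (λ k l → conv (f ∘ (k ∷_)) (g ∘ (l ∷_)) a)) (h ∘ (j ∷_)) c)
    ≡⟨ antidiag-cong n (λ i j → conv-antidiagˡ i _ (h ∘ (j ∷_)) c) ⟩
  antidiag n (λ i j → antidiag i (λ k l → conv (conv (f ∘ (k ∷_)) (g ∘ (l ∷_))) (h ∘ (j ∷_)) c))
    ≡⟨ antidiag-cong n (λ i j → antidiag-cong i (λ k l →
         conv-assoc (f ∘ (k ∷_)) (g ∘ (l ∷_)) (h ∘ (j ∷_)) c)) ⟩
  antidiag n (λ i j → antidiag i (λ k l → conv (f ∘ (k ∷_)) (conv (g ∘ (l ∷_)) (h ∘ (j ∷_))) c))
    ≡⟨ antidiag-assoc n _ ⟩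
  antidiag n (λ k m → antidiag m (λ l j → conv (f ∘ (k ∷_)) (conv (g ∘ (l ∷_)) (h ∘ (j ∷_))) c))
    ≡⟨ antidiag-cong n (λ k m → sym (conv-antidiagʳ m _ (f ∘ (k ∷_)) c)) ⟩
  antidiag n (λ k m → conv (f ∘ (k ∷_)) (λ a → antidiag m (λ l j → conv (g ∘ (l ∷_)) (h ∘ (j ∷_)) a)) c) ∎
  where open ≡-Reasoning

∷-resp : ∀ {a b} n → a ≋ b → n ∷ a ≋ n ∷ b
∷-resp n p zero    = refl
∷-resp n p (suc i) = p i

conv-resp : ∀ f g → (∀ {a b} → a ≋ b → f a ≡ f b) → (∀ {a b} → a ≋ b → g a ≡ g b) →
            ∀ {a b} → a ≋ b → conv f g a ≡ conv f g b
conv-resp f g p q {a} {b} = go f g p q a b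
  where
  Resp : (𝐀 → ℤ) → Set
  Resp f = ∀ {a b} → a ≋ b → f a ≡ f b

  []≋0 : [] ≋ 0 ∷ []
  []≋0 zero    = refl
  []≋0 (suc i) = refl

  nil : ∀ f g → Resp f → Resp g → ∀ b → [] ≋ b → conv f g [] ≡ conv f g b
  nil f g p q []           e = refl
  nil f g p q (zero  ∷ b) e = trans (cong₂ _*ᶻ_ (p []≋0) (q []≋0))
    (nil (f ∘ (0 ∷_)) (g ∘ (0 ∷_)) (p ∘ ∷-resp 0) (q ∘ ∷-resp 0) b (e ∘ suc))
  nil f g p q (suc n ∷ b) e with e 0
  ... | ()

  go : ∀ f g → Resp f → Resp g → ∀ a b → a ≋ b → conv f g a ≡ conv f g b
  go f g p q []      b       e = nil f g p q b e
  go f g p q (m ∷ a) []      e = sym (nil f g p q (m ∷ a) (sym ∘ e))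
  go f g p q (m ∷ a) (n ∷ b) e with e 0
  ... | refl = antidiag-cong m (λ i j →
    go (f ∘ (i ∷_)) (g ∘ (j ∷_)) (p ∘ ∷-resp i) (q ∘ ∷-resp j) a b (e ∘ suc))

-- trim drops trailing zeros, giving unique representatives of sequences.
consᵗ : ℕ → 𝐀 → 𝐀
consᵗ zero    []      = []
consᵗ zero    (m ∷ a) = zero ∷ m ∷ a
consᵗ (suc n) a       = suc n ∷ a

trim : 𝐀 → 𝐀
trim []      = []
trim (n ∷ a) = consᵗ n (trim a)

trim-‼ : ∀ a → trim a ≋ a
trim-‼ []      i = refl
trim-‼ (n ∷ a) i = trans (consᵗ-‼ n (trim a) i) (∷-resp n (trim-‼ a) i)
  where
  consᵗ-‼ : ∀ n a → consᵗ n a ≋ n ∷ a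
  consᵗ-‼ zero    []      zero    = refl
  consᵗ-‼ zero    []      (suc i) = refl
  consᵗ-‼ zero    (m ∷ a) i       = refl
  consᵗ-‼ (suc n) a       i       = refl

trim-resp : ∀ {a b} → a ≋ b → trim a ≡ trim b
trim-resp {a} {b} = go a b
  where
  nil : ∀ b → [] ≋ b → [] ≡ trim b
  nil []          e = refl
  nil (zero  ∷ b) e = cong (consᵗ zero) (nil b (e ∘ suc))
  nil (suc n ∷ b) e with e 0
  ... | ()

  go : ∀ a b → a ≋ b → trim a ≡ trim b
  go []      b       e = nil b e
  go (m ∷ a) []      e = sym (nil (m ∷ a) (sym ∘ e))
  go (m ∷ a) (n ∷ b) e = cong₂ consᵗ (e 0) (go a b (e ∘ suc))

t^_ : 𝐀 → Series
t^ a = record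
  { coeff      = λ b → if ⌊ ≡-dec ℕₚ._≟_ (trim a) (trim b) ⌋ then 1ℤ else 0ℤ
  ; coeff-resp = λ {b} {b′} e → cong (λ b → if ⌊ ≡-dec ℕₚ._≟_ (trim a) b ⌋ then 1ℤ else 0ℤ) (trim-resp {b} {b′} e)
  }

unit : ℕ → 𝐀
unit n = replicate n 0 ++ 1 ∷ []

0ˢ 1ˢ : Series
0ˢ = record { coeff = λ _ → 0ℤ ; coeff-resp = λ _ → refl }
1ˢ = t^ []

infixl 6 _+ˢ_
infixl 7 _*ˢ_
infix  8 -ˢ_

_+ˢ_ _*ˢ_ : Series → Series → Series
S +ˢ S′ = record
  { coeff      = λ a → coeff S a +ᶻ coeff S′ a
  ; coeff-resp = λ e → cong₂ _+ᶻ_ (coeff-resp S e) (coeff-resp S′ e)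
  }
S *ˢ S′ = record
  { coeff      = conv (coeff S) (coeff S′)
  ; coeff-resp = λ {a} {b} → conv-resp (coeff S) (coeff S′) (coeff-resp S) (coeff-resp S′) {a} {b}
  }

-ˢ_ : Series → Series
-ˢ S = record { coeff = λ a → -ᶻ coeff S a ; coeff-resp = λ e → cong -ᶻ_ (coeff-resp S e) }

1ˢ-zero∷ : ∀ b → coeff 1ˢ (zero ∷ b) ≡ coeff 1ˢ b
1ˢ-zero∷ b with trim b
... | []    = refl
... | _ ∷ _ = refl

conv-identityˡ : ∀ g c → conv (coeff 1ˢ) g c ≡ g c
conv-identityˡ g []          = ℤₚ.*-identityˡ (g [])
conv-identityˡ g (zero  ∷ c) =
  trans (conv-cong 1ˢ-zero∷ (λ _ → refl) c) (conv-identityˡ (g ∘ (0 ∷_)) c)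
conv-identityˡ g (suc n ∷ c) = trans
  (cong₂ _+ᶻ_
    (trans (conv-cong 1ˢ-zero∷ (λ _ → refl) c) (conv-identityˡ (g ∘ (suc n ∷_)) c))
    (trans (antidiag-cong n (λ _ j → conv-zeroˡ (g ∘ (j ∷_)) c)) (antidiag-0 n)))
  (ℤₚ.+-identityʳ _)

conv-identityʳ : ∀ g c → conv g (coeff 1ˢ) c ≡ g c
conv-identityʳ g c = trans (conv-comm g (coeff 1ˢ) c) (conv-identityˡ g c)

occurrences : ℕ → Tuple → ℕ
occurrences i x = length (filter (i ℕₚ.≟_) x)

-- words k n lists each n-tuple over {0, …, k - 1} once.
words : ℕ → ℕ → List Tuple
words k zero    = [] ∷ []
words k (suc n) = cartesianProductWith _∷_ (upTo k) (words k n)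

-- The number of x in X with t_x = t^a, where a has no trailing zeros.
count : 𝕎 → 𝐀 → ℕ
count X a = length (filter
  (λ x → ≡-dec ℕₚ._≟_ (applyUpTo (λ i → occurrences i x) (length a)) a ×-dec T? (χ X x))
  (words (length a) (sum a)))

char : 𝕎 → Series
char X = record
  { coeff      = λ a → + count X (trim a)
  ; coeff-resp = λ {a} {b} e → cong (λ a → + count X a) (trim-resp {a} {b} e)
  }

record Bounded (S : Series) : Set where
  field
    degree   : ℕ → ℕ
    degree-≤ : ∀ a → (∃ λ n → degree n < a ‼ n) → coeff S a ≡ 0ℤ
    bound    : ℕ
    bound-≤  : ∀ a → ∣ coeff S a ∣ * product (map _! a) ≤ bound * (sum a !)

-- The bounded series alone do not form a ring: if P = ∑ k! t_F over all finite
-- F ⊆ ℕ with k = |F|, then P is bounded but P * P = ∑ (k + 1)! t_F is not.  Nor do they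
-- contain every characteristic series: for X = {(0, …, 0, k) : k ≥ 1} with k zeros,
-- char X = ∑ t₀ᵏ tₖ.  So 𝓡 is the least ring containing both.
data In𝓡 : Pred Series 0ℓ where
  bounded : ∀ {S} → Bounded S → In𝓡 S
  char∈   : ∀ X → In𝓡 (char X)
  sum∈    : ∀ {S S′} → In𝓡 S → In𝓡 S′ → In𝓡 (S +ˢ S′)
  neg∈    : ∀ {S} → In𝓡 S → In𝓡 (-ˢ S)
  prod∈   : ∀ {S S′} → In𝓡 S → In𝓡 S′ → In𝓡 (S *ˢ S′)
  resp∈   : ∀ {S S′} → S ≈ˢ S′ → In𝓡 S → In𝓡 S′

m!*n!≤[m+n]! : ∀ m n → m ! * n ! ≤ (m + n) !
m!*n!≤[m+n]! zero    n = ℕₚ.≤-reflexive (ℕₚ.*-identityˡ (n !))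
m!*n!≤[m+n]! (suc m) n = begin
  suc m * m ! * n !         ≡⟨ ℕₚ.*-assoc (suc m) (m !) (n !) ⟩
  suc m * (m ! * n !)       ≤⟨ ℕₚ.*-mono-≤ (ℕₚ.m≤m+n (suc m) n) (m!*n!≤[m+n]! m n) ⟩
  suc (m + n) * (m + n) !   ∎
  where open ℕₚ.≤-Reasoning

product!≤sum! : ∀ a → product (map _! a) ≤ sum a !
product!≤sum! []      = ℕₚ.≤-refl
product!≤sum! (n ∷ a) =
  ℕₚ.≤-trans (ℕₚ.*-monoʳ-≤ (n !) (product!≤sum! a)) (m!*n!≤[m+n]! n (sum a))

t^-bounded : ∀ a → Bounded (t^ a)
t^-bounded a = record { degree = a ‼_ ; degree-≤ = deg ; bound = 1 ; bound-≤ = bnd }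
  where
  deg : ∀ b → (∃ λ n → a ‼ n < b ‼ n) → coeff (t^ a) b ≡ 0ℤ
  deg b (n , a<b) with ≡-dec ℕₚ._≟_ (trim a) (trim b)
  ... | no  _ = refl
  ... | yes e = ⊥-elim (ℕₚ.<-irrefl
    (trans (sym (trim-‼ a n)) (trans (cong (_‼ n) e) (trim-‼ b n))) a<b)

  bnd : ∀ b → ∣ coeff (t^ a) b ∣ * product (map _! b) ≤ 1 * (sum b !)
  bnd b with ≡-dec ℕₚ._≟_ (trim a) (trim b)
  ... | no  _ = z≤n
  ... | yes _ = ℕₚ.*-monoʳ-≤ 1 (product!≤sum! b)

0ˢ-bounded : Bounded 0ˢ
0ˢ-bounded = record
  { degree = λ _ → 0 ; degree-≤ = λ _ _ → refl ; bound = 0 ; bound-≤ = λ _ → z≤n }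

𝓡 : Set
𝓡 = Σ Series In𝓡

𝓡-isCommutativeRing : IsCommutativeRing {A = 𝓡} (_≈ˢ_ on proj₁)
  (λ (S , p) (S′ , p′) → S +ˢ S′ , sum∈ p p′)
  (λ (S , p) (S′ , p′) → S *ˢ S′ , prod∈ p p′)
  (λ (S , p) → -ˢ S , neg∈ p)
  (0ˢ , bounded 0ˢ-bounded)
  (1ˢ , bounded (t^-bounded []))
𝓡-isCommutativeRing = record
  { isRing = record
    { +-isAbelianGroup = record
      { isGroup = record
        { isMonoid = record
          { isSemigroup = record
            { isMagma = record
              { isEquivalence = record
                { refl  = λ _ → refl
                ; sym   = λ p a → sym (p a)
                ; trans = λ p q a → trans (p a) (q a)
                }
              ; ∙-cong = λ p q a → cong₂ _+ᶻ_ (p a) (q a)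
              }
            ; assoc = λ (R , _) (S , _) (S′ , _) a → ℤₚ.+-assoc (coeff R a) (coeff S a) (coeff S′ a)
            }
          ; identity = (λ (S , _) a → ℤₚ.+-identityˡ (coeff S a))
                     , (λ (S , _) a → ℤₚ.+-identityʳ (coeff S a))
          }
        ; inverse = (λ (S , _) a → ℤₚ.+-inverseˡ (coeff S a))
                  , (λ (S , _) a → ℤₚ.+-inverseʳ (coeff S a))
        ; ⁻¹-cong = λ p a → cong -ᶻ_ (p a)
        }
      ; comm = λ (S , _) (S′ , _) a → ℤₚ.+-comm (coeff S a) (coeff S′ a)
      }
    ; *-cong     = λ p q → conv-cong p q
    ; *-assoc    = λ (R , _) (S , _) (S′ , _) → conv-assoc (coeff R) (coeff S) (coeff S′)
    ; *-identity = (λ (S , _) → conv-identityˡ (coeff S))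
                 , (λ (S , _) → conv-identityʳ (coeff S))
    ; distrib    = (λ (R , _) (S , _) (S′ , _) → conv-distribˡ (coeff R) (coeff S) (coeff S′))
                 , (λ (R , _) (S , _) (S′ , _) → conv-distribʳ (coeff R) (coeff S) (coeff S′))
    }
  ; *-comm = λ (S , _) (S′ , _) → conv-comm (coeff S) (coeff S′)
  }

𝓡-ring : CommutativeRing 0ℓ 0ℓ
𝓡-ring = record { isCommutativeRing = 𝓡-isCommutativeRing }

module 𝓡 = CommutativeRing 𝓡-ring

t : ℕ → 𝓡
t n = (t^ unit n) , bounded (t^-bounded (unit n))

𝕊 : 𝕎 → 𝓡
𝕊 X = char X , char∈ X

𝓡⁺ : Pred 𝓡 0ℓ
𝓡⁺ (S , p) = ¬ ((S , p) 𝓡.≈ 𝓡.0#) × (∀ a → 0ℤ ≤ᶻ coeff S a)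

module _ {c ℓ} (R : CommutativeRing c ℓ) where

  open CommutativeRing R renaming (_+_ to _⊕_; _*_ to _⊛_; _-_ to _⊖_; refl to ≈-refl; sym to ≈-sym; trans to ≈-trans)

  record IsIdeal {i} (I : Pred Carrier i) : Set (c ⊔ˡ ℓ ⊔ˡ i) where
    field
      ≈-resp   : ∀ {x y} → x ≈ y → x ∈ I → y ∈ I
      0∈       : 0# ∈ I
      +-closed : ∀ {x y} → x ∈ I → y ∈ I → x ⊕ y ∈ I
      *-closed : ∀ r {x} → x ∈ I → r ⊛ x ∈ I

  data ⟨_⟩ {g} (G : Pred Carrier g) : Pred Carrier (c ⊔ˡ ℓ ⊔ˡ g) where
    gen∈  : ∀ {x} → x ∈ G → ⟨ G ⟩ x
    resp∈ : ∀ {x y} → x ≈ y → ⟨ G ⟩ x → ⟨ G ⟩ y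
    zero∈ : ⟨ G ⟩ 0#
    sum∈  : ∀ {x y} → ⟨ G ⟩ x → ⟨ G ⟩ y → ⟨ G ⟩ (x ⊕ y)
    mult∈ : ∀ r {x} → ⟨ G ⟩ x → ⟨ G ⟩ (r ⊛ x)

  module _ {i} {I : Pred Carrier i} (isIdeal : IsIdeal I) where

    open IsIdeal isIdeal
    open RingProperties ring
    open import Relation.Binary.Reasoning.Setoid setoid

    _~_ : Rel Carrier i
    x ~ y = x ⊖ y ∈ I

    neg-closed : ∀ {x} → x ∈ I → - x ∈ I
    neg-closed {x} p = ≈-resp (-1*x≈-x x) (*-closed (- 1#) p)

    ≈⇒~ : ∀ {x y} → x ≈ y → x ~ y
    ≈⇒~ {x} {y} p = ≈-resp (≈-sym (≈-trans (+-congʳ p) (-‿inverseʳ y))) 0∈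

    cancel-middle : ∀ x y z → (x ⊖ y) ⊕ (y ⊖ z) ≈ x ⊖ z
    cancel-middle x y z = begin
      (x ⊖ y) ⊕ (y ⊖ z)      ≈⟨ +-assoc x (- y) _ ⟩
      x ⊕ (- y ⊕ (y ⊖ z))    ≈⟨ +-congˡ (≈-sym (+-assoc (- y) y (- z))) ⟩
      x ⊕ ((- y ⊕ y) ⊖ z)    ≈⟨ +-congˡ (+-congʳ (-‿inverseˡ y)) ⟩
      x ⊕ (0# ⊖ z)           ≈⟨ +-congˡ (+-identityˡ (- z)) ⟩
      x ⊖ z                  ∎

    ~-sym : ∀ {x y} → x ~ y → y ~ x
    ~-sym {x} {y} p = ≈-resp (begin
      - (x ⊖ y)      ≈⟨ ≈-sym (-‿+-comm x (- y)) ⟩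
      - x ⊕ - (- y)  ≈⟨ +-congˡ (-‿involutive y) ⟩
      - x ⊕ y        ≈⟨ +-comm (- x) y ⟩
      y ⊖ x          ∎) (neg-closed p)

    ~-trans : ∀ {x y z} → x ~ y → y ~ z → x ~ z
    ~-trans {x} {y} {z} p q = ≈-resp (cancel-middle x y z) (+-closed p q)

    ~-+-congʳ : ∀ {x y} z → x ~ y → (x ⊕ z) ~ (y ⊕ z)
    ~-+-congʳ {x} {y} z p = ≈-resp (begin
      x ⊖ y                    ≈⟨ ≈-sym (+-congʳ (+-identityʳ x)) ⟩
      (x ⊕ 0#) ⊖ y             ≈⟨ +-congʳ (+-congˡ (≈-sym (-‿inverseʳ z))) ⟩
      (x ⊕ (z ⊖ z)) ⊖ y        ≈⟨ +-congʳ (≈-sym (+-assoc x z (- z))) ⟩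
      ((x ⊕ z) ⊖ z) ⊖ y        ≈⟨ +-assoc (x ⊕ z) (- z) (- y) ⟩
      (x ⊕ z) ⊕ (- z ⊕ - y)    ≈⟨ +-congˡ (+-comm (- z) (- y)) ⟩
      (x ⊕ z) ⊕ (- y ⊕ - z)    ≈⟨ +-congˡ (-‿+-comm y z) ⟩
      (x ⊕ z) ⊖ (y ⊕ z)        ∎) p

    ~-+-cong : ∀ {x x′ y y′} → x ~ x′ → y ~ y′ → (x ⊕ y) ~ (x′ ⊕ y′)
    ~-+-cong {x} {x′} {y} {y′} p q = ~-trans (~-+-congʳ y p) (~-trans (≈⇒~ (+-comm x′ y))
      (~-trans (~-+-congʳ x′ q) (≈⇒~ (+-comm y′ x′))))

    ~-*-congˡ : ∀ {x y} z → x ~ y → (z ⊛ x) ~ (z ⊛ y)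
    ~-*-congˡ {x} {y} z p = ≈-resp
      (≈-trans (distribˡ z x (- y)) (+-congˡ (≈-sym (-‿distribʳ-* z y)))) (*-closed z p)

    ~-*-cong : ∀ {x x′ y y′} → x ~ x′ → y ~ y′ → (x ⊛ y) ~ (x′ ⊛ y′)
    ~-*-cong {x} {x′} {y} {y′} p q = ~-trans (~-*-congˡ x q) (~-trans (≈⇒~ (*-comm x y′))
      (~-trans (~-*-congˡ y′ p) (≈⇒~ (*-comm y′ x′))))

    ~-neg-cong : ∀ {x y} → x ~ y → (- x) ~ (- y)
    ~-neg-cong {x} {y} p = ≈-resp (≈-sym (-‿+-comm x (- y))) (neg-closed p)

    -- The carrier is that of R, and x ≈ y in the quotient means x - y ∈ I.
    _/_ : CommutativeRing c i
    _/_ = record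
      { _≈_ = _~_
      ; _+_ = _⊕_
      ; _*_ = _⊛_
      ; -_  = -_
      ; 0#  = 0#
      ; 1#  = 1#
      ; isCommutativeRing = record
        { isRing = record
          { +-isAbelianGroup = record
            { isGroup = record
              { isMonoid = record
                { isSemigroup = record
                  { isMagma = record
                    { isEquivalence = record
                      { refl = ≈⇒~ ≈-refl ; sym = ~-sym ; trans = ~-trans }
                    ; ∙-cong = ~-+-cong
                    }
                  ; assoc = λ x y z → ≈⇒~ (+-assoc x y z)
                  }
                ; identity = (λ x → ≈⇒~ (+-identityˡ x)) , (λ x → ≈⇒~ (+-identityʳ x))
                }
              ; inverse = (λ x → ≈⇒~ (-‿inverseˡ x)) , (λ x → ≈⇒~ (-‿inverseʳ x))
              ; ⁻¹-cong = ~-neg-cong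
              }
            ; comm = λ x y → ≈⇒~ (+-comm x y)
            }
          ; *-cong     = ~-*-cong
          ; *-assoc    = λ x y z → ≈⇒~ (*-assoc x y z)
          ; *-identity = (λ x → ≈⇒~ (*-identityˡ x)) , (λ x → ≈⇒~ (*-identityʳ x))
          ; distrib    = (λ x y z → ≈⇒~ (distribˡ x y z)) , (λ x y z → ≈⇒~ (distribʳ x y z))
          }
        ; *-comm = λ x y → ≈⇒~ (*-comm x y)
        }
      }

𝓘₀ : Pred 𝓡 0ℓ
𝓘₀ = ⟨_⟩ 𝓡-ring (λ S → ∃ λ n → S ≡ t n 𝓡.- 𝓡.1#)

record GaugeIdeal : Set₁ where
  field
    𝓘       : Pred 𝓡 0ℓ
    isIdeal : IsIdeal 𝓡-ring 𝓘
    𝓘₀⊆𝓘    : 𝓘₀ ⊆ 𝓘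
    𝓡⁺⊥𝓘    : 𝓡⁺ ⊥ 𝓘
    gauge   : ∀ S → S ∉ 𝓘 → ∃ λ P → P ∈ 𝓡⁺ × ((S 𝓡.+ P) ∈ 𝓘 ⊎ (S 𝓡.- P) ∈ 𝓘)

  𝓡/𝓘 : CommutativeRing 0ℓ 0ℓ
  𝓡/𝓘 = _/_ 𝓡-ring isIdeal

  module 𝓡/𝓘 = CommutativeRing 𝓡/𝓘

  π : 𝓡 → 𝓡/𝓘.Carrier
  π S = S

  Positive NonNegative : Pred 𝓡/𝓘.Carrier 0ℓ
  Positive S    = ∃ λ P → P ∈ 𝓡⁺ × S 𝓡/𝓘.≈ π P
  NonNegative S = Positive S ⊎ S 𝓡/𝓘.≈ 𝓡/𝓘.0#

  infix 4 _<ᴵ_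
  _<ᴵ_ : Rel 𝓡/𝓘.Carrier 0ℓ
  S <ᴵ S′ = Positive (S′ 𝓡/𝓘.- S)

gaugeIdealSetoid : Setoid (lsuc 0ℓ) 0ℓ
gaugeIdealSetoid = record
  { Carrier       = GaugeIdeal
  ; _≈_           = λ I J → GaugeIdeal.𝓘 I ≐ GaugeIdeal.𝓘 J
  ; isEquivalence = record
    { refl  = (λ p → p) , (λ p → p)
    ; sym   = λ (p , q) → q , p
    ; trans = λ (p , q) (p′ , q′) → p′ ∘ p , q ∘ q′
    }
  }

module _ {a ℓ₁ ℓ₂} {A : Set a} (_≈_ : Rel A ℓ₁) (_<_ : Rel A ℓ₂) where

  record IsOrderedSemiring (_+_ _*_ : A → A → A) (0# 1# : A) : Set (a ⊔ˡ ℓ₁ ⊔ˡ ℓ₂) where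
    field
      isCommutativeSemiring : IsCommutativeSemiring _≈_ _+_ _*_ 0# 1#
      isStrictTotalOrder    : IsStrictTotalOrder _≈_ _<_
      +-monoˡ-<             : ∀ z {x y} → x < y → (x + z) < (y + z)
      *-monoˡ-<             : ∀ z {x y} → 0# < z → x < y → (x * z) < (y * z)

module _ (E : Equinumerosity) (I : GaugeIdeal) where

  open Equinumerosity E
  open GaugeIdeal I

  record IsNumerosityEmbedding (j : Setoid.Carrier 𝔑 → 𝓡/𝓘.Carrier) : Set where
    field
      isOrderMonomorphism : IsOrderMonomorphism _≈_ 𝓡/𝓘._≈_ _≺_ _<ᴵ_ j
      onto                : (λ S → ∃ λ u → j u 𝓡/𝓘.≈ S) ≐ NonNegative
      commutes            : ∀ X → j (𝔫 X) 𝓡/𝓘.≈ π (𝕊 X)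

  record InducedSemiring (j : Setoid.Carrier 𝔑 → 𝓡/𝓘.Carrier) : Set where
    infixl 6 _+ᴺ_
    infixl 7 _*ᴺ_
    field
      _+ᴺ_ _*ᴺ_         : 𝕎 → 𝕎 → 𝕎
      0ᴺ 1ᴺ             : 𝕎
      isOrderedSemiring : IsOrderedSemiring _≈_ _≺_ _+ᴺ_ _*ᴺ_ 0ᴺ 1ᴺ

    rawSemiring : RawSemiring 0ℓ 0ℓ
    rawSemiring = record { _≈_ = _≈_ ; _+_ = _+ᴺ_ ; _*_ = _*ᴺ_ ; 0# = 0ᴺ ; 1# = 1ᴺ }

    field
      isSemiringHomomorphism :
        SemiringMorphisms.IsSemiringHomomorphism rawSemiring (RawRing.rawSemiring 𝓡/𝓘.rawRing) j

-- A series S in 𝓡 has only finitely many terms in any finite set of variables, so β S, which is S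
-- with t₀ = t₁ = 1, makes sense, and β is a ring homomorphism.  Its kernel is as small as possible:
-- modulo 𝓙 = ⟨t₀ - 1, t₁ - 1⟩, every element of 𝓡 is a difference 𝕊 X - 𝕊 Y, and β (𝕊 X) = β (𝕊 Y)
-- implies that X and Y are equivalent for every equinumerosity, and that 𝕊 X = 𝕊 Y modulo 𝓙.
-- For the latter, replacing each a in X by 0ᵏ 1 a, where k may depend on a, gives an equivalent set:
-- with U = {0ʲ 1 a : j < k(a)} one has 1 X ∪ 0 U = U ∪ {0ᵏ⁽ᵃ⁾ 1 a : a ∈ X}, and U cancels.  So sets of
-- words with the same letters ≥ 2 can be padded to permutations of each other; and the prefix code
-- 0ᵏ 1 a with k the length of a makes any two sets multipliable.
-- As β P, for P in 𝓡⁺, is β (𝕊 Z) for some non-empty Z, the positive elements are the classes of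
-- the 𝕊 Z.  An equinumerosity then corresponds to the ideal of all S that are 𝕊 X - 𝕊 Y modulo 𝓙
-- for some X ≈ Y.
module Submission where

open import Defs
open import Algebra.Bundles using (CommutativeRing; RawMonoid)
import Algebra.Morphism.MonoidMonomorphism as MonoidMonomorphism
open import Algebra.Morphism.Structures using (module MonoidMorphisms)
import Algebra.Properties.Ring as RingProperties
open import Algebra.Structures using (IsCommutativeSemiring)
open import Algebra.Structures.Biased using (module IsCommutativeSemiringˡ; IsCommutativeSemiringˡ)
open import Axiom.ExcludedMiddle using (ExcludedMiddle)
open import Data.Bool.Base using (true; false; T; not)
open import Data.Bool.Properties using (T-∧; T-∨; T?)
open import Data.Empty using (⊥-elim)
open import Data.Integer.Base using (ℤ; +_; -[1+_]; +≤+; 0ℤ; 1ℤ; ∣_∣)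
  renaming (_+_ to _+ᶻ_; _*_ to _*ᶻ_; -_ to -ᶻ_; _≤_ to _≤ᶻ_)
import Data.Integer.Properties as ℤₚ
open import Data.List.Base using (List; []; _∷_; _++_; _∷ʳ_; length; drop; map; filter; upTo; applyUpTo;
  cartesianProduct; replicate; take)
import Data.List.Properties as Listₚ
open import Data.List.Membership.Propositional using () renaming (_∈_ to _∈ˡ_)
open import Data.List.Membership.Propositional.Properties
open import Data.List.Relation.Binary.Permutation.Propositional using (_↭_; ↭-refl; ↭-sym; ↭-trans; prep)
import Data.List.Relation.Binary.Permutation.Propositional.Properties as Permₚ
open import Data.List.Relation.Unary.All as All using (All; []; _∷_)
import Data.List.Relation.Unary.All.Properties as Allₚ
open import Data.List.Relation.Unary.AllPairs using ([]; _∷_)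
open import Data.List.Relation.Unary.Any using (here; there)
open import Data.List.Relation.Unary.Unique.Propositional using (Unique)
import Data.List.Relation.Unary.Unique.Propositional.Properties as Uniqueₚ
open import Data.Maybe.Base using (nothing)
open import Data.Nat.Base using (ℕ; zero; suc; pred; _+_; _*_; _∸_; _⊔_; _⊓_; _≤_; _<_; z≤n; s≤s; _!)
open import Data.Nat.ListAction using (sum; product)
import Data.Nat.Properties as ℕₚ
open import Data.Product using (Σ; ∃; ∃₂; ∃!; _×_; _,_; proj₁; proj₂)
open import Data.Sum.Base as Sum using (_⊎_; inj₁; inj₂; [_,_]′)
open import Function.Base using (_∘_; id; case_of_; flip)
open import Function.Bundles using (Bijection; Equivalence; _⇔_; mk⇔)
open import Level using (0ℓ)
open import Relation.Binary.Bundles using (Setoid)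
open import Relation.Binary.Core using (Rel)
open import Relation.Binary.Definitions using (Tri; tri<; tri≈; tri>; Trichotomous)
open import Relation.Binary.PropositionalEquality
  using (_≡_; _≢_; refl; sym; trans; cong; cong₂; subst; subst₂; module ≡-Reasoning)
import Relation.Binary.Reasoning.Setoid as SetoidReasoning
open import Relation.Binary.Structures using (IsEquivalence)
open import Relation.Nullary.Decidable
  using (Dec; yes; no; ⌊_⌋; toWitness; fromWitness; dec-false; isYes≗does; _×-dec_)
open import Relation.Nullary.Negation using (¬_; contradiction)
open import Relation.Unary using (Pred; _∈_; _∉_; _⊆_; _⊂_; _≐_; _⊥_)
open import Tactic.RingSolver using (solve-∀)
open import Tactic.RingSolver.Core.AlmostCommutativeRing using (AlmostCommutativeRing; fromCommutativeRing)

open Equivalence using (to; from)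

-- With every variable at 1 a coefficient would be an infinite sum, so only finitely many variables
-- can be sent to 1. Two are chosen because padding uses two letters, a repeated one and a different
-- one that ends the run, and both have to be invisible in the quotient. Exchanging their roles in a
-- second padding equalises the other letter too. No multinomial bound holds throughout `𝓡`, so a
-- positive series may have more terms with a given monomial than there are words. Once t₀ is 1,
-- runs of 0 distinguish arbitrarily many words with the same remaining letters, and finiteness in
-- every finite set of variables is the only condition left; it passes to products. Cancellation is
-- applied to three relations: an equinumerosity, congruence of characteristic series modulo `𝓙`,
-- and congruence modulo a gauge ideal. Modulo `𝓙` trichotomy fails: the difference of t₂ and t₃
-- keeps coefficients of both signs under `β`, so it is neither zero nor plus or minus a positive
-- class. Hence these arguments rest on a separate, weaker set of axioms.

private
  variable
    A B : Set

-- Finite cardinalities and their arithmetic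

unique-⊆⇒length-≤ : ∀ {xs ys : List A} → Unique xs → (∀ {x} → x ∈ˡ xs → x ∈ˡ ys) →
                    length xs ≤ length ys
unique-⊆⇒length-≤ {xs = []}     _          _  = z≤n
unique-⊆⇒length-≤ {xs = x ∷ xs} (x∉ ∷ uxs) xs⊆ with ∈-∃++ (xs⊆ (here refl))
... | us , vs , refl = ℕₚ.≤-trans (s≤s (unique-⊆⇒length-≤ uxs rest)) (ℕₚ.≤-reflexive len)
  where
  rest : ∀ {y} → y ∈ˡ xs → y ∈ˡ us ++ vs
  rest y∈ with ∈-++⁻ us (xs⊆ (there y∈))
  ... | inj₁ y∈us         = ∈-++⁺ˡ y∈us
  ... | inj₂ (here refl)  = ⊥-elim (All.lookup x∉ y∈ refl)
  ... | inj₂ (there y∈vs) = ∈-++⁺ʳ us y∈vs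

  len : suc (length (us ++ vs)) ≡ length (us ++ x ∷ vs)
  len = begin
    suc (length (us ++ vs))         ≡⟨ cong suc (Listₚ.length-++ us) ⟩
    suc (length us + length vs)     ≡⟨ ℕₚ.+-suc (length us) (length vs) ⟨
    length us + suc (length vs)     ≡⟨ Listₚ.length-++ us ⟨
    length (us ++ x ∷ vs)           ∎
    where open ≡-Reasoning

unique-map : ∀ {xs : List A} (f : A → B) → (∀ {x y} → x ∈ˡ xs → y ∈ˡ xs → f x ≡ f y → x ≡ y) →
             Unique xs → Unique (map f xs)
unique-map {xs = []}     f inj _          = []
unique-map {xs = x ∷ xs} f inj (x∉ ∷ uxs) =
  Allₚ.map⁺ (All.tabulate λ y∈ eq → All.lookup x∉ y∈ (inj (here refl) (there y∈) eq))
  ∷ unique-map f (λ x∈ y∈ → inj (there x∈) (there y∈)) uxs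

-- The cardinality is an integer so that coefficients of series can be read as sizes directly. The
-- enumeration is kept as data because matchings and selected sets later pick words from it by
-- position.
record Size {A : Set} (P : Pred A 0ℓ) (z : ℤ) : Set where
  field
    elements : List A
    unique   : Unique elements
    size     : + length elements ≡ z
    ∈⇔       : ∀ x → x ∈ˡ elements ⇔ P x

open Size public

module _ {P : Pred A 0ℓ} {Q : Pred B 0ℓ} (f : A → B) (f∈ : ∀ {x} → P x → Q (f x))
         (f-inj : ∀ {x y} → P x → P y → f x ≡ f y → x ≡ y) where

  Size-≤ : ∀ {m n} → Size P m → Size Q n → m ≤ᶻ n
  Size-≤ p q = subst₂ _≤ᶻ_ (trans (cong +_ (Listₚ.length-map f (elements p))) (size p)) (size q)
    (+≤+ (unique-⊆⇒length-≤
      (unique-map f (λ x∈ y∈ → f-inj (to (∈⇔ p _) x∈) (to (∈⇔ p _) y∈)) (unique p))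
      λ y∈ → case ∈-map⁻ f y∈ of λ { (x , x∈ , refl) → from (∈⇔ q _) (f∈ (to (∈⇔ p x) x∈)) }))

  Size-map : (∀ y → Q y → ∃ λ x → P x × f x ≡ y) → ∀ {n} → Size P n → Size Q n
  Size-map surj p = record
    { elements = map f (elements p)
    ; unique   = unique-map f (λ x∈ y∈ → f-inj (to (∈⇔ p _) x∈) (to (∈⇔ p _) y∈)) (unique p)
    ; size     = trans (cong +_ (Listₚ.length-map f (elements p))) (size p)
    ; ∈⇔       = λ y → mk⇔
        (λ y∈ → case ∈-map⁻ f y∈ of λ { (x , x∈ , refl) → f∈ (to (∈⇔ p x) x∈) })
        (λ qy → case surj y qy of λ { (x , px , refl) → ∈-map⁺ f (from (∈⇔ p x) px) })
    }

module _ {P Q : Pred A 0ℓ} where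

  Size-cong : P ≐ Q → ∀ {n} → Size P n → Size Q n
  Size-cong (P⊆Q , Q⊆P) p = record
    { elements = elements p ; unique = unique p ; size = size p
    ; ∈⇔ = λ x → mk⇔ (λ x∈ → P⊆Q (to (∈⇔ p x) x∈)) (λ qx → from (∈⇔ p x) (Q⊆P qx))
    }

  Size-unique : P ≐ Q → ∀ {m n} → Size P m → Size Q n → m ≡ n
  Size-unique (P⊆Q , Q⊆P) p q = ℤₚ.≤-antisym
    (Size-≤ id P⊆Q (λ _ _ e → e) p q) (Size-≤ id Q⊆P (λ _ _ e → e) q p)

  Size-⊎ : P ⊥ Q → ∀ {m n} → Size P m → Size Q n → Size (λ x → P x ⊎ Q x) (m +ᶻ n)
  Size-⊎ P⊥Q p q = record
    { elements = elements p ++ elements q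
    ; unique   = Uniqueₚ.++⁺ (unique p) (unique q)
                   (λ (x∈p , x∈q) → P⊥Q (to (∈⇔ p _) x∈p , to (∈⇔ q _) x∈q))
    ; size     = trans (cong +_ (Listₚ.length-++ (elements p)))
                   (trans (ℤₚ.pos-+ (length (elements p)) _) (cong₂ _+ᶻ_ (size p) (size q)))
    ; ∈⇔       = λ x → mk⇔
        (λ x∈ → case ∈-++⁻ (elements p) x∈ of λ
          { (inj₁ x∈p) → inj₁ (to (∈⇔ p x) x∈p) ; (inj₂ x∈q) → inj₂ (to (∈⇔ q x) x∈q) })
        λ { (inj₁ px) → ∈-++⁺ˡ (from (∈⇔ p x) px)
          ; (inj₂ qx) → ∈-++⁺ʳ (elements p) (from (∈⇔ q x) qx) }
    }

length-cartesianProduct : ∀ (xs : List A) (ys : List B) →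
                          length (cartesianProduct xs ys) ≡ length xs * length ys
length-cartesianProduct []       ys = refl
length-cartesianProduct (x ∷ xs) ys = trans (Listₚ.length-++ (map (x ,_) ys))
  (cong₂ _+_ (Listₚ.length-map (x ,_) ys) (length-cartesianProduct xs ys))

Size-× : ∀ {P : Pred A 0ℓ} {Q : Pred B 0ℓ} {m n} → Size P m → Size Q n →
         Size (λ (x , y) → P x × Q y) (m *ᶻ n)
Size-× p q = record
  { elements = cartesianProduct (elements p) (elements q)
  ; unique   = Uniqueₚ.cartesianProduct⁺ (unique p) (unique q)
  ; size     = trans (cong +_ (length-cartesianProduct (elements p) (elements q)))
                 (trans (ℤₚ.pos-* (length (elements p)) _) (cong₂ _*ᶻ_ (size p) (size q)))
  ; ∈⇔       = λ (x , y) → mk⇔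
      (λ xy∈ → case ∈-cartesianProduct⁻ (elements p) (elements q) xy∈ of λ
        (x∈ , y∈) → to (∈⇔ p x) x∈ , to (∈⇔ q y) y∈)
      (λ (px , qy) → ∈-cartesianProduct⁺ (from (∈⇔ p x) px) (from (∈⇔ q y) qy))
  }

Size-∅ : ∀ {P : Pred A 0ℓ} → (∀ x → ¬ P x) → Size P 0ℤ
Size-∅ ¬P = record
  { elements = [] ; unique = [] ; size = refl ; ∈⇔ = λ x → mk⇔ (λ ()) (λ px → ⊥-elim (¬P x px)) }

Size-singleton : ∀ (x : A) → Size (_≡ x) 1ℤ
Size-singleton x = record
  { elements = x ∷ [] ; unique = [] ∷ [] ; size = refl
  ; ∈⇔ = λ y → mk⇔ (λ { (here e) → e ; (there ()) }) here }

Size-empty⇒0 : ∀ {P : Pred A 0ℓ} {z} → (∀ x → ¬ P x) → Size P z → z ≡ 0ℤ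
Size-empty⇒0 ¬P p = Size-unique (id , id) p (Size-∅ ¬P)

Size-≥0 : ∀ {P : Pred A 0ℓ} {z} → Size P z → 0ℤ ≤ᶻ z
Size-≥0 p = subst (0ℤ ≤ᶻ_) (size p) (+≤+ z≤n)

Size-0⇒empty : ∀ {P : Pred A 0ℓ} → Size P 0ℤ → ∀ x → ¬ P x
Size-0⇒empty p x px with elements p | size p | from (∈⇔ p x) px
... | _ ∷ _ | () | here _
... | _ ∷ _ | () | there _

-- A bijection between two finite fibres of equal size, given by position in their enumerations. The
-- fallback value makes it a total function on tuples.
transport : List Tuple → List Tuple → Tuple → Tuple
transport (x ∷ xs) (y ∷ ys) a with Listₚ.≡-dec ℕₚ._≟_ a x
... | yes _ = y
... | no  _ = transport xs ys a
transport _ _ a = a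

transport-∈ : ∀ xs ys {a} → length xs ≡ length ys → a ∈ˡ xs → transport xs ys a ∈ˡ ys
transport-∈ (x ∷ xs) (y ∷ ys) {a} l a∈ with Listₚ.≡-dec ℕₚ._≟_ a x | a∈
... | yes _ | _         = here refl
... | no a≢ | here a≡   = contradiction a≡ a≢
... | no _  | there a∈′ = there (transport-∈ xs ys (ℕₚ.suc-injective l) a∈′)

transport-inverse : ∀ xs ys {a} → length xs ≡ length ys → Unique ys → a ∈ˡ xs →
                    transport ys xs (transport xs ys a) ≡ a
transport-inverse (x ∷ xs) (y ∷ ys) {a} l (y∉ ∷ uys) a∈ with Listₚ.≡-dec ℕₚ._≟_ a x | a∈
... | yes refl | _ with Listₚ.≡-dec ℕₚ._≟_ y y
...   | yes _  = refl
...   | no y≢  = contradiction refl y≢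
transport-inverse (x ∷ xs) (y ∷ ys) {a} l (y∉ ∷ uys) a∈ | no a≢ | here a≡ = contradiction a≡ a≢
transport-inverse (x ∷ xs) (y ∷ ys) {a} l (y∉ ∷ uys) a∈ | no a≢ | there a∈′
  with Listₚ.≡-dec ℕₚ._≟_ (transport xs ys a) y
... | yes e = contradiction (sym e) (All.lookup y∉ (transport-∈ xs ys (ℕₚ.suc-injective l) a∈′))
... | no  _ = transport-inverse xs ys (ℕₚ.suc-injective l) uys a∈′

-- Words, letter counts and exponent sequences

occ-++ : ∀ i x y → occurrences i (x ++ y) ≡ occurrences i x + occurrences i y
occ-++ i x y = trans (cong length (Listₚ.filter-++ (i ℕₚ.≟_) x y))
  (Listₚ.length-++ (filter (i ℕₚ.≟_) x))

occ-∷ : ∀ i y x → occurrences i (y ∷ x) ≡ occurrences i (y ∷ []) + occurrences i x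
occ-∷ i y x = occ-++ i (y ∷ []) x

occ-same : ∀ n → occurrences n (n ∷ []) ≡ 1
occ-same n = cong length (Listₚ.filter-accept (n ℕₚ.≟_) refl)

occ-other : ∀ {i n} → i ≢ n → occurrences i (n ∷ []) ≡ 0
occ-other {i} i≢n = cong length (Listₚ.filter-reject (i ℕₚ.≟_) i≢n)

occ-replicate-same : ∀ k n → occurrences n (replicate k n) ≡ k
occ-replicate-same zero    n = refl
occ-replicate-same (suc k) n = trans (occ-∷ n n (replicate k n)) (cong₂ _+_ (occ-same n) (occ-replicate-same k n))

occ-replicate-other : ∀ k {i n} → i ≢ n → occurrences i (replicate k n) ≡ 0
occ-replicate-other zero    i≢n = refl
occ-replicate-other (suc k) {i} {n} i≢n =
  trans (occ-∷ i n (replicate k n)) (cong₂ _+_ (occ-other i≢n) (occ-replicate-other k i≢n))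

∈⇒occ>0 : ∀ {i} x → i ∈ˡ x → 0 < occurrences i x
∈⇒occ>0 {i} (y ∷ x) (here refl) =
  subst (0 <_) (sym (trans (occ-∷ i i x) (cong (_+ occurrences i x) (occ-same i)))) (s≤s z≤n)
∈⇒occ>0 {i} (y ∷ x) (there i∈x) =
  subst (0 <_) (sym (occ-∷ i y x)) (ℕₚ.≤-trans (∈⇒occ>0 x i∈x) (ℕₚ.m≤n+m _ _))

occ>0⇒∈ : ∀ {i} x → 0 < occurrences i x → i ∈ˡ x
occ>0⇒∈ {i} (y ∷ x) p with i ℕₚ.≟ y
... | yes refl = here refl
... | no  i≢y  = there (occ>0⇒∈ x (subst (0 <_) (trans (occ-∷ i y x) (cong (_+ occurrences i x) (occ-other i≢y))) p))

All-<⇒occ≡0 : ∀ {k i} x → All (_< k) x → k ≤ i → occurrences i x ≡ 0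
All-<⇒occ≡0 {k} {i} x x< k≤i with occurrences i x in eq
... | zero  = refl
... | suc _ = ⊥-elim (ℕₚ.<-irrefl refl (ℕₚ.<-≤-trans
  (All.lookup x< (occ>0⇒∈ x (subst (0 <_) (sym eq) (s≤s z≤n)))) k≤i))

↭⇒occ≡ : ∀ {x y} → x ↭ y → ∀ i → occurrences i x ≡ occurrences i y
↭⇒occ≡ p i = Permₚ.↭-length (Permₚ.filter-↭ (i ℕₚ.≟_) p)

occ≡⇒↭ : ∀ x y → (∀ i → occurrences i x ≡ occurrences i y) → x ↭ y
occ≡⇒↭ []      []      e = ↭-refl
occ≡⇒↭ []      (b ∷ y) e = ⊥-elim (ℕₚ.<-irrefl (e b) (∈⇒occ>0 (b ∷ y) (here refl)))
occ≡⇒↭ (a ∷ x) y       e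
  with ∈-∃++ (occ>0⇒∈ y (subst (0 <_) (e a) (∈⇒occ>0 (a ∷ x) (here refl))))
... | us , vs , refl = ↭-trans (prep a (occ≡⇒↭ x (us ++ vs) e′)) (↭-sym (Permₚ.shift a us vs))
  where
  e′ : ∀ i → occurrences i x ≡ occurrences i (us ++ vs)
  e′ i = ℕₚ.+-cancelˡ-≡ (occurrences i (a ∷ [])) _ _ (begin
    occurrences i (a ∷ []) + occurrences i x          ≡⟨ occ-∷ i a x ⟨
    occurrences i (a ∷ x)                             ≡⟨ e i ⟩
    occurrences i (us ++ a ∷ vs)                      ≡⟨ ↭⇒occ≡ (Permₚ.shift a us vs) i ⟩
    occurrences i (a ∷ us ++ vs)                      ≡⟨ occ-∷ i a (us ++ vs) ⟩
    occurrences i (a ∷ []) + occurrences i (us ++ vs) ∎)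
    where open ≡-Reasoning

infix 4 _∼_
-- The counts form a function rather than a list, so that dropping coordinates is composition with
-- `suc` and concatenating words is pointwise addition.
_∼_ : (ℕ → ℕ) → 𝐀 → Set
κ ∼ a = ∀ i → κ i ≡ a ‼ i

occs : Tuple → ℕ → ℕ
occs x i = occurrences i x

‼-beyond : ∀ a {i} → length a ≤ i → a ‼ i ≡ 0
‼-beyond []      _         = refl
‼-beyond (n ∷ a) (s≤s l≤i) = ‼-beyond a l≤i

decr : ℕ → 𝐀 → 𝐀
decr _       []      = []
decr zero    (n ∷ a) = pred n ∷ a
decr (suc y) (n ∷ a) = n ∷ decr y a

‼-decr : ∀ y a → 0 < a ‼ y → ∀ i → a ‼ i ≡ occurrences i (y ∷ []) + decr y a ‼ i
‼-decr y a a> i with i ℕₚ.≟ y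
... | yes refl = trans (same y a a>) (cong (_+ decr y a ‼ y) (sym (occ-same y)))
  where
  same : ∀ y a → 0 < a ‼ y → a ‼ y ≡ suc (decr y a ‼ y)
  same zero    (suc n ∷ a) _  = refl
  same (suc y) (n ∷ a)     a> = same y a a>
... | no i≢y = trans (other y a i i≢y) (cong (_+ decr y a ‼ i) (sym (occ-other i≢y)))
  where
  other : ∀ y a i → i ≢ y → a ‼ i ≡ decr y a ‼ i
  other y       []      i       _   = refl
  other zero    (n ∷ a) zero    i≢y = contradiction refl i≢y
  other zero    (n ∷ a) (suc i) _   = refl
  other (suc y) (n ∷ a) zero    _   = refl
  other (suc y) (n ∷ a) (suc i) i≢y = other y a i (i≢y ∘ cong suc)

sum-decr : ∀ y a → 0 < a ‼ y → sum a ≡ suc (sum (decr y a))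
sum-decr zero    (suc n ∷ a) _  = refl
sum-decr (suc y) (n ∷ a)     a> = trans (cong (_+_ n) (sum-decr y a a>)) (ℕₚ.+-suc n _)

∼-decr : ∀ y x a → occs (y ∷ x) ∼ a → 0 < a ‼ y × occs x ∼ decr y a
∼-decr y x a e = a> , λ i → ℕₚ.+-cancelˡ-≡ (occurrences i (y ∷ [])) _ _
  (trans (sym (occ-∷ i y x)) (trans (e i) (‼-decr y a a> i)))
  where a> = subst (0 <_) (e y) (∈⇒occ>0 (y ∷ x) (here refl))

∼-∷ : ∀ y x a → 0 < a ‼ y → occs x ∼ decr y a → occs (y ∷ x) ∼ a
∼-∷ y x a a> e i = trans (occ-∷ i y x) (trans (cong (_+_ (occurrences i (y ∷ []))) (e i)) (sym (‼-decr y a a> i)))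

sum≡0⇒‼≡0 : ∀ a → sum a ≡ 0 → ∀ i → a ‼ i ≡ 0
sum≡0⇒‼≡0 []      _ i       = refl
sum≡0⇒‼≡0 (n ∷ a) e zero    = ℕₚ.m+n≡0⇒m≡0 n e
sum≡0⇒‼≡0 (n ∷ a) e (suc i) = sum≡0⇒‼≡0 a (ℕₚ.m+n≡0⇒n≡0 n e) i

‼≡0⇒sum≡0 : ∀ a → (∀ i → a ‼ i ≡ 0) → sum a ≡ 0
‼≡0⇒sum≡0 []      e = refl
‼≡0⇒sum≡0 (n ∷ a) e = cong₂ _+_ (e 0) (‼≡0⇒sum≡0 a (e ∘ suc))

occs∼⇒length : ∀ x a → occs x ∼ a → length x ≡ sum a
occs∼⇒length []      a e = sym (‼≡0⇒sum≡0 a (sym ∘ e))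
occs∼⇒length (y ∷ x) a e with ∼-decr y x a e
... | a> , e′ = trans (cong suc (occs∼⇒length x (decr y a) e′)) (sym (sum-decr y a a>))

occs∼⇒All< : ∀ x a → occs x ∼ a → All (_< length a) x
occs∼⇒All< x a e = All.tabulate λ {i} i∈x → ℕₚ.≰⇒> λ l≤i →
  ℕₚ.<-irrefl (sym (trans (e i) (‼-beyond a l≤i))) (∈⇒occ>0 x i∈x)

-- Coefficients as numbers of words

words-unique : ∀ k n → Unique (words k n)
words-unique k zero    = [] ∷ []
words-unique k (suc n) =
  Uniqueₚ.cartesianProductWith⁺ _∷_ Listₚ.∷-injective (Uniqueₚ.upTo⁺ k) (words-unique k n)

∈-words⁺ : ∀ k x → All (_< k) x → x ∈ˡ words k (length x)
∈-words⁺ k []      _          = here refl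
∈-words⁺ k (y ∷ x) (y< ∷ x<) = ∈-cartesianProductWith⁺ _∷_ (∈-upTo⁺ y<) (∈-words⁺ k x x<)

∈-words⁻ : ∀ k n {x} → x ∈ˡ words k n → All (_< k) x
∈-words⁻ k zero    (here refl) = []
∈-words⁻ k (suc n) x∈ with ∈-cartesianProductWith⁻ _∷_ (upTo k) (words k n) x∈
... | y , x′ , y∈ , x′∈ , refl = ∈-upTo⁻ y∈ ∷ ∈-words⁻ k n x′∈

applyUpTo⇒‼ : ∀ (f : ℕ → ℕ) a → applyUpTo f (length a) ≡ a → ∀ {i} → i < length a → f i ≡ a ‼ i
applyUpTo⇒‼ f (n ∷ a) e {zero}  _         = Listₚ.∷-injectiveˡ e
applyUpTo⇒‼ f (n ∷ a) e {suc i} (s≤s i<) = applyUpTo⇒‼ (f ∘ suc) a (Listₚ.∷-injectiveʳ e) i<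

‼⇒applyUpTo : ∀ (f : ℕ → ℕ) a → f ∼ a → applyUpTo f (length a) ≡ a
‼⇒applyUpTo f []      e = refl
‼⇒applyUpTo f (n ∷ a) e = cong₂ _∷_ (e 0) (‼⇒applyUpTo (f ∘ suc) a (e ∘ suc))

-- Says that f is the generating function of P with weights κ. The objects are of any type because a
-- Cauchy product counts pairs before it counts words.
Counts : (κ : A → ℕ → ℕ) → Pred A 0ℓ → (𝐀 → ℤ) → Set
Counts κ P f = ∀ a → Size (λ x → P x × κ x ∼ a) (f a)

Counts-unique : ∀ {κ : A → ℕ → ℕ} {P Q f g} → P ≐ Q → Counts κ P f → Counts κ Q g → ∀ a → f a ≡ g a
Counts-unique (P⊆Q , Q⊆P) p q a =
  Size-unique ((λ (px , e) → P⊆Q px , e) , (λ (qx , e) → Q⊆P qx , e)) (p a) (q a)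

Counts-⊎ : ∀ {κ : A → ℕ → ℕ} {P Q f g} → P ⊥ Q → Counts κ P f → Counts κ Q g →
           Counts κ (λ x → P x ⊎ Q x) (λ a → f a +ᶻ g a)
Counts-⊎ P⊥Q p q a = Size-cong
  ((λ { (inj₁ (px , e)) → inj₁ px , e ; (inj₂ (qx , e)) → inj₂ qx , e })
  , (λ { (inj₁ px , e) → inj₁ (px , e) ; (inj₂ qx , e) → inj₂ (qx , e) }))
  (Size-⊎ (λ ((px , _) , (qx , _)) → P⊥Q (px , qx)) (p a) (q a))

-- For a trimmed exponent the length bounds the letters and the sum is the length of the word, so
-- `words` contains every word with that exponent.
char-counts : ∀ X → Counts occs ⟦ X ⟧ (coeff (char X))
char-counts X a = record
  { elements = filter good? (words (length b) (sum b))
  ; unique   = Uniqueₚ.filter⁺ good? (words-unique (length b) (sum b))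
  ; size     = refl
  ; ∈⇔       = λ x → mk⇔ (sound x) (complete x)
  }
  where
  b = trim a
  good? = λ x → Listₚ.≡-dec ℕₚ._≟_ (applyUpTo (λ i → occurrences i x) (length b)) b ×-dec T? (χ X x)

  sound : ∀ x → x ∈ˡ filter good? (words (length b) (sum b)) → T (χ X x) × occs x ∼ a
  sound x x∈ with ∈-filter⁻ good? {xs = words (length b) (sum b)} x∈
  ... | x∈w , e , x∈X = x∈X , λ i → trans (eq i) (trim-‼ a i)
    where
    eq : occs x ∼ b
    eq i with i ℕₚ.<? length b
    ... | yes i< = applyUpTo⇒‼ (occs x) b e i<
    ... | no  i≮ = trans (All-<⇒occ≡0 x (∈-words⁻ (length b) (sum b) x∈w) (ℕₚ.≮⇒≥ i≮))
                         (sym (‼-beyond b (ℕₚ.≮⇒≥ i≮)))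

  complete : ∀ x → T (χ X x) × occs x ∼ a → x ∈ˡ filter good? (words (length b) (sum b))
  complete x (x∈X , e) = ∈-filter⁺ good?
    (subst (λ n → x ∈ˡ words (length b) n) (occs∼⇒length x b e′)
      (∈-words⁺ (length b) x (occs∼⇒All< x b e′)))
    (‼⇒applyUpTo (occs x) b e′ , x∈X)
    where
    e′ : occs x ∼ b
    e′ i = trans (e i) (sym (trim-‼ a i))

t^-counts : ∀ x u → occs x ∼ u → Counts occs (_≡ x) (coeff (t^ u))
t^-counts x u x∼u a with Listₚ.≡-dec ℕₚ._≟_ (trim u) (trim a)
... | yes e = Size-cong ((λ { refl → refl , λ i → trans (x∼u i) (u≋a i) }) , proj₁) (Size-singleton x)
  where
  u≋a : u ≋ a
  u≋a i = trans (sym (trim-‼ u i)) (trans (cong (_‼ i) e) (trim-‼ a i))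
... | no ¬e = Size-∅ λ { _ (refl , x∼a) → ¬e (trim-resp {u} {a} λ i → trans (sym (x∼u i)) (x∼a i)) }

1ˢ-counts : Counts occs (_≡ []) (coeff 1ˢ)
1ˢ-counts = t^-counts [] [] (λ _ → refl)

t-counts : ∀ n → Counts occs (_≡ n ∷ []) (coeff (proj₁ (t n)))
t-counts n = t^-counts (n ∷ []) (unit n) (go n)
  where
  unit-same : ∀ n → unit n ‼ n ≡ 1
  unit-same zero    = refl
  unit-same (suc n) = unit-same n

  unit-other : ∀ n i → i ≢ n → unit n ‼ i ≡ 0
  unit-other zero    zero    i≢n = contradiction refl i≢n
  unit-other zero    (suc i) i≢n = refl
  unit-other (suc n) zero    i≢n = refl
  unit-other (suc n) (suc i) i≢n = unit-other n i (i≢n ∘ cong suc)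

  go : ∀ n → occs (n ∷ []) ∼ unit n
  go n i with i ℕₚ.≟ n
  ... | yes refl = trans (occ-same n) (sym (unit-same n))
  ... | no  i≢n  = trans (occ-other i≢n) (sym (unit-other n i i≢n))

char-｛｝ : ∀ n → char ｛ n ｝ʷ ≈ˢ proj₁ (t n)
char-｛｝ n = Counts-unique ((λ {x} → toWitness {a? = Listₚ.≡-dec ℕₚ._≟_ x (n ∷ [])})
  , (λ {x} → fromWitness {a? = Listₚ.≡-dec ℕₚ._≟_ x (n ∷ [])})) (char-counts ｛ n ｝ʷ) (t-counts n)

-- Partition by the value of u. The step splits off the class with u equal to 0 and lowers u on the
-- rest, where `pred` loses nothing because u is positive.
antidiag-Size : ∀ n (u v : A → ℕ) (P : Pred A 0ℓ) {h} →
                (∀ i j → i + j ≡ n → Size (λ x → P x × u x ≡ i × v x ≡ j) (h i j)) →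
                Size (λ x → P x × u x + v x ≡ n) (antidiag n h)
antidiag-Size zero u v P p = Size-cong
  ((λ {x} (px , e , e′) → px , cong₂ _+_ e e′)
  , (λ {x} (px , e) → px , ℕₚ.m+n≡0⇒m≡0 (u x) e , ℕₚ.m+n≡0⇒n≡0 (u x) e)) (p 0 0 refl)
antidiag-Size {A = A} (suc n) u v P {h} p = Size-cong
  ((λ { (inj₁ (px , e , e′)) → px , cong₂ _+_ e e′
      ; {x} (inj₂ ((px , 0<u) , e)) → px , trans (cong (_+ v x) (sym (suc-pred-u 0<u))) (cong suc e) })
  , λ {x} (px , e) → split x px e)
  (Size-⊎ (λ { ((_ , u≡0 , _) , (_ , 0<u) , _) → ℕₚ.<-irrefl (sym u≡0) 0<u }) (p 0 (suc n) refl)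
    (antidiag-Size n (pred ∘ u) v (λ x → P x × 0 < u x) λ i j e →
      Size-cong ((λ {x} (px , ei , ej) → (px , subst (0 <_) (sym ei) (s≤s z≤n)) , cong pred ei , ej)
                , (λ {x} ((px , 0<u) , ei , ej) → px , trans (sym (suc-pred-u 0<u)) (cong suc ei) , ej))
        (p (suc i) j (cong suc e))))
  where
  suc-pred-u : ∀ {x} → 0 < u x → suc (pred (u x)) ≡ u x
  suc-pred-u {x} 0<u with u x
  ... | suc _ = refl
  split : ∀ x → P x → u x + v x ≡ suc n →
          (P x × u x ≡ 0 × v x ≡ suc n) ⊎ ((P x × 0 < u x) × pred (u x) + v x ≡ n)
  split x px e with u x
  ... | zero  = inj₁ (px , refl , e)
  ... | suc m = inj₂ ((px , s≤s z≤n) , ℕₚ.suc-injective e)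

Counts-∷ : ∀ i {κ : A → ℕ → ℕ} {P f} → Counts κ P f →
           Counts (λ x → κ x ∘ suc) (λ x → P x × κ x 0 ≡ i) (f ∘ (i ∷_))
Counts-∷ i p a = Size-cong
  ((λ (px , e) → (px , e 0) , e ∘ suc) , (λ ((px , e₀) , e) → px , λ { zero → e₀ ; (suc j) → e j }))
  (p (i ∷ a))

-- Each coordinate of c contributes one `antidiag`, which distributes its value between the two
-- components. The weights stay general because peeling off a coordinate replaces them by their
-- shifts.
conv-Size : ∀ c {κ : A → ℕ → ℕ} {μ : B → ℕ → ℕ} {P : Pred A 0ℓ} {Q : Pred B 0ℓ} {f g} → Counts κ P f → Counts μ Q g →
            Size {A = A × B} (λ (x , y) → (P x × Q y) × (λ i → κ x i + μ y i) ∼ c) (conv f g c)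
conv-Size [] {κ} p q = Size-cong
  ((λ ((px , e) , (qy , e′)) → (px , qy) , λ i → cong₂ _+_ (e i) (e′ i))
  , (λ {(x , y)} ((px , qy) , e) → (px , λ i → ℕₚ.m+n≡0⇒m≡0 (κ x i) (e i))
                                 , (qy , λ i → ℕₚ.m+n≡0⇒n≡0 (κ x i) (e i))))
  (Size-× (p []) (q []))
conv-Size (n ∷ c) {κ} {μ} {P} {Q} p q = Size-cong
  ((λ (((px , qy) , e) , e₀) → (px , qy) , λ { zero → e₀ ; (suc i) → e i })
  , (λ ((px , qy) , e) → ((px , qy) , e ∘ suc) , e 0))
  (antidiag-Size n (λ (x , y) → κ x 0) (λ (x , y) → μ y 0)
    (λ (x , y) → (P x × Q y) × (λ i → κ x (suc i) + μ y (suc i)) ∼ c)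
    λ i j _ → Size-cong
      ((λ (((px , ei) , (qy , ej)) , e) → ((px , qy) , e) , ei , ej)
      , (λ (((px , qy) , e) , ei , ej) → ((px , ei) , (qy , ej)) , e))
      (conv-Size c (Counts-∷ i p) (Counts-∷ j q)))

-- Multipliability is injectivity of concatenation and turns counted pairs into counted words.
-- Predicates take the place of point sets because `Selected` below may contain the empty tuple.
conv-counts : ∀ {P Q : Pred Tuple 0ℓ} {f g} →
  (∀ {a a′ b b′} → P a → P a′ → Q b → Q b′ → a ++ b ≡ a′ ++ b′ → a ≡ a′ × b ≡ b′) →
  Counts occs P f → Counts occs Q g → Counts occs (λ x → ∃₂ λ a b → P a × Q b × x ≡ a ++ b) (conv f g)
conv-counts m p q c = Size-map (λ (a , b) → a ++ b)
  (λ {(a , b)} ((pa , qb) , e) → (a , b , pa , qb , refl) , λ i → trans (occ-++ i a b) (e i))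
  (λ ((pa , qb) , _) ((pa′ , qb′) , _) e → case m pa pa′ qb qb′ e of λ { (refl , refl) → refl })
  (λ { _ ((a , b , pa , qb , refl) , e) → (a , b) , ((pa , qb) , λ i → trans (sym (occ-++ i a b)) (e i)) , refl })
  (conv-Size c p q)

char-×ʷ : ∀ A B → Multipliable A B → char (A ×ʷ B) ≈ˢ char A *ˢ char B
char-×ʷ A B m = Counts-unique ((λ {x} → to (∈-×ʷ A B x)) , (λ {x} → from (∈-×ʷ A B x)))
  (char-counts (A ×ʷ B)) (conv-counts m (char-counts A) (char-counts B))

-- Finite sums, Cauchy products and finitary series

Σ≤ : ℕ → (ℕ → ℤ) → ℤ
Σ≤ n f = antidiag n (λ i _ → f i)

antidiag-cong-on : ∀ n {h h′ : ℕ → ℕ → ℤ} → (∀ i j → i + j ≡ n → h i j ≡ h′ i j) →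
                   antidiag n h ≡ antidiag n h′
antidiag-cong-on zero    p = p 0 0 refl
antidiag-cong-on (suc n) p =
  cong₂ _+ᶻ_ (p 0 (suc n) refl) (antidiag-cong-on n λ i j e → p (suc i) j (cong suc e))

antidiag-vanish : ∀ n {h : ℕ → ℕ → ℤ} → (∀ i j → i + j ≡ n → h i j ≡ 0ℤ) → antidiag n h ≡ 0ℤ
antidiag-vanish n p = trans (antidiag-cong-on n p) (antidiag-0 n)

Σ≤-cong : ∀ n {f g : ℕ → ℤ} → (∀ i → f i ≡ g i) → Σ≤ n f ≡ Σ≤ n g
Σ≤-cong n p = antidiag-cong n (λ i _ → p i)

Σ≤-vanish : ∀ n {f : ℕ → ℤ} → (∀ i → f i ≡ 0ℤ) → Σ≤ n f ≡ 0ℤ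
Σ≤-vanish n p = antidiag-vanish n (λ i _ _ → p i)

Σ≤-extend : ∀ {m n f} → m ≤ n → (∀ i → m < i → f i ≡ 0ℤ) → Σ≤ n f ≡ Σ≤ m f
Σ≤-extend {zero}  {zero}  _         p = refl
Σ≤-extend {zero}  {suc n} {f} _     p =
  trans (cong (f 0 +ᶻ_) (Σ≤-vanish n λ i → p (suc i) (s≤s z≤n))) (ℤₚ.+-identityʳ _)
Σ≤-extend {suc m} {suc n} {f} (s≤s m≤n) p = cong (f 0 +ᶻ_) (Σ≤-extend m≤n λ i m<i → p (suc i) (s≤s m<i))

Σ≤-neg : ∀ n f → Σ≤ n (λ i → -ᶻ f i) ≡ -ᶻ Σ≤ n f
Σ≤-neg zero    f = refl
Σ≤-neg (suc n) f = trans (cong (-ᶻ f 0 +ᶻ_) (Σ≤-neg n (f ∘ suc))) (sym (ℤₚ.neg-distrib-+ (f 0) _))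

Σ≤-≥0 : ∀ n {f : ℕ → ℤ} → (∀ i → 0ℤ ≤ᶻ f i) → 0ℤ ≤ᶻ Σ≤ n f
Σ≤-≥0 zero    p = p 0
Σ≤-≥0 (suc n) p = ℤₚ.+-mono-≤ (p 0) (Σ≤-≥0 n (p ∘ suc))

≥0-+≡0 : ∀ {x y} → 0ℤ ≤ᶻ x → 0ℤ ≤ᶻ y → x +ᶻ y ≡ 0ℤ → x ≡ 0ℤ × y ≡ 0ℤ
≥0-+≡0 {+ m} {+ n} _ _ e = cong +_ (ℕₚ.m+n≡0⇒m≡0 m (ℤₚ.+-injective e)) , cong +_ (ℕₚ.m+n≡0⇒n≡0 m (ℤₚ.+-injective e))

Σ≤-≡0 : ∀ n {f : ℕ → ℤ} → (∀ i → 0ℤ ≤ᶻ f i) → Σ≤ n f ≡ 0ℤ → ∀ {i} → i ≤ n → f i ≡ 0ℤ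
Σ≤-≡0 zero    p e z≤n = e
Σ≤-≡0 (suc n) p e i≤ with ≥0-+≡0 (p 0) (Σ≤-≥0 n (p ∘ suc)) e
Σ≤-≡0 (suc n) p e z≤n       | e₀ , _  = e₀
Σ≤-≡0 (suc n) p e (s≤s i≤n) | _  , e₁ = Σ≤-≡0 n (p ∘ suc) e₁ i≤n

-- The triangle of pairs with sum at most N contains the rectangle that supports h. The induction
-- removes the row with first index 0.
Σ≤-antidiag : ∀ {H H′ N} → H + H′ ≤ N → (h : ℕ → ℕ → ℤ) → (∀ i j → H < i → h i j ≡ 0ℤ) →
              (∀ i j → H′ < j → h i j ≡ 0ℤ) →
              Σ≤ N (λ n → antidiag n h) ≡ Σ≤ H (λ i → Σ≤ H′ (h i))
Σ≤-antidiag {zero} {zero} {zero} _ h p q = refl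
Σ≤-antidiag {H} {H′} {suc N} H≤ h p q = begin
  h 0 0 +ᶻ Σ≤ N (λ n → h 0 (suc n) +ᶻ antidiag n (h ∘ suc))
    ≡⟨ cong (h 0 0 +ᶻ_) (antidiag-+ N _ _) ⟩
  h 0 0 +ᶻ (Σ≤ N (h 0 ∘ suc) +ᶻ Σ≤ N (λ n → antidiag n (h ∘ suc)))
    ≡⟨ ℤₚ.+-assoc (h 0 0) _ _ ⟨
  Σ≤ (suc N) (h 0) +ᶻ Σ≤ N (λ n → antidiag n (h ∘ suc))
    ≡⟨ cong (_+ᶻ Σ≤ N (λ n → antidiag n (h ∘ suc))) (Σ≤-extend (ℕₚ.m+n≤o⇒n≤o H H≤) (q 0)) ⟩
  Σ≤ H′ (h 0) +ᶻ Σ≤ N (λ n → antidiag n (h ∘ suc))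
    ≡⟨ rest H H≤ p ⟩
  Σ≤ H (λ i → Σ≤ H′ (h i)) ∎
  where
  open ≡-Reasoning
  rest : ∀ H → H + H′ ≤ suc N → (∀ i j → H < i → h i j ≡ 0ℤ) →
         Σ≤ H′ (h 0) +ᶻ Σ≤ N (λ n → antidiag n (h ∘ suc)) ≡ Σ≤ H (λ i → Σ≤ H′ (h i))
  rest zero    _        p = trans (cong (Σ≤ H′ (h 0) +ᶻ_)
    (Σ≤-vanish N λ n → antidiag-vanish n λ i j _ → p (suc i) j (s≤s z≤n))) (ℤₚ.+-identityʳ _)
  rest (suc H) (s≤s H≤) p = cong (Σ≤ H′ (h 0) +ᶻ_)
    (Σ≤-antidiag {H} H≤ (h ∘ suc) (λ i j H<i → p (suc i) j (s≤s H<i)) (q ∘ suc))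

-- `conv` reads its factors only at lists exactly as long as c. A cutoff that depends only on the
-- length of an exponent is therefore uniform over all terms of a coefficient.
conv-cong-on : ∀ c {f f′ g g′ : 𝐀 → ℤ} →
               (∀ a → length a ≡ length c → f a ≡ f′ a) →
               (∀ a → length a ≡ length c → g a ≡ g′ a) → conv f g c ≡ conv f′ g′ c
conv-cong-on []      p q = cong₂ _*ᶻ_ (p [] refl) (q [] refl)
conv-cong-on (n ∷ c) p q = antidiag-cong n λ i j →
  conv-cong-on c (λ a e → p (i ∷ a) (cong suc e)) (λ a e → q (j ∷ a) (cong suc e))

conv-vanish : ∀ c {f g : 𝐀 → ℤ} → (∀ a b → length a ≡ length c → length b ≡ length c →
              sum a + sum b ≡ sum c → f a ≡ 0ℤ ⊎ g b ≡ 0ℤ) → conv f g c ≡ 0ℤ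
conv-vanish [] {f} {g} p with p [] [] refl refl refl
... | inj₁ e = trans (cong (_*ᶻ g []) e) (ℤₚ.*-zeroˡ (g []))
... | inj₂ e = trans (cong (f [] *ᶻ_) e) (ℤₚ.*-zeroʳ (f []))
conv-vanish (n ∷ c) p = antidiag-vanish n λ i j e → conv-vanish c λ a b la lb s →
  p (i ∷ a) (j ∷ b) (cong suc la) (cong suc lb) (trans (+-interchange i (sum a) j (sum b)) (cong₂ _+_ e s))
  where
  +-interchange : ∀ i x j y → (i + x) + (j + y) ≡ (i + j) + (x + y)
  +-interchange i x j y = trans (ℕₚ.+-assoc i x _) (trans (cong (_+_ i)
    (trans (sym (ℕₚ.+-assoc x j y)) (trans (cong (_+ y) (ℕₚ.+-comm x j)) (ℕₚ.+-assoc j x y))))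
    (sym (ℕₚ.+-assoc i j _)))

conv-Σ≤ˡ : ∀ n (F : ℕ → 𝐀 → ℤ) g c →
           conv (λ a → Σ≤ n (λ i → F i a)) g c ≡ Σ≤ n (λ i → conv (F i) g c)
conv-Σ≤ˡ n F g c = conv-antidiagˡ n (λ i _ → F i) g c

conv-Σ≤ʳ : ∀ n (F : ℕ → 𝐀 → ℤ) g c →
           conv g (λ a → Σ≤ n (λ i → F i a)) c ≡ Σ≤ n (λ i → conv g (F i) c)
conv-Σ≤ʳ n F g c = conv-antidiagʳ n (λ i _ → F i) g c

-- The finitary condition of point sets carried over to series: finitely many terms in the first n
-- variables. It holds on all of `𝓡` and, unlike the multinomial bound, is stable under products.
Finitary : (𝐀 → ℤ) → Set
Finitary f = ∀ n → ∃ λ h → ∀ a → length a ≤ n → h < sum a → f a ≡ 0ℤ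

conv-finitary : ∀ {f g} → Finitary f → Finitary g → Finitary (conv f g)
conv-finitary {f} {g} φ ψ n with φ n | ψ n
... | h , p | h′ , q = h + h′ , λ c l s → conv-vanish c λ a b la lb e →
  vanish a b (subst (_≤ n) (sym la) l) (subst (_≤ n) (sym lb) l) (subst (h + h′ <_) (sym e) s)
  where
  vanish : ∀ a b → length a ≤ n → length b ≤ n → h + h′ < sum a + sum b → f a ≡ 0ℤ ⊎ g b ≡ 0ℤ
  vanish a b la lb s with h ℕₚ.<? sum a
  ... | yes h< = inj₁ (p a la h<)
  ... | no  h≮ = inj₂ (q b lb (ℕₚ.≰⇒> λ b≤ → ℕₚ.<-irrefl refl
                   (ℕₚ.<-≤-trans s (ℕₚ.+-mono-≤ (ℕₚ.≮⇒≥ h≮) b≤))))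

+-finitary : ∀ {f g} → Finitary f → Finitary g → Finitary (λ a → f a +ᶻ g a)
+-finitary φ ψ n with φ n | ψ n
... | h , p | h′ , q = h ⊔ h′ , λ a l s → cong₂ _+ᶻ_
  (p a l (ℕₚ.≤-<-trans (ℕₚ.m≤m⊔n h h′) s)) (q a l (ℕₚ.≤-<-trans (ℕₚ.m≤n⊔m h h′) s))

neg-finitary : ∀ {f} → Finitary f → Finitary (λ a → -ᶻ f a)
neg-finitary φ n = proj₁ (φ n) , λ a l s → cong -ᶻ_ (proj₂ (φ n) a l s)

cong-finitary : ∀ {f g} → (∀ a → f a ≡ g a) → Finitary f → Finitary g
cong-finitary e φ n = proj₁ (φ n) , λ a l s → trans (sym (e a)) (proj₂ (φ n) a l s)

char-finitary : ∀ X → Finitary (coeff (char X))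
char-finitary X n with finitary X n
... | h , p = h , λ a l s → Size-empty⇒0
  (λ x (x∈X , e) → p x (subst (h <_) (sym (occs∼⇒length x a e)) s)
    (All.map (λ i< → ℕₚ.<⇒≤ (ℕₚ.<-≤-trans i< l)) (occs∼⇒All< x a e)) x∈X)
  (char-counts X a)

-- By the pigeonhole principle, a total degree above the sum of the first n degree bounds exceeds
-- one of them.
bounded-finitary : ∀ {S} → Bounded S → Finitary (coeff S)
bounded-finitary B n = total (Bounded.degree B) n , λ a l s → Bounded.degree-≤ B a (exceeds (Bounded.degree B) n a l s)
  where
  total : (ℕ → ℕ) → ℕ → ℕ
  total d zero    = 0
  total d (suc n) = d 0 + total (d ∘ suc) n

  exceeds : ∀ d n a → length a ≤ n → total d n < sum a → ∃ λ i → d i < a ‼ i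
  exceeds d (suc n) (m ∷ a) (s≤s l) s with d 0 ℕₚ.<? m
  ... | yes d<m = 0 , d<m
  ... | no  d≮m with exceeds (d ∘ suc) n a l (ℕₚ.≰⇒> λ a≤ → ℕₚ.<-irrefl refl
                       (ℕₚ.<-≤-trans s (ℕₚ.+-mono-≤ (ℕₚ.≮⇒≥ d≮m) a≤)))
  ...   | i , d<a = suc i , d<a

In𝓡-finitary : ∀ {S} → In𝓡 S → Finitary (coeff S)
In𝓡-finitary (bounded B)  = bounded-finitary B
In𝓡-finitary (char∈ X)    = char-finitary X
In𝓡-finitary (sum∈ p q)   = +-finitary (In𝓡-finitary p) (In𝓡-finitary q)
In𝓡-finitary (neg∈ p)     = neg-finitary (In𝓡-finitary p)
In𝓡-finitary (prod∈ p q)  = conv-finitary (In𝓡-finitary p) (In𝓡-finitary q)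
In𝓡-finitary (resp∈ e p)  = cong-finitary e (In𝓡-finitary p)

-- Setting variables to 1

module _ (f : 𝐀 → ℤ) (φ : Finitary f) where

  cutoff : 𝐀 → ℕ
  cutoff b = proj₁ (φ (suc (length b)))

  -- The substitution of 1 for the first variable, with the other variables renumbered. Beyond the
  -- cutoff all summands vanish, so the sum is the full one.
  bar : 𝐀 → ℤ
  bar b = Σ≤ (cutoff b) (λ i → f (i ∷ b))

  bar-cutoff : ∀ b i → cutoff b < i → f (i ∷ b) ≡ 0ℤ
  bar-cutoff b i h<i = proj₂ (φ (suc (length b))) (i ∷ b) ℕₚ.≤-refl (ℕₚ.≤-trans h<i (ℕₚ.m≤m+n i (sum b)))

  -- Frees the value from the cutoff supplied by φ, by comparing both bounds with their maximum. The
  -- algebraic rules for `bar` all pass through a bound common to the series involved.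
  bar-≡ : ∀ b {H} → (∀ i → H < i → f (i ∷ b) ≡ 0ℤ) → bar b ≡ Σ≤ H (λ i → f (i ∷ b))
  bar-≡ b {H} p = trans (sym (Σ≤-extend (ℕₚ.m≤m⊔n h H) (bar-cutoff b))) (Σ≤-extend (ℕₚ.m≤n⊔m h H) p)
    where h = cutoff b

  bar-finitary : Finitary bar
  bar-finitary n = proj₁ (φ (suc n)) , λ b l s → Σ≤-vanish (cutoff b) λ i →
    proj₂ (φ (suc n)) (i ∷ b) (s≤s l) (ℕₚ.≤-trans s (ℕₚ.m≤n+m (sum b) i))

  bar-resp : (∀ {a b} → a ≋ b → f a ≡ f b) → ∀ {a b} → a ≋ b → bar a ≡ bar b
  bar-resp r {a} {b} e = trans
    (bar-≡ a λ i h<i → trans (r {i ∷ a} {i ∷ b} (∷-resp i e)) (bar-cutoff b i h<i))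
    (Σ≤-cong (cutoff b) λ i → r {i ∷ a} {i ∷ b} (∷-resp i e))

  bar-≥0 : (∀ a → 0ℤ ≤ᶻ f a) → ∀ b → 0ℤ ≤ᶻ bar b
  bar-≥0 p b = Σ≤-≥0 (cutoff b) λ i → p (i ∷ b)

  -- Non-negative terms cannot cancel. This is what later keeps elements of `𝓡⁺` out of the kernel
  -- of `β`.
  bar-≡0 : (∀ a → 0ℤ ≤ᶻ f a) → (∀ b → bar b ≡ 0ℤ) → ∀ i b → f (i ∷ b) ≡ 0ℤ
  bar-≡0 p e i b with cutoff b ℕₚ.<? i
  ... | yes h<i = bar-cutoff b i h<i
  ... | no  h≮i = Σ≤-≡0 (cutoff b) (λ i → p (i ∷ b)) (e b) (ℕₚ.≮⇒≥ h≮i)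

  bar-counts : ∀ {κ : A → ℕ → ℕ} {P} → Counts κ P f → Counts (λ x → κ x ∘ suc) P bar
  bar-counts {κ = κ} {P} p b = Size-cong
    ((λ ((px , e) , _) → px , e) , λ {x} (px , e) → (px , e) , ℕₚ.m+[n∸m]≡n (small x px e))
    -- The complement `h ∸ κ x 0` fills the second slot, so that the sum being h only expresses that
    -- `κ x 0` is at most h, which is `small`.
    (antidiag-Size h (λ x → κ x 0) (λ x → h ∸ κ x 0) (λ x → P x × (κ x ∘ suc) ∼ b) λ i j e →
      Size-cong ((λ {x} (px , e′) → (px , e′ ∘ suc) , e′ 0 , subst (λ k → h ∸ k ≡ j) (sym (e′ 0))
                    (trans (cong (_∸ i) (sym e)) (ℕₚ.m+n∸m≡n i j)))
                , λ ((px , e′) , e₀ , _) → px , λ { zero → e₀ ; (suc k) → e′ k }) (p (i ∷ b)))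
    where
    h = cutoff b
    small : ∀ x → P x → (κ x ∘ suc) ∼ b → κ x 0 ≤ h
    small x px e = ℕₚ.≮⇒≥ λ h< → Size-0⇒empty
      (subst (Size _) (bar-cutoff b (κ x 0) h<) (p (κ x 0 ∷ b))) x (px , λ { zero → refl ; (suc k) → e k })

bar-cong : ∀ f g φ ψ → (∀ a → f a ≡ g a) → ∀ b → bar f φ b ≡ bar g ψ b
bar-cong f g φ ψ e b = trans
  (bar-≡ f φ b λ i h<i → trans (e (i ∷ b)) (bar-cutoff g ψ b i h<i)) (Σ≤-cong (cutoff g ψ b) λ i → e (i ∷ b))

bar-+ : ∀ f g φ ψ χ b → bar (λ a → f a +ᶻ g a) χ b ≡ bar f φ b +ᶻ bar g ψ b
bar-+ f g φ ψ χ b = begin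
  bar (λ a → f a +ᶻ g a) χ b                        ≡⟨ bar-≡ _ χ b (λ i H< → cong₂ _+ᶻ_ (f0 i H<) (g0 i H<)) ⟩
  Σ≤ H (λ i → f (i ∷ b) +ᶻ g (i ∷ b))               ≡⟨ antidiag-+ H _ _ ⟩
  Σ≤ H (λ i → f (i ∷ b)) +ᶻ Σ≤ H (λ i → g (i ∷ b))  ≡⟨ cong₂ _+ᶻ_ (bar-≡ f φ b f0) (bar-≡ g ψ b g0) ⟨
  bar f φ b +ᶻ bar g ψ b                            ∎
  where
  open ≡-Reasoning
  hf = cutoff f φ b
  hg = cutoff g ψ b
  H = hf ⊔ hg
  f0 : ∀ i → H < i → f (i ∷ b) ≡ 0ℤ
  f0 i H< = bar-cutoff f φ b i (ℕₚ.≤-<-trans (ℕₚ.m≤m⊔n hf hg) H<)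
  g0 : ∀ i → H < i → g (i ∷ b) ≡ 0ℤ
  g0 i H< = bar-cutoff g ψ b i (ℕₚ.≤-<-trans (ℕₚ.m≤n⊔m hf hg) H<)

bar-neg : ∀ f φ χ b → bar (λ a → -ᶻ f a) χ b ≡ -ᶻ bar f φ b
bar-neg f φ χ b = trans (bar-≡ _ χ b λ i h< → cong -ᶻ_ (bar-cutoff f φ b i h<)) (Σ≤-neg (cutoff f φ b) _)

-- Multiplicativity is a change of summation order: the sum over the exponent m of the first
-- variable in the product runs over a triangle, and becomes a sum over the rectangle given by the
-- cutoffs of the factors.
bar-conv : ∀ f g φ ψ χ c → bar (conv f g) χ c ≡ conv (bar f φ) (bar g ψ) c
bar-conv f g φ ψ χ c = begin
  bar (conv f g) χ c
    ≡⟨ bar-≡ _ χ c {hf + hg} (λ m H< → antidiag-vanish m λ i j e → beyond i j (subst (hf + hg <_) (sym e) H<)) ⟩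
  Σ≤ (hf + hg) (λ m → antidiag m h)
    ≡⟨ Σ≤-antidiag {hf} {hg} ℕₚ.≤-refl h (λ i j hf< → h-vanishˡ i j hf<) (λ i j hg< → h-vanishʳ i j hg<) ⟩
  Σ≤ hf (λ i → Σ≤ hg (h i))
    ≡⟨ Σ≤-cong hf (λ i → conv-Σ≤ʳ hg (λ j → g ∘ (j ∷_)) (f ∘ (i ∷_)) c) ⟨
  Σ≤ hf (λ i → conv (f ∘ (i ∷_)) (λ b → Σ≤ hg (λ j → g (j ∷ b))) c)
    ≡⟨ conv-Σ≤ˡ hf (λ i → f ∘ (i ∷_)) _ c ⟨
  conv (λ a → Σ≤ hf (λ i → f (i ∷ a))) (λ b → Σ≤ hg (λ j → g (j ∷ b))) c
    ≡⟨ conv-cong-on c (λ a l → bar-≡ f φ a (f0 a l)) (λ b l → bar-≡ g ψ b (g0 b l)) ⟨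
  conv (bar f φ) (bar g ψ) c ∎
  where
  open ≡-Reasoning
  hf = proj₁ (φ (suc (length c)))
  hg = proj₁ (ψ (suc (length c)))
  h : ℕ → ℕ → ℤ
  h i j = conv (f ∘ (i ∷_)) (g ∘ (j ∷_)) c
  f0 : ∀ a → length a ≡ length c → ∀ i → hf < i → f (i ∷ a) ≡ 0ℤ
  f0 a l i hf< = bar-cutoff f φ a i (subst (λ n → proj₁ (φ (suc n)) < i) (sym l) hf<)
  g0 : ∀ a → length a ≡ length c → ∀ i → hg < i → g (i ∷ a) ≡ 0ℤ
  g0 a l i hg< = bar-cutoff g ψ a i (subst (λ n → proj₁ (ψ (suc n)) < i) (sym l) hg<)
  h-vanishˡ : ∀ i j → hf < i → h i j ≡ 0ℤ
  h-vanishˡ i j hf< = conv-vanish c λ a b la lb _ → inj₁ (f0 a la i hf<)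
  h-vanishʳ : ∀ i j → hg < j → h i j ≡ 0ℤ
  h-vanishʳ i j hg< = conv-vanish c λ a b la lb _ → inj₂ (g0 b lb j hg<)
  beyond : ∀ i j → hf + hg < i + j → h i j ≡ 0ℤ
  beyond i j H< with hf ℕₚ.<? i
  ... | yes hf< = h-vanishˡ i j hf<
  ... | no  hf≮ = h-vanishʳ i j (ℕₚ.≰⇒> λ j≤ → ℕₚ.<-irrefl refl
                    (ℕₚ.<-≤-trans H< (ℕₚ.+-mono-≤ (ℕₚ.≮⇒≥ hf≮) j≤)))

bar₀ : 𝓡 → 𝐀 → ℤ
bar₀ (S , p) = bar (coeff S) (In𝓡-finitary p)

bar₀-finitary : ∀ S → Finitary (bar₀ S)
bar₀-finitary (S , p) = bar-finitary (coeff S) (In𝓡-finitary p)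

-- β S is S with t₀ = t₁ = 1, as a series in t₂, t₃, …
β : 𝓡 → 𝐀 → ℤ
β S = bar (bar₀ S) (bar₀-finitary S)

β-finitary : ∀ S → Finitary (β S)
β-finitary S = bar-finitary (bar₀ S) (bar₀-finitary S)

β-resp : ∀ S {a b} → a ≋ b → β S a ≡ β S b
β-resp (S , p) {a} {b} = bar-resp (bar₀ (S , p)) (bar₀-finitary (S , p))
  (λ {a} {b} → bar-resp (coeff S) (In𝓡-finitary p) (λ {a} {b} → coeff-resp S {a} {b}) {a} {b}) {a} {b}

-- `bar-≡0` says nothing about the empty exponent; it is the same sequence as `0 ∷ []`.
∷≡0⇒≡0 : ∀ (f : 𝐀 → ℤ) → (∀ {a b} → a ≋ b → f a ≡ f b) → (∀ i a → f (i ∷ a) ≡ 0ℤ) → ∀ a → f a ≡ 0ℤ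
∷≡0⇒≡0 f r e []      = trans (r {[]} {0 ∷ []} λ { zero → refl ; (suc _) → refl }) (e 0 [])
∷≡0⇒≡0 f r e (i ∷ a) = e i a

module _ (S : 𝓡) (S≥0 : ∀ a → 0ℤ ≤ᶻ coeff (proj₁ S) a) where

  private
    f = coeff (proj₁ S)
    φ = In𝓡-finitary (proj₂ S)

    f-resp : ∀ {a b} → a ≋ b → f a ≡ f b
    f-resp {a} {b} = coeff-resp (proj₁ S) {a} {b}

  β-≥0 : ∀ b → 0ℤ ≤ᶻ β S b
  β-≥0 = bar-≥0 (bar₀ S) (bar₀-finitary S) (bar-≥0 f φ S≥0)

  -- Applies the absence of cancellation once for each of the two substituted variables.
  β-≡0 : (∀ b → β S b ≡ 0ℤ) → ∀ a → f a ≡ 0ℤ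
  β-≡0 e = ∷≡0⇒≡0 f (λ {a} {b} → f-resp {a} {b}) λ i a → bar-≡0 f φ S≥0
    (∷≡0⇒≡0 (bar₀ S) (λ {a} {b} → bar-resp f φ (λ {a} {b} → f-resp {a} {b}) {a} {b})
      (bar-≡0 (bar₀ S) (bar₀-finitary S) (bar-≥0 f φ S≥0) e)) i a

β-counts : ∀ S {κ : A → ℕ → ℕ} {P} → Counts κ P (coeff (proj₁ S)) → Counts (λ x → κ x ∘ suc ∘ suc) P (β S)
β-counts (S , p) c = bar-counts _ (bar₀-finitary (S , p)) (bar-counts (coeff S) (In𝓡-finitary p) c)

β-cong : ∀ S S′ → S 𝓡.≈ S′ → ∀ b → β S b ≡ β S′ b
β-cong (S , p) (S′ , p′) e = bar-cong (bar₀ (S , p)) (bar₀ (S′ , p′)) (bar₀-finitary (S , p)) (bar₀-finitary (S′ , p′))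
  (bar-cong (coeff S) (coeff S′) (In𝓡-finitary p) (In𝓡-finitary p′) e)

module _ (S S′ : 𝓡) where

  private
    φ  = bar₀-finitary S
    φ′ = bar₀-finitary S′

  β-+ : ∀ b → β (S 𝓡.+ S′) b ≡ β S b +ᶻ β S′ b
  β-+ b = trans
    (bar-cong _ _ (bar₀-finitary (S 𝓡.+ S′)) (+-finitary φ φ′)
      (bar-+ _ _ (In𝓡-finitary (proj₂ S)) (In𝓡-finitary (proj₂ S′)) (In𝓡-finitary (proj₂ (S 𝓡.+ S′)))) b)
    (bar-+ (bar₀ S) (bar₀ S′) φ φ′ (+-finitary φ φ′) b)

  β-* : ∀ b → β (S 𝓡.* S′) b ≡ conv (β S) (β S′) b
  β-* b = trans
    (bar-cong _ _ (bar₀-finitary (S 𝓡.* S′)) (conv-finitary φ φ′)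
      (bar-conv _ _ (In𝓡-finitary (proj₂ S)) (In𝓡-finitary (proj₂ S′)) (In𝓡-finitary (proj₂ (S 𝓡.* S′)))) b)
    (bar-conv (bar₀ S) (bar₀ S′) φ φ′ (conv-finitary φ φ′) b)

β-neg : ∀ S b → β (𝓡.- S) b ≡ -ᶻ β S b
β-neg S b = trans
  (bar-cong _ _ (bar₀-finitary (𝓡.- S)) (neg-finitary (bar₀-finitary S))
    (bar-neg _ (In𝓡-finitary (proj₂ S)) (In𝓡-finitary (proj₂ (𝓡.- S)))) b)
  (bar-neg (bar₀ S) (bar₀-finitary S) (neg-finitary (bar₀-finitary S)) b)

β-𝕊-counts : ∀ X → Counts (λ x → occs x ∘ suc ∘ suc) ⟦ X ⟧ (β (𝕊 X))
β-𝕊-counts X = β-counts (𝕊 X) (char-counts X)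

-- For n below 2, the word with the single letter n and the empty word both have no letters from 2
-- on, so `β` counts them alike.
β-t : ∀ n → n < 2 → ∀ b → β (t n) b ≡ β 𝓡.1# b
β-t n n<2 b = Size-unique (id , id) (β-counts (t n) (t-counts n) b) (Size-map
  (λ _ → n ∷ []) (λ { (refl , e) → refl , λ i → trans (absent i) (e i) })
  (λ { (refl , _) (refl , _) _ → refl })
  (λ { _ (refl , e) → [] , (refl , λ i → trans (sym (absent i)) (e i)) , refl })
  (β-counts 𝓡.1# 1ˢ-counts b))
  where
  absent : ∀ i → occurrences (2 + i) (n ∷ []) ≡ 0
  absent i = occ-other λ e → ℕₚ.<-irrefl refl (ℕₚ.<-≤-trans n<2 (subst (2 ≤_) e (ℕₚ.m≤m+n 2 i)))

-- Contents of words and bounds on sets of words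

inc : ℕ → 𝐀 → 𝐀
inc zero    []      = 1 ∷ []
inc zero    (n ∷ a) = suc n ∷ a
inc (suc y) []      = 0 ∷ inc y []
inc (suc y) (n ∷ a) = n ∷ inc y a

‼-inc : ∀ y a i → inc y a ‼ i ≡ occurrences i (y ∷ []) + a ‼ i
‼-inc y a i with i ℕₚ.≟ y
... | yes refl = trans (same y a) (cong (_+ a ‼ y) (sym (occ-same y)))
  where
  same : ∀ y a → inc y a ‼ y ≡ suc (a ‼ y)
  same zero    []      = refl
  same zero    (n ∷ a) = refl
  same (suc y) []      = same y []
  same (suc y) (n ∷ a) = same y a
... | no i≢y = trans (other y a i i≢y) (cong (_+ a ‼ i) (sym (occ-other i≢y)))
  where
  other : ∀ y a i → i ≢ y → inc y a ‼ i ≡ a ‼ i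
  other zero    a       zero    i≢y = contradiction refl i≢y
  other zero    []      (suc i) _   = refl
  other zero    (n ∷ a) (suc i) _   = refl
  other (suc y) []      zero    _   = refl
  other (suc y) []      (suc i) i≢y = other y [] i (i≢y ∘ cong suc)
  other (suc y) (n ∷ a) zero    _   = refl
  other (suc y) (n ∷ a) (suc i) i≢y = other y a i (i≢y ∘ cong suc)

content : Tuple → 𝐀
content []      = []
content (y ∷ x) = inc y (content x)

occs∼content : ∀ x → occs x ∼ content x
occs∼content []      i = refl
occs∼content (y ∷ x) i = trans (occ-∷ i y x)
  (trans (cong (_+_ (occurrences i (y ∷ []))) (occs∼content x i)) (sym (‼-inc y (content x) i)))

-- Trimmed, so that words agreeing in all letters from 2 on have equal lists. Both directions of a
-- matching then consult the same enumerated fibres.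
≥2-content : Tuple → 𝐀
≥2-content x = trim (drop 2 (content x))

∼≥2-content : ∀ x → (occs x ∘ suc ∘ suc) ∼ ≥2-content x
∼≥2-content x i = trans (occs∼content x (suc (suc i)))
  (trans (drop2 (content x)) (sym (trim-‼ (drop 2 (content x)) i)))
  where
  drop2 : ∀ a → a ‼ suc (suc i) ≡ drop 2 a ‼ i
  drop2 []          = refl
  drop2 (_ ∷ [])    = refl
  drop2 (_ ∷ _ ∷ _) = refl

≥2-content-cong : ∀ x y → (∀ i → 2 ≤ i → occurrences i x ≡ occurrences i y) → ≥2-content x ≡ ≥2-content y
≥2-content-cong x y e = trim-trim (drop 2 (content x)) (drop 2 (content y)) (λ i → trans (sym (∼≥2-content x i))
  (trans (e (suc (suc i)) (s≤s (s≤s z≤n))) (∼≥2-content y i)))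
  where
  trim-trim : ∀ a b → trim a ≋ trim b → trim a ≡ trim b
  trim-trim a b e = trim-resp {a} {b} λ i → trans (sym (trim-‼ a i)) (trans (e i) (trim-‼ b i))

-- Only finitely many tuples are concerned. Padding lengths are arbitrary functions of the word, and
-- this bound keeps the padded sets finitary.
bounded-on : ∀ (k : Tuple → ℕ) n h → ∃ λ K → ∀ x → All (_≤ n) x → length x ≤ h → k x ≤ K
bounded-on k n zero    = k [] , λ { [] _ _ → ℕₚ.≤-refl }
bounded-on k n (suc h) with maximum n
  where
  maximum : ∀ m → ∃ λ K → ∀ y → y ≤ m → ∀ x → All (_≤ n) x → length x ≤ h → k (y ∷ x) ≤ K
  maximum zero    with bounded-on (k ∘ (0 ∷_)) n h
  ... | K , p = K , λ { zero _ → p }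
  maximum (suc m) with bounded-on (k ∘ (suc m ∷_)) n h | maximum m
  ... | K , p | K′ , q = K ⊔ K′ , λ y y≤ x x≤ l → case ℕₚ.m≤n⇒m<n∨m≡n y≤ of λ
    { (inj₁ (s≤s y≤m)) → ℕₚ.≤-trans (q y y≤m x x≤ l) (ℕₚ.m≤n⊔m K K′)
    ; (inj₂ refl)      → ℕₚ.≤-trans (p x x≤ l) (ℕₚ.m≤m⊔n K K′) }
... | K , p = k [] ⊔ K , λ
  { []      _          _        → ℕₚ.m≤m⊔n (k []) K
  ; (y ∷ x) (y≤ ∷ x≤) (s≤s l) → ℕₚ.≤-trans (p y y≤ x x≤ l) (ℕₚ.m≤n⊔m (k []) K) }

length-bound : ∀ A n → ∃ λ h → ∀ x → All (_≤ n) x → x ∈ ⟦ A ⟧ → length x ≤ h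
length-bound A n = proj₁ (finitary A n) , λ x x≤ x∈ → ℕₚ.≮⇒≥ λ h< → proj₂ (finitary A n) x h< x≤ x∈

∈｛｝⇒≡ : ∀ c x → x ∈ ⟦ ｛ c ｝ʷ ⟧ → x ≡ c ∷ []
∈｛｝⇒≡ c x = toWitness {a? = Listₚ.≡-dec ℕₚ._≟_ x (c ∷ [])}

[c]∈｛｝ : ∀ c → c ∷ [] ∈ ⟦ ｛ c ｝ʷ ⟧
[c]∈｛｝ c = fromWitness {a? = Listₚ.≡-dec ℕₚ._≟_ (c ∷ []) (c ∷ [])} refl

∈-∖ : ∀ A B x → x ∈ ⟦ A ∖ʷ B ⟧ → x ∈ ⟦ A ⟧ × ¬ x ∈ ⟦ B ⟧
∈-∖ A B x x∈ with to (T-∧ {χ A x}) x∈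
... | x∈A , x∉B = x∈A , not-T x∉B
  where
  not-T : ∀ {b} → T (not b) → ¬ T b
  not-T {true} ()

∖-∈ : ∀ A B x → x ∈ ⟦ A ⟧ → ¬ x ∈ ⟦ B ⟧ → x ∈ ⟦ A ∖ʷ B ⟧
∖-∈ A B x x∈A x∉B = from (T-∧ {χ A x}) (x∈A , T-not x∉B)
  where
  T-not : ∀ {b} → ¬ T b → T (not b)
  T-not {false} _ = _
  T-not {true} ¬t = ⊥-elim (¬t _)

-- Tagged unions, padding and matchings

infixr 6 _∪_ _⊕_
infixr 7 _◁_

-- Abstract, since the unifier would otherwise unfold sets into their components.
abstract

  _∪_ : 𝕎 → 𝕎 → 𝕎
  _∪_ = _∪ʷ_

  ∈-∪ : ∀ A B {x} → x ∈ ⟦ A ∪ B ⟧ → x ∈ ⟦ A ⟧ ⊎ x ∈ ⟦ B ⟧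
  ∈-∪ A B {x} = to (T-∨ {χ A x})

  ∪-∈ : ∀ A B {x} → x ∈ ⟦ A ⟧ ⊎ x ∈ ⟦ B ⟧ → x ∈ ⟦ A ∪ B ⟧
  ∪-∈ A B {x} = from (T-∨ {χ A x})

  ∪≐∪ʷ : ∀ A B → ⟦ A ∪ B ⟧ ≐ ⟦ A ∪ʷ B ⟧
  ∪≐∪ʷ A B = id , id

  _◁_ : ℕ → 𝕎 → 𝕎
  c ◁ A = ｛ c ｝ʷ ×ʷ A

  ∈-◁ : ∀ c A x → x ∈ ⟦ c ◁ A ⟧ ⇔ (∃ λ a → a ∈ ⟦ A ⟧ × x ≡ c ∷ a)
  ∈-◁ c A x = mk⇔
    (λ x∈ → case to (∈-×ʷ ｛ c ｝ʷ A x) x∈ of λ { (y , a , y∈ , a∈ , e) →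
      a , a∈ , trans e (cong (_++ a) (∈｛｝⇒≡ c y y∈)) })
    (λ (a , a∈ , e) → from (∈-×ʷ ｛ c ｝ʷ A x) (c ∷ [] , a , [c]∈｛｝ c , a∈ , e))

∪-comm : ∀ A B → ⟦ A ∪ B ⟧ ≐ ⟦ B ∪ A ⟧
∪-comm A B = (λ x∈ → ∪-∈ B A (Sum.swap (∈-∪ A B x∈)))
           , (λ x∈ → ∪-∈ A B (Sum.swap (∈-∪ B A x∈)))

◁-⊥ : ∀ {c d} A B → c ≢ d → ⟦ c ◁ A ⟧ ⊥ ⟦ d ◁ B ⟧
◁-⊥ {c} {d} A B c≢d {x} (x∈ , x∈′) with to (∈-◁ c A x) x∈ | to (∈-◁ d B x) x∈′
... | _ , _ , refl | _ , _ , e = c≢d (Listₚ.∷-injectiveˡ e)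

-- A sum defined for all pairs: the tags make the summands disjoint, and both tag letters become 1
-- in the quotients.
_⊕_ : 𝕎 → 𝕎 → 𝕎
A ⊕ B = 0 ◁ A ∪ 1 ◁ B

padding : ℕ → ℕ → ℕ → Tuple → Tuple
padding u v j a = replicate j u ++ v ∷ a

-- The first letter different from u is the marker v, so the run can be measured even when a itself
-- begins with u.
padding-injective : ∀ {u v} → u ≢ v → ∀ {j k a b} → padding u v j a ≡ padding u v k b → j ≡ k × a ≡ b
padding-injective u≢v {zero}  {zero}  e = refl , Listₚ.∷-injectiveʳ e
padding-injective u≢v {zero}  {suc k} e = contradiction (sym (Listₚ.∷-injectiveˡ e)) u≢v
padding-injective u≢v {suc j} {zero}  e = contradiction (Listₚ.∷-injectiveˡ e) u≢v
padding-injective u≢v {suc j} {suc k} e with padding-injective u≢v {j} {k} (Listₚ.∷-injectiveʳ e)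
... | j≡k , a≡b = cong suc j≡k , a≡b

length-padding : ∀ u v j a → length (padding u v j a) ≡ j + suc (length a)
length-padding u v j a = trans (Listₚ.length-++ (replicate j u)) (cong (_+ _) (Listₚ.length-replicate j))

unpad : ℕ → Tuple → Tuple
unpad u []      = []
unpad u (y ∷ x) with y ℕₚ.≟ u
... | yes _ = unpad u x
... | no  _ = x

unpad-padding : ∀ {u v} → u ≢ v → ∀ j a → unpad u (padding u v j a) ≡ a
unpad-padding {u} {v} u≢v zero a with v ℕₚ.≟ u
... | yes v≡u = contradiction (sym v≡u) u≢v
... | no  _   = refl
unpad-padding {u} {v} u≢v (suc j) a with u ℕₚ.≟ u
... | yes _   = unpad-padding u≢v j a
... | no  u≢u = contradiction refl u≢u

occ-padding : ∀ i u v j a → occurrences i (padding u v j a) ≡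
              occurrences i (replicate j u) + (occurrences i (v ∷ []) + occurrences i a)
occ-padding i u v j a = trans (occ-++ i (replicate j u) (v ∷ a))
  (cong (_+_ (occurrences i (replicate j u))) (occ-∷ i v a))

occ-padding-same : ∀ u v j a → occurrences u (padding u v j a) ≡
                   j + (occurrences u (v ∷ []) + occurrences u a)
occ-padding-same u v j a = trans (occ-padding u u v j a)
  (cong (_+ (occurrences u (v ∷ []) + occurrences u a)) (occ-replicate-same j u))

occ-padding-other : ∀ {i u} → i ≢ u → ∀ v j a → occurrences i (padding u v j a) ≡
                    occurrences i (v ∷ []) + occurrences i a
occ-padding-other {i} {u} i≢u v j a = trans (occ-padding i u v j a)
  (cong (_+ (occurrences i (v ∷ []) + occurrences i a)) (occ-replicate-other j i≢u))

All-padding : ∀ {P : Pred ℕ 0ℓ} {u v} j {a} → All P (padding u v j a) → All P a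
All-padding {u = u} j x with Allₚ.++⁻ʳ (replicate j u) x
... | _ ∷ a = a

Agree : Pred ℕ 0ℓ → Rel Tuple 0ℓ
Agree K x y = ∀ i → K i → occurrences i x ≡ occurrences i y

-- The inverse is part of the data because words on each side are padded according to their partners
-- on the other side.
record Matching (R : Rel Tuple 0ℓ) (A B : 𝕎) : Set where
  field
    there→  : Tuple → Tuple
    back    : Tuple → Tuple
    there-∈ : ∀ {a} → a ∈ ⟦ A ⟧ → there→ a ∈ ⟦ B ⟧
    back-∈  : ∀ {b} → b ∈ ⟦ B ⟧ → back b ∈ ⟦ A ⟧
    back∘there : ∀ {a} → a ∈ ⟦ A ⟧ → back (there→ a) ≡ a
    there∘back : ∀ {b} → b ∈ ⟦ B ⟧ → there→ (back b) ≡ b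
    related : ∀ {a} → a ∈ ⟦ A ⟧ → R a (there→ a)

Matching-map : ∀ {R R′ : Rel Tuple 0ℓ} {A B} → (∀ {a b} → R a b → R′ a b) → Matching R A B → Matching R′ A B
Matching-map f M = record
  { there→ = there→ ; back = back ; there-∈ = there-∈ ; back-∈ = back-∈
  ; back∘there = back∘there ; there∘back = there∘back ; related = f ∘ related
  }
  where open Matching M

-- Equal coefficients mean equally many words in X and in Y for each content in the letters from 2
-- on. Such fibres are finite and are matched by position.
β≡⇒Matching : ∀ X Y → (∀ b → β (𝕊 X) b ≡ β (𝕊 Y) b) → Matching (Agree (2 ≤_)) X Y
β≡⇒Matching X Y e = record
  { there→     = move X Y
  ; back       = move Y X
  ; there-∈    = λ a∈ → proj₁ (to (∈⇔ (fib Y _) _) (move-fib X Y (sym ∘ e) a∈))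
  ; back-∈     = λ b∈ → proj₁ (to (∈⇔ (fib X _) _) (move-fib Y X e b∈))
  ; back∘there = move∘move X Y (sym ∘ e)
  ; there∘back = move∘move Y X e
  ; related    = λ {a} a∈ i 2≤i → agree X Y (sym ∘ e) a∈ i 2≤i
  }
  where
  fib : ∀ X b → Size (λ x → x ∈ ⟦ X ⟧ × (occs x ∘ suc ∘ suc) ∼ b) (β (𝕊 X) b)
  fib = β-𝕊-counts

  move : 𝕎 → 𝕎 → Tuple → Tuple
  move X Y x = transport (elements (fib X (≥2-content x))) (elements (fib Y (≥2-content x))) x

  module _ (X Y : 𝕎) (e : ∀ b → β (𝕊 Y) b ≡ β (𝕊 X) b) where

    same-length : ∀ b → length (elements (fib X b)) ≡ length (elements (fib Y b))
    same-length b = ℤₚ.+-injective (trans (size (fib X b)) (trans (sym (e b)) (sym (size (fib Y b)))))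

    ∈-fib : ∀ {x} → x ∈ ⟦ X ⟧ → x ∈ˡ elements (fib X (≥2-content x))
    ∈-fib {x} x∈ = from (∈⇔ (fib X _) x) (x∈ , ∼≥2-content x)

    move-fib : ∀ {x} → x ∈ ⟦ X ⟧ → move X Y x ∈ˡ elements (fib Y (≥2-content x))
    move-fib {x} x∈ = transport-∈ (elements (fib X _)) _ (same-length _) (∈-fib x∈)

    agree : ∀ {x} → x ∈ ⟦ X ⟧ → Agree (2 ≤_) x (move X Y x)
    agree {x} x∈ (suc (suc i)) (s≤s (s≤s z≤n)) = trans (∼≥2-content x i)
      (sym (proj₂ (to (∈⇔ (fib Y _) _) (move-fib x∈)) i))

    move∘move : ∀ {x} → x ∈ ⟦ X ⟧ → move Y X (move X Y x) ≡ x
    move∘move {x} x∈ = trans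
      (cong (λ b → transport (elements (fib Y b)) (elements (fib X b)) (move X Y x))
        (sym (≥2-content-cong x (move X Y x) (agree x∈))))
      (transport-inverse (elements (fib X _)) (elements (fib Y _)) (same-length _) (unique (fib Y _)) (∈-fib x∈))

-- Padded sets and cancellation

module Sets (em : ExcludedMiddle 0ℓ) where

  module _ (P : Pred Tuple 0ℓ) (¬P[] : ¬ P []) (bnd : ∀ n → ∃ λ h → ∀ x → All (_≤ n) x → P x → length x ≤ h) where

    abstract

      comprehension : 𝕎
      comprehension = record
        { χ        = λ x → ⌊ em {P x} ⌋
        ; []∉      = trans (isYes≗does (em {P []})) (dec-false (em {P []}) ¬P[])
        ; finitary = λ n → proj₁ (bnd n) , λ x h< x≤ x∈ →
            ℕₚ.<-irrefl refl (ℕₚ.<-≤-trans h< (proj₂ (bnd n) x x≤ (toWitness {a? = em} x∈)))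
        }

      ∈-comprehension : ∀ x → x ∈ ⟦ comprehension ⟧ ⇔ P x
      ∈-comprehension x = mk⇔ (toWitness {a? = em}) (fromWitness {a? = em})

  module Padding (u v : ℕ) (u≢v : u ≢ v) (k : Tuple → ℕ) (A : 𝕎) where

    private
      padded-bound : ∀ n → ∃ λ h → ∀ a j → j ≤ k a → a ∈ ⟦ A ⟧ → All (_≤ n) (padding u v j a) →
                     length (padding u v j a) ≤ h
      padded-bound n with length-bound A n
      ... | h , p with bounded-on k n h
      -- `K` bounds the run, `h` the original word, and the additional 1 is the marker.
      ...   | K , q = K + suc h , λ a j j≤k a∈ x≤ →
        let a≤ = All-padding j x≤; l = p a a≤ a∈ in
        subst (_≤ K + suc h) (sym (length-padding u v j a))
          (ℕₚ.+-mono-≤ (ℕₚ.≤-trans j≤k (q a a≤ l)) (s≤s l))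

    padding≢[] : ∀ j {a} → [] ≢ padding u v j a
    padding≢[] zero    ()
    padding≢[] (suc j) ()

    IsPadded IsPartial : Pred Tuple 0ℓ
    IsPadded  x = ∃ λ a → a ∈ ⟦ A ⟧ × x ≡ padding u v (k a) a
    IsPartial x = ∃₂ λ a j → a ∈ ⟦ A ⟧ × j < k a × x ≡ padding u v j a

    padded partials : 𝕎
    padded = comprehension IsPadded (λ (a , _ , e) → padding≢[] (k a) e) λ n →
      proj₁ (padded-bound n) , λ { x x≤ (a , a∈ , refl) → proj₂ (padded-bound n) a (k a) ℕₚ.≤-refl a∈ x≤ }
    partials = comprehension IsPartial (λ (a , j , _ , _ , e) → padding≢[] j e) λ n →
      proj₁ (padded-bound n) , λ { x x≤ (a , j , a∈ , j< , refl) → proj₂ (padded-bound n) a j (ℕₚ.<⇒≤ j<) a∈ x≤ }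

    ∈-padded : ∀ x → x ∈ ⟦ padded ⟧ ⇔ IsPadded x
    ∈-padded = ∈-comprehension IsPadded _ _

    ∈-partials : ∀ x → x ∈ ⟦ partials ⟧ ⇔ IsPartial x
    ∈-partials = ∈-comprehension IsPartial _ _

    partials⊥padded : ⟦ partials ⟧ ⊥ ⟦ padded ⟧
    partials⊥padded {x} (x∈ , x∈′) with to (∈-partials x) x∈ | to (∈-padded x) x∈′
    ... | a , j , _ , j< , refl | a′ , _ , e with padding-injective u≢v {j} e
    ...   | refl , refl = ℕₚ.<-irrefl refl j<

    -- Cancelling partials turns this identity into v ◁ A ≈ padded, whatever k is.
    telescope : ⟦ v ◁ A ∪ u ◁ partials ⟧ ≐ ⟦ partials ∪ padded ⟧
    telescope = ⊆⁺ , ⊇⁺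
      where
      extend : ∀ a j → a ∈ ⟦ A ⟧ → j ≤ k a → padding u v j a ∈ ⟦ partials ∪ padded ⟧
      extend a j a∈ j≤ with ℕₚ.m≤n⇒m<n∨m≡n j≤
      ... | inj₁ j<   = ∪-∈ partials padded (inj₁ (from (∈-partials _) (a , j , a∈ , j< , refl)))
      ... | inj₂ refl = ∪-∈ partials padded (inj₂ (from (∈-padded _) (a , a∈ , refl)))

      ⊆⁺ : ⟦ v ◁ A ∪ u ◁ partials ⟧ ⊆ ⟦ partials ∪ padded ⟧
      ⊆⁺ {x} x∈ with ∈-∪ (v ◁ A) (u ◁ partials) x∈
      ... | inj₁ x∈vA with to (∈-◁ v A x) x∈vA
      ...   | a , a∈ , refl = extend a 0 a∈ z≤n
      ⊆⁺ {x} x∈ | inj₂ x∈uU with to (∈-◁ u partials x) x∈uU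
      ...   | y , y∈ , refl with to (∈-partials y) y∈
      ...     | a , j , a∈ , j< , refl = extend a (suc j) a∈ j<

      shrink : ∀ a j → a ∈ ⟦ A ⟧ → j ≤ k a → padding u v j a ∈ ⟦ v ◁ A ∪ u ◁ partials ⟧
      shrink a zero    a∈ _  = ∪-∈ (v ◁ A) (u ◁ partials) (inj₁ (from (∈-◁ v A _) (a , a∈ , refl)))
      shrink a (suc j) a∈ j< = ∪-∈ (v ◁ A) (u ◁ partials) (inj₂ (from (∈-◁ u partials _)
        (_ , from (∈-partials _) (a , j , a∈ , j< , refl) , refl)))

      ⊇⁺ : ⟦ partials ∪ padded ⟧ ⊆ ⟦ v ◁ A ∪ u ◁ partials ⟧
      ⊇⁺ {x} x∈ with ∈-∪ partials padded x∈
      ... | inj₁ x∈′ with to (∈-partials x) x∈′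
      ...   | a , j , a∈ , j< , refl = shrink a j a∈ (ℕₚ.<⇒≤ j<)
      ⊇⁺ {x} x∈ | inj₂ x∈′ with to (∈-padded x) x∈′
      ...   | a , a∈ , refl = shrink a (k a) a∈ ℕₚ.≤-refl

  open Padding using (padded; ∈-padded)

  -- An equinumerosity without (ZP), (PP), and with (UP) for n < 2 only.
  record IsPreEquinumerosity (_≈_ : Rel 𝕎 0ℓ) : Set where
    field
      isEquivalence : IsEquivalence _≈_
      extensional   : ∀ {A B} → ⟦ A ⟧ ≐ ⟦ B ⟧ → A ≈ B
      AP            : ∀ A B → A ≈ B ⇔ (A ∖ʷ B) ≈ (B ∖ʷ A)
      TP            : ∀ A B (t : Tuple → Tuple) →
                      (∀ {a a′} → a ∈ ⟦ A ⟧ → a′ ∈ ⟦ A ⟧ → t a ≡ t a′ → a ≡ a′) →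
                      (∀ {a} → a ∈ ⟦ A ⟧ → t a ↭ a) →
                      (∀ y → y ∈ ⟦ B ⟧ ⇔ (∃ λ a → a ∈ ⟦ A ⟧ × t a ≡ y)) →
                      A ≈ B
      UP            : ∀ A n → n < 2 → (A ×ʷ ｛ n ｝ʷ) ≈ A

    open IsEquivalence isEquivalence renaming (refl to ≈-refl; sym to ≈-sym; trans to ≈-trans) public

    setoid : Setoid 0ℓ 0ℓ
    setoid = record { isEquivalence = isEquivalence }

    module _ {A B C : 𝕎} (A⊥C : ⟦ A ⟧ ⊥ ⟦ C ⟧) (B⊥C : ⟦ B ⟧ ⊥ ⟦ C ⟧) where

      private
        -- C drops out of both set differences, so (AP) makes disjoint union with C a congruence and
        -- cancellable at once.
        ∪∖∪ : ∀ {A B C : 𝕎} → ⟦ A ⟧ ⊥ ⟦ C ⟧ → ⟦ (A ∪ C) ∖ʷ (B ∪ C) ⟧ ≐ ⟦ A ∖ʷ B ⟧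
        ∪∖∪ {A} {B} {C} A⊥C =
            (λ {x} x∈ → let x∈AC , x∉BC = ∈-∖ (A ∪ C) (B ∪ C) x x∈ in ∖-∈ A B x
              ([ id , (λ x∈C → ⊥-elim (x∉BC (∪-∈ B C (inj₂ x∈C)))) ]′ (∈-∪ A C x∈AC))
              (λ x∈B → x∉BC (∪-∈ B C (inj₁ x∈B))))
          , (λ {x} x∈ → let x∈A , x∉B = ∈-∖ A B x x∈ in ∖-∈ (A ∪ C) (B ∪ C) x
              (∪-∈ A C (inj₁ x∈A))
              (λ x∈BC → [ x∉B , (λ x∈C → A⊥C (x∈A , x∈C)) ]′ (∈-∪ B C x∈BC)))

        ∖≈ : ((A ∪ C) ∖ʷ (B ∪ C)) ≈ (A ∖ʷ B)
        ∖≈ = extensional (∪∖∪ {A} {B} {C} A⊥C)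

        ∖≈′ : ((B ∪ C) ∖ʷ (A ∪ C)) ≈ (B ∖ʷ A)
        ∖≈′ = extensional (∪∖∪ {B} {A} {C} B⊥C)

      ∪-congʳ : A ≈ B → (A ∪ C) ≈ (B ∪ C)
      ∪-congʳ e = from (AP (A ∪ C) (B ∪ C)) (≈-trans ∖≈ (≈-trans (to (AP A B) e) (≈-sym ∖≈′)))

      ∪-cancelʳ : (A ∪ C) ≈ (B ∪ C) → A ≈ B
      ∪-cancelʳ e = from (AP A B) (≈-trans (≈-sym ∖≈) (≈-trans (to (AP (A ∪ C) (B ∪ C)) e) ∖≈′))

    ∪-congˡ : ∀ {A B C} → ⟦ A ⟧ ⊥ ⟦ B ⟧ → ⟦ A ⟧ ⊥ ⟦ C ⟧ → B ≈ C → (A ∪ B) ≈ (A ∪ C)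
    ∪-congˡ {A} {B} {C} A⊥B A⊥C e = ≈-trans (extensional (∪-comm A B))
      (≈-trans (∪-congʳ (λ (p , q) → A⊥B (q , p)) (λ (p , q) → A⊥C (q , p)) e) (extensional (∪-comm C A)))

    -- (UP) concerns a letter appended at the end; rotating each word is a permutation of its
    -- coordinates, so (TP) moves the letter to the front.
    ◁-≈ : ∀ c A → c < 2 → (c ◁ A) ≈ A
    ◁-≈ c A c<2 = ≈-trans (TP (c ◁ A) (A ×ʷ ｛ c ｝ʷ) rotate inj perm image) (UP A c c<2)
      where
      rotate : Tuple → Tuple
      rotate []      = []
      rotate (y ∷ x) = x ∷ʳ y

      inj : ∀ {a a′} → a ∈ ⟦ c ◁ A ⟧ → a′ ∈ ⟦ c ◁ A ⟧ → rotate a ≡ rotate a′ → a ≡ a′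
      inj {a} {a′} a∈ a′∈ e with to (∈-◁ c A a) a∈ | to (∈-◁ c A a′) a′∈
      ... | x , _ , refl | x′ , _ , refl = cong (c ∷_) (proj₁ (Listₚ.∷ʳ-injective x x′ e))

      perm : ∀ {a} → a ∈ ⟦ c ◁ A ⟧ → rotate a ↭ a
      perm {[]}    _ = ↭-refl
      perm {y ∷ x} _ = ↭-sym (Permₚ.∷↭∷ʳ y x)

      image : ∀ y → y ∈ ⟦ A ×ʷ ｛ c ｝ʷ ⟧ ⇔ (∃ λ a → a ∈ ⟦ c ◁ A ⟧ × rotate a ≡ y)
      image y = mk⇔
        (λ y∈ → case to (∈-×ʷ A ｛ c ｝ʷ y) y∈ of λ { (x , z , x∈ , z∈ , e) →
          c ∷ x , from (∈-◁ c A _) (x , x∈ , refl) , sym (trans e (cong (x ++_) (∈｛｝⇒≡ c z z∈))) })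
        (λ (a , a∈ , e) → case to (∈-◁ c A a) a∈ of λ { (x , x∈ , refl) →
          from (∈-×ʷ A ｛ c ｝ʷ y) (x , c ∷ [] , x∈ , [c]∈｛｝ c , sym e) })

    0◁-≈ : ∀ A → (0 ◁ A) ≈ A
    0◁-≈ A = ◁-≈ 0 A (s≤s z≤n)

    1◁-≈ : ∀ A → (1 ◁ A) ≈ A
    1◁-≈ A = ◁-≈ 1 A (s≤s (s≤s z≤n))

    ⊕-cong : ∀ {A A′ B B′} → A ≈ A′ → B ≈ B′ → (A ⊕ B) ≈ (A′ ⊕ B′)
    ⊕-cong {A} {A′} {B} {B′} e e′ = ≈-trans
      (∪-congʳ (◁-⊥ A B λ ()) (◁-⊥ A′ B λ ()) (≈-trans (0◁-≈ A) (≈-trans e (≈-sym (0◁-≈ A′)))))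
      (∪-congˡ (◁-⊥ A′ B λ ()) (◁-⊥ A′ B′ λ ()) (≈-trans (1◁-≈ B) (≈-trans e′ (≈-sym (1◁-≈ B′)))))

    -- (AP) cancels only a common set, so C′ is first replaced by C through `⊕-cong`.
    ⊕-cancelʳ : ∀ {A B C C′} → C ≈ C′ → (A ⊕ C) ≈ (B ⊕ C′) → A ≈ B
    ⊕-cancelʳ {A} {B} {C} {C′} e e′ = ≈-trans (≈-sym (0◁-≈ A)) (≈-trans
      (∪-cancelʳ (◁-⊥ A C λ ()) (◁-⊥ B C λ ()) (≈-trans e′ (⊕-cong ≈-refl (≈-sym e)))) (0◁-≈ B))

    -- Tagging the whole union with 0 preserves disjointness; then the part from B changes its tag
    -- to 1.
    ∪≈⊕ : ∀ A B → ⟦ A ⟧ ⊥ ⟦ B ⟧ → (A ∪ B) ≈ (A ⊕ B)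
    ∪≈⊕ A B A⊥B = ≈-trans (≈-sym (0◁-≈ (A ∪ B))) (≈-trans (extensional distrib)
      (∪-congˡ 0A⊥0B (◁-⊥ A B λ ()) (≈-trans (0◁-≈ B) (≈-sym (1◁-≈ B)))))
      where
      0A⊥0B : ⟦ 0 ◁ A ⟧ ⊥ ⟦ 0 ◁ B ⟧
      0A⊥0B {x} (x∈ , x∈′) with to (∈-◁ 0 A x) x∈ | to (∈-◁ 0 B x) x∈′
      ... | a , a∈ , refl | _ , b∈ , refl = A⊥B (a∈ , b∈)

      distrib : ⟦ 0 ◁ (A ∪ B) ⟧ ≐ ⟦ 0 ◁ A ∪ 0 ◁ B ⟧
      distrib =
          (λ {x} x∈ → case to (∈-◁ 0 (A ∪ B) x) x∈ of λ { (a , a∈ , e) → ∪-∈ (0 ◁ A) (0 ◁ B)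
            (Sum.map (λ a∈A → from (∈-◁ 0 A x) (a , a∈A , e)) (λ a∈B → from (∈-◁ 0 B x) (a , a∈B , e))
              (∈-∪ A B a∈)) })
        , (λ {x} x∈ → from (∈-◁ 0 (A ∪ B) x) ([
            (λ x∈A → case to (∈-◁ 0 A x) x∈A of λ (a , a∈ , e) → a , ∪-∈ A B (inj₁ a∈) , e)
          , (λ x∈B → case to (∈-◁ 0 B x) x∈B of λ (b , b∈ , e) → b , ∪-∈ A B (inj₂ b∈) , e) ]′
            (∈-∪ (0 ◁ A) (0 ◁ B) x∈)))

    -- The two unions in `telescope` are disjoint and can be written with `_⊕_`, where `partials`
    -- and `u ◁ partials` cancel although they are only equivalent.
    padded-≈ : ∀ {u v} (u≢v : u ≢ v) → u < 2 → v < 2 → ∀ k A → padded u v u≢v k A ≈ A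
    padded-≈ {u} {v} u≢v u<2 v<2 k A = ⊕-cancelʳ (≈-sym (◁-≈ u partials u<2)) (begin
      padded u v u≢v k A ⊕ partials                 ≈⟨ ∪≈⊕ _ partials (λ (p , q) → partials⊥padded (q , p)) ⟨
      padded u v u≢v k A ∪ partials                ≈⟨ extensional (∪-comm (padded u v u≢v k A) partials) ⟩
      partials ∪ padded u v u≢v k A                ≈⟨ extensional telescope ⟨
      v ◁ A ∪ u ◁ partials                         ≈⟨ ∪≈⊕ (v ◁ A) (u ◁ partials) (◁-⊥ A partials (u≢v ∘ sym)) ⟩
      v ◁ A ⊕ u ◁ partials                          ≈⟨ ⊕-cong (◁-≈ v A v<2) ≈-refl ⟩
      A ⊕ u ◁ partials                              ∎)
      where
      open Padding u v u≢v k A using (partials; partials⊥padded; telescope)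
      open SetoidReasoning setoid

    Matching-≈ : ∀ {A B} → Matching _↭_ A B → A ≈ B
    Matching-≈ {A} {B} M = TP A B there→
      (λ a∈ a′∈ e → trans (sym (back∘there a∈)) (trans (cong back e) (back∘there a′∈)))
      (λ a∈ → ↭-sym (related a∈))
      (λ y → mk⇔ (λ y∈ → back y , back-∈ y∈ , there∘back y∈) λ { (a , a∈ , refl) → there-∈ a∈ })
      where open Matching M

    -- Every word receives as many copies of u as its partner contains, so both partners end up with
    -- the sum of their counts. Both also gain a single v, which preserves the agreement already
    -- reached, and `unpad` recovers the original words.
    pad-Matching : ∀ {A B K u v} → u ≢ v → u < 2 → v < 2 → Matching (Agree K) A B →
                   ∃₂ λ A′ B′ → A′ ≈ A × B′ ≈ B × Matching (Agree (λ i → i ≡ u ⊎ K i)) A′ B′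
    pad-Matching {A} {B} {K} {u} {v} u≢v u<2 v<2 M =
      A′ , B′ , padded-≈ u≢v u<2 v<2 k A , padded-≈ u≢v u<2 v<2 l B , record
        { there→     = λ x → pad-B (there→ (unpad u x))
        ; back       = λ x → pad-A (back (unpad u x))
        ; there-∈    = λ {x} x∈ → case to (∈A′ x) x∈ of λ { (a , a∈ , refl) →
            from (∈B′ (pad-B (there→ (unpad u (pad-A a)))))
              (there→ a , there-∈ a∈ , cong (pad-B ∘ there→) (unpad-A a)) }
        ; back-∈     = λ {x} x∈ → case to (∈B′ x) x∈ of λ { (b , b∈ , refl) →
            from (∈A′ (pad-A (back (unpad u (pad-B b)))))
              (back b , back-∈ b∈ , cong (pad-A ∘ back) (unpad-B b)) }
        ; back∘there = λ {x} x∈ → case to (∈A′ x) x∈ of λ { (a , a∈ , refl) → cong pad-A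
            (trans (cong back (trans (unpad-B (there→ (unpad u (pad-A a)))) (cong there→ (unpad-A a))))
              (back∘there a∈)) }
        ; there∘back = λ {x} x∈ → case to (∈B′ x) x∈ of λ { (b , b∈ , refl) → cong pad-B
            (trans (cong there→ (trans (unpad-A (back (unpad u (pad-B b)))) (cong back (unpad-B b))))
              (there∘back b∈)) }
        ; related    = λ {x} x∈ i Ki → case to (∈A′ x) x∈ of λ { (a , a∈ , refl) →
            trans (agree a a∈ i Ki (i ℕₚ.≟ u)) (cong (λ y → occurrences i (pad-B (there→ y))) (sym (unpad-A a))) }
        }
      where
      open Matching M
      k l : Tuple → ℕ
      k a = occurrences u (there→ a)
      l b = occurrences u (back b)
      pad-A pad-B : Tuple → Tuple
      pad-A a = padding u v (k a) a
      pad-B b = padding u v (l b) b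
      unpad-A : ∀ a → unpad u (pad-A a) ≡ a
      unpad-A a = unpad-padding u≢v (k a) a
      unpad-B : ∀ b → unpad u (pad-B b) ≡ b
      unpad-B b = unpad-padding u≢v (l b) b
      A′ B′ : 𝕎
      A′ = padded u v u≢v k A
      B′ = padded u v u≢v l B
      ∈A′ : ∀ x → x ∈ ⟦ A′ ⟧ ⇔ (∃ λ a → a ∈ ⟦ A ⟧ × x ≡ pad-A a)
      ∈A′ = ∈-padded u v u≢v k A
      ∈B′ : ∀ x → x ∈ ⟦ B′ ⟧ ⇔ (∃ λ b → b ∈ ⟦ B ⟧ × x ≡ pad-B b)
      ∈B′ = ∈-padded u v u≢v l B

      rearrange : ∀ m w n → m + (w + n) ≡ n + (w + m)
      rearrange m w n = trans (ℕₚ.+-comm m (w + n)) (trans (cong (_+ m) (ℕₚ.+-comm w n)) (ℕₚ.+-assoc n w m))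

      agree : ∀ a → a ∈ ⟦ A ⟧ → ∀ i → i ≡ u ⊎ K i → Dec (i ≡ u) →
              occurrences i (pad-A a) ≡ occurrences i (pad-B (there→ a))
      agree a a∈ i _ (yes refl) = begin
        occurrences u (pad-A a)                ≡⟨ occ-padding-same u v (k a) a ⟩
        k a + (w + occurrences u a)            ≡⟨ rearrange (k a) w (occurrences u a) ⟩
        occurrences u a + (w + k a)            ≡⟨ cong (λ x → occurrences u x + (w + k a)) (back∘there a∈) ⟨
        l (there→ a) + (w + k a)               ≡⟨ occ-padding-same u v (l (there→ a)) (there→ a) ⟨
        occurrences u (pad-B (there→ a))       ∎
        where
        open ≡-Reasoning
        w = occurrences u (v ∷ [])
      agree a a∈ i (inj₁ i≡u) (no i≢u) = contradiction i≡u i≢u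
      agree a a∈ i (inj₂ Ki)  (no i≢u) = trans (occ-padding-other i≢u v (k a) a)
        (trans (cong (_+_ (occurrences i (v ∷ []))) (related a∈ i Ki))
          (sym (occ-padding-other i≢u v (l (there→ a)) (there→ a))))

    Agree≥2⇒≈ : ∀ {X Y} → Matching (Agree (2 ≤_)) X Y → X ≈ Y
    Agree≥2⇒≈ {X} {Y} M = finish (pad-Matching {u = 0} {v = 1} (λ ()) (s≤s z≤n) (s≤s (s≤s z≤n)) M)
      where
      all : ∀ i → i ≡ 1 ⊎ i ≡ 0 ⊎ 2 ≤ i
      all zero          = inj₂ (inj₁ refl)
      all (suc zero)    = inj₁ refl
      all (suc (suc i)) = inj₂ (inj₂ (s≤s (s≤s z≤n)))

      permuted : ∀ {X Y} → Matching (Agree (λ i → i ≡ 1 ⊎ i ≡ 0 ⊎ 2 ≤ i)) X Y → X ≈ Y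
      permuted M = Matching-≈ (Matching-map (λ {a} {b} agree → occ≡⇒↭ a b λ i → agree i (all i)) M)

      finish : (∃₂ λ X′ Y′ → X′ ≈ X × Y′ ≈ Y × Matching (Agree (λ i → i ≡ 0 ⊎ 2 ≤ i)) X′ Y′) → X ≈ Y
      finish (X₁ , Y₁ , X₁≈X , Y₁≈Y , M₁) =
        -- With the roles exchanged, the marker 0 is added once on both sides, so the agreement on 0
        -- survives.
        case pad-Matching {u = 1} {v = 0} (λ ()) (s≤s (s≤s z≤n)) (s≤s z≤n) M₁ of λ
          (X₂ , Y₂ , X₂≈X₁ , Y₂≈Y₁ , M₂) →
            ≈-trans (≈-sym (≈-trans X₂≈X₁ X₁≈X)) (≈-trans (permuted M₂) (≈-trans Y₂≈Y₁ Y₁≈Y))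

    -- Taken for congruence modulo `𝓙`, this says that `β` separates the classes of characteristic
    -- series.
    β≡⇒≈ : ∀ X Y → (∀ b → β (𝕊 X) b ≡ β (𝕊 Y) b) → X ≈ Y
    β≡⇒≈ X Y e = Agree≥2⇒≈ (β≡⇒Matching X Y e)

-- Counting the arrangements of a monomial

product!-decr : ∀ y a → 0 < a ‼ y → product (map _! a) ≡ (a ‼ y) * product (map _! (decr y a))
product!-decr zero    (suc n ∷ a) _  = ℕₚ.*-assoc (suc n) (n !) (product (map _! a))
product!-decr (suc y) (n ∷ a)     a> = begin
  n ! * product (map _! a)     ≡⟨ cong (n ! *_) (product!-decr y a a>) ⟩
  n ! * ((a ‼ y) * p)          ≡⟨ ℕₚ.*-assoc (n !) (a ‼ y) p ⟨
  n ! * (a ‼ y) * p            ≡⟨ cong (_* p) (ℕₚ.*-comm (n !) (a ‼ y)) ⟩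
  (a ‼ y) * n ! * p            ≡⟨ ℕₚ.*-assoc (a ‼ y) (n !) p ⟩
  (a ‼ y) * (n ! * p)          ∎
  where
  open ≡-Reasoning
  p = product (map _! (decr y a))

1≤product! : ∀ a → 1 ≤ product (map _! a)
1≤product! []      = s≤s z≤n
1≤product! (n ∷ a) = ℕₚ.*-mono-≤ (ℕₚ.1≤n! n) (1≤product! a)

partialSum : 𝐀 → ℕ → ℕ
partialSum a zero    = 0
partialSum a (suc k) = partialSum a k + a ‼ k

partialSum-length : ∀ a → partialSum a (length a) ≡ sum a
partialSum-length []      = refl
partialSum-length (n ∷ a) = trans (shift n a (length a)) (cong (_+_ n) (partialSum-length a))
  where
  shift : ∀ n a k → partialSum (n ∷ a) (suc k) ≡ n + partialSum a k
  shift n a zero    = ℕₚ.+-comm 0 n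
  shift n a (suc k) = trans (cong (_+ a ‼ k) (shift n a k)) (ℕₚ.+-assoc n (partialSum a k) (a ‼ k))

-- Lets the count admit possible first letters one at a time; each new letter contributes the
-- arrangements of an exponent with one occurrence less.
HeadBelow : ℕ → Tuple → Set
HeadBelow k x = ∃₂ λ y x′ → x ≡ y ∷ x′ × y < k

-- Splitting by the first letter y, the multinomial bound follows from ∏ aᵢ! = a_y ∏ (decr y a)ᵢ!
-- and ∑ a_y = sum a; equality holds, but is not needed.
arrangements : ∀ a → ∃ λ n → Size (λ x → occs x ∼ a) (+ n) × sum a ! ≤ n * product (map _! a)
arrangements a = go (sum a) a refl
  where
  go : ∀ s a → sum a ≡ s → ∃ λ n → Size (λ x → occs x ∼ a) (+ n) × s ! ≤ n * product (map _! a)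
  go zero a e = 1 , Size-cong ((λ { refl i → sym (sum≡0⇒‼≡0 a e i) }) , λ {x} → nil x) (Size-singleton [])
              , subst (1 ≤_) (sym (ℕₚ.*-identityˡ _)) (1≤product! a)
    where
    nil : ∀ x → occs x ∼ a → x ≡ []
    nil []      _  = refl
    nil (y ∷ x) e′ = case trans (occs∼⇒length (y ∷ x) a e′) e of λ ()
  go (suc s) a e with below (length a)
    where
    below : ∀ k → ∃ λ n → Size (λ x → HeadBelow k x × occs x ∼ a) (+ n) ×
                          partialSum a k * s ! ≤ n * product (map _! a)
    below zero    = 0 , Size-∅ (λ { _ ((_ , _ , _ , ()) , _) }) , z≤n
    below (suc k) with below k | a ‼ k in eq
    ... | m , p , m≥ | zero = m , Size-cong
      ( (λ { ((y , x , refl , y<k) , e′) → (y , x , refl , ℕₚ.m<n⇒m<1+n y<k) , e′ })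
      , (λ { ((y , x , refl , y<1+k) , e′) → (y , x , refl , ℕₚ.≤∧≢⇒< (ℕₚ.≤-pred y<1+k)
           λ { refl → ℕₚ.<-irrefl (sym eq) (proj₁ (∼-decr y x a e′)) }) , e′ })) p
      , subst (λ z → z * s ! ≤ m * product (map _! a)) (sym (ℕₚ.+-identityʳ (partialSum a k))) m≥
    ... | m , p , m≥ | suc c with go s (decr k a) (ℕₚ.suc-injective (trans (sym (sum-decr k a k>)) e))
      where k> = subst (0 <_) (sym eq) (s≤s z≤n)
    ...   | n , q , n≥ = m + n , Size-cong
      ( (λ { (inj₁ ((y , x , refl , y<k) , e′)) → (y , x , refl , ℕₚ.m<n⇒m<1+n y<k) , e′
           ; (inj₂ (x , e′ , refl)) → (k , x , refl , ℕₚ.n<1+n k) , ∼-∷ k x a k> e′ })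
      , λ { ((y , x , refl , y<1+k) , e′) → split y x (ℕₚ.m<1+n⇒m<n∨m≡n y<1+k) e′ })
      (Size-⊎ {Q = λ z → ∃ λ x → occs x ∼ decr k a × k ∷ x ≡ z}
        (λ { (((_ , _ , refl , k<k) , _) , (_ , _ , refl)) → ℕₚ.<-irrefl refl k<k }) p
        (Size-map (k ∷_) (λ {x} e′ → x , e′ , refl) (λ _ _ → Listₚ.∷-injectiveʳ)
          (λ { _ (x , e′ , refl) → x , e′ , refl }) q))
      , (begin
        (partialSum a k + suc c) * s !              ≡⟨ ℕₚ.*-distribʳ-+ (s !) (partialSum a k) (suc c) ⟩
        partialSum a k * s ! + suc c * s !          ≤⟨ ℕₚ.+-mono-≤ m≥ (ℕₚ.*-monoʳ-≤ (suc c) n≥) ⟩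
        m * p! + suc c * (n * decr!)                ≡⟨ cong (_+_ (m * p!)) (swap (suc c) n decr!) ⟩
        m * p! + n * (suc c * decr!)                ≡⟨ cong (λ z → m * p! + n * (z * decr!)) eq ⟨
        m * p! + n * ((a ‼ k) * decr!)              ≡⟨ cong (λ z → m * p! + n * z) (product!-decr k a k>) ⟨
        m * p! + n * p!                             ≡⟨ ℕₚ.*-distribʳ-+ p! m n ⟨
        (m + n) * p!                                ∎)
      where
      open ℕₚ.≤-Reasoning
      p! decr! : ℕ
      p! = product (map _! a)
      decr! = product (map _! (decr k a))
      k> = subst (0 <_) (sym eq) (s≤s z≤n)
      swap : ∀ x y z → x * (y * z) ≡ y * (x * z)
      swap x y z = trans (sym (ℕₚ.*-assoc x y z)) (trans (cong (_* z) (ℕₚ.*-comm x y)) (ℕₚ.*-assoc y x z))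
      split : ∀ y x → y < k ⊎ y ≡ k → occs (y ∷ x) ∼ a →
              (HeadBelow k (y ∷ x) × occs (y ∷ x) ∼ a) ⊎ (∃ λ x′ → occs x′ ∼ decr k a × k ∷ x′ ≡ y ∷ x)
      split y x (inj₁ y<k)  e′ = inj₁ ((y , x , refl , y<k) , e′)
      split y x (inj₂ refl) e′ = inj₂ (x , proj₂ (∼-decr y x a e′) , refl)
  ... | n , p , n≥ = n , Size-cong (proj₂ , λ {x} e′ → head x e′ , e′) p
      , subst (λ z → z * s ! ≤ n * product (map _! a)) (trans (partialSum-length a) e) n≥
    where
    head : ∀ x → occs x ∼ a → HeadBelow (length a) x
    head []      e′ = case trans (occs∼⇒length [] a e′) e of λ ()
    head (y ∷ x) e′ with occs∼⇒All< (y ∷ x) a e′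
    ... | y< ∷ _ = y , x , refl , y<

arrangementCount : 𝐀 → ℕ
arrangementCount a = proj₁ (arrangements a)

arrangementCount-resp : ∀ {a b} → a ≋ b → arrangementCount a ≡ arrangementCount b
arrangementCount-resp {a} {b} e = ℤₚ.+-injective (Size-unique
  ((λ e′ i → trans (e′ i) (e i)) , (λ e′ i → trans (e′ i) (sym (e i))))
  (proj₁ (proj₂ (arrangements a))) (proj₁ (proj₂ (arrangements b))))

applyUpTo-∼ : ∀ (f : ℕ → ℕ) n → (∀ i → n ≤ i → f i ≡ 0) → f ∼ applyUpTo f n
applyUpTo-∼ f zero    p i       = p i z≤n
applyUpTo-∼ f (suc n) p zero    = refl
applyUpTo-∼ f (suc n) p (suc i) = applyUpTo-∼ (f ∘ suc) n (λ i n≤i → p (suc i) (s≤s n≤i)) i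

All≤⇒occ≡0 : ∀ {n} x → All (_≤ n) x → ∀ i → suc n ≤ i → occurrences i x ≡ 0
All≤⇒occ≡0 x x≤ i = All-<⇒occ≡0 x (All.map s≤s x≤)

-- Words selected by a series with natural coefficients

record Series-ℕ : Set where
  field
    multiplicity : 𝐀 → ℕ
    resp         : ∀ {a b} → a ≋ b → multiplicity a ≡ multiplicity b

  series : Series
  series = record { coeff = λ a → + multiplicity a ; coeff-resp = λ {a} {b} e → cong +_ (resp {a} {b} e) }

open Series-ℕ

module _ (c : Series-ℕ) (c≤ : ∀ a → multiplicity c a ≤ arrangementCount a) where

  selection : 𝐀 → List Tuple
  selection a = take (multiplicity c a) (elements (proj₁ (proj₂ (arrangements a))))

  -- Trimming fixes one enumeration for each monomial, since exponents differing by trailing zeros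
  -- may list their words in different orders.
  Selected : Pred Tuple 0ℓ
  Selected x = x ∈ˡ selection (trim (content x))

  trim-content : ∀ x a → occs x ∼ a → trim (content x) ≡ trim a
  trim-content x a e = trim-resp {content x} {a} λ i → trans (sym (occs∼content x i)) (e i)

  ∈-take : ∀ n {xs : List Tuple} {x} → x ∈ˡ take n xs → x ∈ˡ xs
  ∈-take (suc n) {_ ∷ _} (here e)   = here e
  ∈-take (suc n) {_ ∷ _} (there x∈) = there (∈-take n x∈)

  Selected-counts : Counts occs Selected (coeff (series c))
  Selected-counts a = record
    { elements = selection (trim a)
    ; unique   = Uniqueₚ.take⁺ n (unique W)
    ; size     = cong +_ (begin
        length (take n (elements W))    ≡⟨ Listₚ.length-take n (elements W) ⟩
        n ⊓ length (elements W)         ≡⟨ cong (n ⊓_) (ℤₚ.+-injective (size W)) ⟩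
        n ⊓ arrangementCount (trim a)   ≡⟨ ℕₚ.m≤n⇒m⊓n≡m (c≤ (trim a)) ⟩
        n                               ≡⟨ resp c {trim a} {a} (trim-‼ a) ⟩
        multiplicity c a                ∎)
    ; ∈⇔       = λ x → mk⇔
        (λ x∈ → let e = λ i → trans (to (∈⇔ W x) (∈-take n x∈) i) (trim-‼ a i)
                 in subst (λ b → x ∈ˡ selection b) (sym (trim-content x a e)) x∈ , e)
        (λ (x∈ , e) → subst (λ b → x ∈ˡ selection b) (trim-content x a e) x∈)
    }
    where
    open ≡-Reasoning
    n : ℕ
    n = multiplicity c (trim a)
    W : Size (λ x → occs x ∼ trim a) (+ arrangementCount (trim a))
    W = proj₁ (proj₂ (arrangements (trim a)))

  Selected-bound : Finitary (coeff (series c)) → ∀ n → ∃ λ h → ∀ x → All (_≤ n) x → Selected x → length x ≤ h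
  Selected-bound φ n with φ (suc n)
  ... | h , p = h , λ x x≤ sel → ℕₚ.≮⇒≥ λ h< →
    let a = applyUpTo (occs x) (suc n)
        e = applyUpTo-∼ (occs x) (suc n) (All≤⇒occ≡0 x x≤)
    in Size-0⇒empty (subst (Size _) (p a (ℕₚ.≤-reflexive (Listₚ.length-applyUpTo (occs x) (suc n)))
         (subst (h <_) (occs∼⇒length x a e) h<)) (Selected-counts a)) x (sel , e)

-- Point sets with a prescribed image under `β`

wordFrom : ℕ → 𝐀 → Tuple
wordFrom k []      = []
wordFrom k (n ∷ b) = replicate n k ++ wordFrom (suc k) b

occ-wordFrom-< : ∀ {j k} b → j < k → occurrences j (wordFrom k b) ≡ 0
occ-wordFrom-< []      _   = refl
occ-wordFrom-< {j} {k} (n ∷ b) j<k = trans (occ-++ j (replicate n k) _)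
  (cong₂ _+_ (occ-replicate-other n (ℕₚ.<⇒≢ j<k)) (occ-wordFrom-< b (ℕₚ.m<n⇒m<1+n j<k)))

occ-wordFrom : ∀ k b i → occurrences (k + i) (wordFrom k b) ≡ b ‼ i
occ-wordFrom k []      i       = refl
occ-wordFrom k (n ∷ b) zero    = trans (cong (λ j → occurrences j (wordFrom k (n ∷ b))) (ℕₚ.+-identityʳ k))
  (trans (occ-++ k (replicate n k) _) (trans
    (cong₂ _+_ (occ-replicate-same n k) (occ-wordFrom-< b (ℕₚ.n<1+n k))) (ℕₚ.+-identityʳ n)))
occ-wordFrom k (n ∷ b) (suc i) = trans (cong (λ j → occurrences j (wordFrom k (n ∷ b))) (ℕₚ.+-suc k i))
  (trans (occ-++ (suc k + i) (replicate n k) _)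
    (cong₂ _+_ (occ-replicate-other n (ℕₚ.>⇒≢ (s≤s (ℕₚ.m≤m+n k i)))) (occ-wordFrom (suc k) b i)))

wordFrom-resp : ∀ k {a b} → a ≋ b → wordFrom k a ≡ wordFrom k b
wordFrom-resp k {a} {b} = go k a b
  where
  nil : ∀ k b → [] ≋ b → [] ≡ wordFrom k b
  nil k []          e = refl
  nil k (zero  ∷ b) e = nil (suc k) b (e ∘ suc)
  nil k (suc n ∷ b) e with e 0
  ... | ()

  go : ∀ k a b → a ≋ b → wordFrom k a ≡ wordFrom k b
  go k []      b       e = nil k b e
  go k (m ∷ a) []      e = sym (nil k (m ∷ a) (sym ∘ e))
  go k (m ∷ a) (n ∷ b) e = cong₂ (λ n x → replicate n k ++ x) (e 0) (go (suc k) a b (e ∘ suc))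

length-wordFrom : ∀ k b → length (wordFrom k b) ≡ sum b
length-wordFrom k []      = refl
length-wordFrom k (n ∷ b) = trans (Listₚ.length-++ (replicate n k))
  (cong₂ _+_ (Listₚ.length-replicate n) (length-wordFrom (suc k) b))

Size-< : ∀ n → Size (_< n) (+ n)
Size-< n = record
  { elements = upTo n ; unique = Uniqueₚ.upTo⁺ n ; size = cong +_ (Listₚ.length-upTo n)
  ; ∈⇔ = λ i → mk⇔ ∈-upTo⁻ ∈-upTo⁺ }

All-≤-sum : ∀ b → All (_≤ sum b) b
All-≤-sum []      = []
All-≤-sum (n ∷ b) = ℕₚ.m≤m+n n (sum b) ∷ All.map (λ m≤ → ℕₚ.≤-trans m≤ (ℕₚ.m≤n+m (sum b) n)) (All-≤-sum b)

module Realisation (em : ExcludedMiddle 0ℓ) (P : 𝓡) (P≥0 : ∀ a → 0ℤ ≤ᶻ coeff (proj₁ P) a) where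

  open Sets em

  private
    N : 𝐀 → ℕ
    N b = ∣ β P b ∣

    N-resp : ∀ {a b} → a ≋ b → N a ≡ N b
    N-resp {a} {b} e = cong ∣_∣ (β-resp P {a} {b} e)

    -- The run of 0s is a label that separates words with the same b, and the letters of b start at
    -- 2 to leave it readable. With `suc i` in place of i the empty tuple never arises.
    rep : ℕ → 𝐀 → Tuple
    rep i b = replicate (suc i) 0 ++ wordFrom 2 b

    occ-rep : ∀ i b m → occurrences (2 + m) (rep i b) ≡ b ‼ m
    occ-rep i b m = trans (occ-++ (2 + m) (replicate (suc i) 0) (wordFrom 2 b))
      (cong₂ _+_ (occ-replicate-other (suc i) {2 + m} {0} λ ()) (occ-wordFrom 2 b m))

    length-rep : ∀ i b → length (rep i b) ≡ suc i + sum b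
    length-rep i b = trans (Listₚ.length-++ (replicate (suc i) 0))
      (cong₂ _+_ (Listₚ.length-replicate (suc i)) (length-wordFrom 2 b))

    IsRep : Pred Tuple 0ℓ
    IsRep x = ∃₂ λ b i → i < N b × x ≡ rep i b

    bnd : ∀ n → ∃ λ h → ∀ x → All (_≤ n) x → IsRep x → length x ≤ h
    bnd n with β-finitary P n
    ... | h , p with bounded-on N h n
    ...   | K , q = K + h , λ { x x≤ (b , i , i< , refl) → bound b i i< x≤ }
      where
      bound : ∀ b i → i < N b → All (_≤ n) (rep i b) → length (rep i b) ≤ K + h
      bound b i i< x≤ = subst (_≤ K + h) (sym (trans (cong length rep≡) (length-rep i a)))
        (ℕₚ.+-mono-≤ (ℕₚ.≤-trans i<′ (q a (All.map (λ m≤ → ℕₚ.≤-trans m≤ sum≤) (All-≤-sum a)) len)) sum≤)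
        where
        -- The letters of the word are at most n, so b vanishes from index n on and can be replaced
        -- by a list of length n, as `bounded-on` requires.
        a = applyUpTo (b ‼_) n
        b≋a : b ≋ a
        b≋a = applyUpTo-∼ (b ‼_) n λ m n≤m → trans (sym (occ-rep i b m))
          (All≤⇒occ≡0 (rep i b) x≤ (2 + m) (s≤s (ℕₚ.≤-trans n≤m (ℕₚ.n≤1+n m))))
        len : length a ≤ n
        len = ℕₚ.≤-reflexive (Listₚ.length-applyUpTo (b ‼_) n)
        rep≡ : rep i b ≡ rep i a
        rep≡ = cong (replicate (suc i) 0 ++_) (wordFrom-resp 2 {b} {a} b≋a)
        i<′ : i < N a
        i<′ = subst (i <_) (N-resp {b} {a} b≋a) i<
        sum≤ : sum a ≤ h
        -- A degree above h would make the coefficient 0 and leave no label i below it.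
        sum≤ = ℕₚ.≮⇒≥ λ h< → case subst (i <_) (cong ∣_∣ (p a len h<)) i<′ of λ ()

  -- Fewer words than the coefficient demands may have a given monomial of P. Labels remove this
  -- limit at the price of matching P only under `β`.
  realisation : 𝕎
  realisation = comprehension IsRep (λ { (_ , _ , _ , ()) }) bnd

  β-realisation : ∀ b → β (𝕊 realisation) b ≡ β P b
  β-realisation b = trans (Size-unique (id , id) (β-𝕊-counts realisation b) counted) (ℤₚ.0≤i⇒+∣i∣≡i (β-≥0 P P≥0 b))
    where
    ∈R = ∈-comprehension IsRep (λ { (_ , _ , _ , ()) }) bnd

    counted : Size (λ x → x ∈ ⟦ realisation ⟧ × (occs x ∘ suc ∘ suc) ∼ b) (+ N b)
    counted = Size-map (λ i → rep i b)
      (λ {i} i< → from (∈R (rep i b)) (b , i , i< , refl) , occ-rep i b)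
      (λ {i} {j} _ _ e → ℕₚ.suc-injective (ℕₚ.+-cancelʳ-≡ (sum b) (suc i) (suc j)
        (trans (sym (length-rep i b)) (trans (cong length e) (length-rep j b)))))
      (λ x (x∈ , e) → case to (∈R x) x∈ of λ { (a , i , i< , refl) →
        let a≋b = λ m → trans (sym (occ-rep i a m)) (e m) in
        i , subst (i <_) (N-resp {a} {b} a≋b) i<
        , cong (replicate (suc i) 0 ++_) (wordFrom-resp 2 {b} {a} (sym ∘ a≋b)) })
      (Size-< (N b))

-- Set functions with values in a ring

module RingIdentities (Q : CommutativeRing 0ℓ 0ℓ) where

  private
    ring : AlmostCommutativeRing 0ℓ 0ℓ
    ring = fromCommutativeRing Q (λ _ → nothing)

  open AlmostCommutativeRing ring renaming (_+_ to infixl 6 _∔_; _*_ to infixl 7 _·_)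

  +-interchange : ∀ x y z w → ((x ∔ y) ∔ (z ∔ w)) ≈ ((x ∔ z) ∔ (y ∔ w))
  +-interchange = solve-∀ ring

  -- With X for x + z and Y for y + w, this is the expansion of (X - z)(Y - w) with the negative
  -- terms moved across.
  *-differences : ∀ x y z w → (x · y ∔ ((x ∔ z) · w ∔ z · (y ∔ w))) ≈ ((x ∔ z) · (y ∔ w) ∔ z · w)
  *-differences = solve-∀ ring

abstract

  ∅ʷ : 𝕎
  ∅ʷ = record { χ = λ _ → false ; []∉ = refl ; finitary = λ _ → 0 , λ _ _ _ () }

  ∉∅ʷ : ∀ x → ¬ x ∈ ⟦ ∅ʷ ⟧
  ∉∅ʷ x ()

  ◁≐×ʷ : ∀ c A → ⟦ c ◁ A ⟧ ≐ ⟦ ｛ c ｝ʷ ×ʷ A ⟧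
  ◁≐×ʷ c A =
      (λ {x} x∈ → case to (∈-◁ c A x) x∈ of λ { (a , a∈ , e) →
        from (∈-×ʷ ｛ c ｝ʷ A x) (c ∷ [] , a , [c]∈｛｝ c , a∈ , e) })
    , (λ {x} x∈ → case to (∈-×ʷ ｛ c ｝ʷ A x) x∈ of λ { (y , a , y∈ , a∈ , e) →
        from (∈-◁ c A x) (a , a∈ , trans e (cong (_++ a) (∈｛｝⇒≡ c y y∈))) })

｛｝-multipliableˡ : ∀ c A → Multipliable ｛ c ｝ʷ A
｛｝-multipliableˡ c A {x} {x′} x∈ x′∈ _ _ e with ∈｛｝⇒≡ c x x∈ | ∈｛｝⇒≡ c x′ x′∈
... | refl | refl = refl , Listₚ.∷-injectiveʳ e

｛｝-multipliableʳ : ∀ A c → Multipliable A ｛ c ｝ʷ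
｛｝-multipliableʳ A c {x} {x′} {y} {y′} _ _ y∈ y′∈ e with ∈｛｝⇒≡ c y y∈ | ∈｛｝⇒≡ c y′ y′∈
... | refl | refl = proj₁ (Listₚ.∷ʳ-injective x x′ e) , refl

++-injective : ∀ (a a′ : Tuple) {b b′} → length a ≡ length a′ → a ++ b ≡ a′ ++ b′ → a ≡ a′ × b ≡ b′
++-injective []      []        _ e = refl , e
++-injective (x ∷ a) (x′ ∷ a′) l e with ++-injective a a′ (ℕₚ.suc-injective l) (Listₚ.∷-injectiveʳ e)
... | a≡a′ , b≡b′ = cong₂ _∷_ (Listₚ.∷-injectiveˡ e) a≡a′ , b≡b′

identity-Matching : ∀ {A B} → ⟦ A ⟧ ≐ ⟦ B ⟧ → Matching _↭_ A B
identity-Matching (A⊆B , B⊆A) = record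
  { there→ = id ; back = id ; there-∈ = A⊆B ; back-∈ = B⊆A
  ; back∘there = λ _ → refl ; there∘back = λ _ → refl ; related = λ _ → ↭-refl }

image-Matching : ∀ A B (t : Tuple → Tuple) →
  (∀ {a a′} → a ∈ ⟦ A ⟧ → a′ ∈ ⟦ A ⟧ → t a ≡ t a′ → a ≡ a′) → (∀ {a} → a ∈ ⟦ A ⟧ → t a ↭ a) →
  (∀ y → y ∈ ⟦ B ⟧ ⇔ (∃ λ a → a ∈ ⟦ A ⟧ × t a ≡ y)) → Matching _↭_ A B
image-Matching A B t inj perm image = record
  { there→     = t
  ; back       = back
  ; there-∈    = λ {a} a∈ → from (image (t a)) (a , a∈ , refl)
  ; back-∈     = λ {b} b∈ → proj₁ (back-spec b b∈)
  ; back∘there = λ {a} a∈ → let b∈ = from (image (t a)) (a , a∈ , refl) in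
      inj (proj₁ (back-spec (t a) b∈)) a∈ (proj₂ (back-spec (t a) b∈))
  ; there∘back = λ {b} b∈ → proj₂ (back-spec b b∈)
  ; related    = λ a∈ → ↭-sym (perm a∈)
  }
  where
  choose : ∀ y → Dec (y ∈ ⟦ B ⟧) → Tuple
  choose y (yes y∈) = proj₁ (to (image y) y∈)
  -- Outside B there is no preimage, and y serves as default.
  choose y (no  _)  = y

  back : Tuple → Tuple
  back y = choose y (T? (χ B y))

  back-spec : ∀ y → y ∈ ⟦ B ⟧ → back y ∈ ⟦ A ⟧ × t (back y) ≡ y
  back-spec y y∈ = spec (T? (χ B y))
    where
    spec : ∀ d → choose y d ∈ ⟦ A ⟧ × t (choose y d) ≡ y
    spec (yes y∈) = proj₂ (to (image y) y∈)
    spec (no  y∉) = contradiction y∈ y∉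

module Classes (em : ExcludedMiddle 0ℓ) where

  open Sets em

  -- The words 0ᵏ 1 a with k the length of a form a prefix code.
  encode : 𝕎 → 𝕎
  encode A = Padding.padded 0 1 (λ ()) length A

  -- The run of 0s announces the length of a, so a can be cut off from whatever follows.
  encode-multipliable : ∀ A B → Multipliable (encode A) B
  encode-multipliable A B {x} {x′} {b} {b′} x∈ x′∈ _ _ e
    with to (Padding.∈-padded 0 1 (λ ()) length A x) x∈ | to (Padding.∈-padded 0 1 (λ ()) length A x′) x′∈
  ... | a , _ , refl | a′ , _ , refl with padding-injective (λ ()) (trans (sym (assoc a b)) (trans e (assoc a′ b′)))
    where
    assoc : ∀ a b → padding 0 1 (length a) a ++ b ≡ padding 0 1 (length a) (a ++ b)
    assoc a b = Listₚ.++-assoc (replicate (length a) 0) (1 ∷ a) b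
  ...   | l≡ , ab≡ with ++-injective a a′ l≡ ab≡
  ...     | refl , b≡b′ = refl , b≡b′

  infixr 7 _⊗_
  -- A product for all pairs of sets; encoding the left factor does not change its class.
  _⊗_ : 𝕎 → 𝕎 → 𝕎
  A ⊗ B = encode A ×ʷ B

  module _ (Q : CommutativeRing 0ℓ 0ℓ) where

    open CommutativeRing Q
      renaming (refl to ≈-refl; sym to ≈-sym; trans to ≈-trans; _+_ to infixl 6 _∔_; _*_ to infixl 7 _·_)
    open RingProperties ring using (+-cancelˡ; +-cancelʳ)
    open RingIdentities Q
    open SetoidReasoning setoid

    -- The properties of the class of `𝕊 X` that hold modulo `𝓙` as well as modulo any gauge ideal.
    -- Single letters are normalised only below 2, as modulo `𝓙` the others are not 1.
    record IsCharacteristic (s : 𝕎 → Carrier) : Set where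
      field
        s-↭   : ∀ {A B} → Matching _↭_ A B → s A ≈ s B
        s-∅   : ∀ A → (∀ x → ¬ x ∈ ⟦ A ⟧) → s A ≈ 0#
        s-∪   : ∀ A B → ⟦ A ⟧ ⊥ ⟦ B ⟧ → s (A ∪ B) ≈ s A ∔ s B
        s-×   : ∀ A B → Multipliable A B → s (A ×ʷ B) ≈ s A · s B
        s-｛｝ : ∀ c → c < 2 → s ｛ c ｝ʷ ≈ 1#

      s-≐ : ∀ {A B} → ⟦ A ⟧ ≐ ⟦ B ⟧ → s A ≈ s B
      s-≐ e = s-↭ (identity-Matching e)

      s-◁ : ∀ c A → c < 2 → s (c ◁ A) ≈ s A
      s-◁ c A c<2 = begin
        s (c ◁ A)            ≈⟨ s-≐ (◁≐×ʷ c A) ⟩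
        s (｛ c ｝ʷ ×ʷ A)    ≈⟨ s-× ｛ c ｝ʷ A (｛｝-multipliableˡ c A) ⟩
        s ｛ c ｝ʷ · s A     ≈⟨ *-congʳ (s-｛｝ c c<2) ⟩
        1# · s A             ≈⟨ *-identityˡ (s A) ⟩
        s A                  ∎

      s-⊕ : ∀ A B → s (A ⊕ B) ≈ s A ∔ s B
      s-⊕ A B = ≈-trans (s-∪ (0 ◁ A) (1 ◁ B) (◁-⊥ A B λ ())) (+-cong (s-◁ 0 A (s≤s z≤n)) (s-◁ 1 B (s≤s (s≤s z≤n))))

      -- Both sides are the value at the union of A and B. Together with cancellation of addition in
      -- Q this yields (AP).
      s-∖ : ∀ A B → s A ∔ s (B ∖ʷ A) ≈ s B ∔ s (A ∖ʷ B)
      s-∖ A B = ≈-trans (≈-sym (s-∪ A (B ∖ʷ A) (disjoint A B)))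
        (≈-trans (s-≐ (union A B , union B A)) (s-∪ B (A ∖ʷ B) (disjoint B A)))
        where
        disjoint : ∀ A B → ⟦ A ⟧ ⊥ ⟦ B ∖ʷ A ⟧
        disjoint A B {x} (x∈A , x∈) = proj₂ (∈-∖ B A x x∈) x∈A

        union : ∀ A B {x} → x ∈ ⟦ A ∪ (B ∖ʷ A) ⟧ → x ∈ ⟦ B ∪ (A ∖ʷ B) ⟧
        union A B {x} x∈ with T? (χ B x) | ∈-∪ A (B ∖ʷ A) x∈
        ... | yes x∈B | _        = ∪-∈ B (A ∖ʷ B) (inj₁ x∈B)
        ... | no  x∉B | inj₁ x∈A = ∪-∈ B (A ∖ʷ B) (inj₂ (∖-∈ A B x x∈A x∉B))
        ... | no  x∉B | inj₂ x∈′ = contradiction (proj₁ (∈-∖ B A x x∈′)) x∉B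

      isPreEquinumerosity : IsPreEquinumerosity (λ A B → s A ≈ s B)
      isPreEquinumerosity = record
        { isEquivalence = record { refl = ≈-refl ; sym = ≈-sym ; trans = ≈-trans }
        ; extensional   = s-≐
        ; AP            = λ A B → mk⇔
            (λ A≈B → ≈-sym (+-cancelˡ (s A) _ _ (≈-trans (s-∖ A B) (+-congʳ (≈-sym A≈B)))))
            (λ e → +-cancelʳ (s (B ∖ʷ A)) _ _ (≈-trans (s-∖ A B) (+-congˡ e)))
        ; TP            = λ A B t inj perm image → s-↭ (image-Matching A B t inj perm image)
        ; UP            = λ A n n<2 → ≈-trans (s-× A ｛ n ｝ʷ (｛｝-multipliableʳ A n))
            (≈-trans (*-congˡ (s-｛｝ n n<2)) (*-identityʳ (s A)))
        }

      private module Pre = IsPreEquinumerosity isPreEquinumerosity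

      s-⊗ : ∀ A B → s (A ⊗ B) ≈ s A · s B
      s-⊗ A B = ≈-trans (s-× (encode A) B (encode-multipliable A B))
        (*-congʳ (Pre.padded-≈ {0} {1} (λ ()) (s≤s z≤n) (s≤s (s≤s z≤n)) length A))

      -- Subtraction is moved across so that both sides are sums, to which the additivity of s
      -- applies.
      _IsDifferenceOf_ : Carrier → 𝕎 × 𝕎 → Set
      x IsDifferenceOf (X , Y) = x ∔ s Y ≈ s X

      difference-resp : ∀ {x y} XY → x ≈ y → x IsDifferenceOf XY → y IsDifferenceOf XY
      difference-resp (X , Y) x≈y e = ≈-trans (+-congʳ (≈-sym x≈y)) e

      difference-s : ∀ X → s X IsDifferenceOf (X , ∅ʷ)
      difference-s X = ≈-trans (+-congˡ (s-∅ ∅ʷ ∉∅ʷ)) (+-identityʳ (s X))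

      difference-0 : ∀ X → 0# IsDifferenceOf (X , X)
      difference-0 X = +-identityˡ (s X)

      difference-neg : ∀ {x} X Y → x IsDifferenceOf (X , Y) → (- x) IsDifferenceOf (Y , X)
      difference-neg {x} X Y e = begin
        - x ∔ s X          ≈⟨ +-congˡ e ⟨
        - x ∔ (x ∔ s Y)    ≈⟨ +-assoc (- x) x (s Y) ⟨
        - x ∔ x ∔ s Y      ≈⟨ +-congʳ (-‿inverseˡ x) ⟩
        0# ∔ s Y           ≈⟨ +-identityˡ (s Y) ⟩
        s Y                ∎

      difference-+ : ∀ {x y} X Y X′ Y′ → x IsDifferenceOf (X , Y) → y IsDifferenceOf (X′ , Y′) →
                     (x ∔ y) IsDifferenceOf (X ⊕ X′ , Y ⊕ Y′)
      difference-+ {x} {y} X Y X′ Y′ e e′ = begin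
        x ∔ y ∔ s (Y ⊕ Y′)         ≈⟨ +-congˡ (s-⊕ Y Y′) ⟩
        x ∔ y ∔ (s Y ∔ s Y′)       ≈⟨ +-interchange x y (s Y) (s Y′) ⟩
        (x ∔ s Y) ∔ (y ∔ s Y′)     ≈⟨ +-cong e e′ ⟩
        s X ∔ s X′                 ≈⟨ s-⊕ X X′ ⟨
        s (X ⊕ X′)                 ∎

      difference-* : ∀ {x y} X Y X′ Y′ → x IsDifferenceOf (X , Y) → y IsDifferenceOf (X′ , Y′) →
                     (x · y) IsDifferenceOf (X ⊗ X′ ⊕ Y ⊗ Y′ , X ⊗ Y′ ⊕ Y ⊗ X′)
      difference-* {x} {y} X Y X′ Y′ e e′ = begin
        x · y ∔ s (X ⊗ Y′ ⊕ Y ⊗ X′)                        ≈⟨ +-congˡ (sum-of-products X Y′ Y X′) ⟩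
        x · y ∔ (s X · s Y′ ∔ s Y · s X′)                  ≈⟨ +-congˡ (+-cong (*-congʳ e) (*-congˡ e′)) ⟨
        x · y ∔ ((x ∔ s Y) · s Y′ ∔ s Y · (y ∔ s Y′))      ≈⟨ *-differences x y (s Y) (s Y′) ⟩
        (x ∔ s Y) · (y ∔ s Y′) ∔ s Y · s Y′                ≈⟨ +-congʳ (*-cong e e′) ⟩
        s X · s X′ ∔ s Y · s Y′                            ≈⟨ sum-of-products X X′ Y Y′ ⟨
        s (X ⊗ X′ ⊕ Y ⊗ Y′)                                ∎
        where
        sum-of-products : ∀ A B C D → s (A ⊗ B ⊕ C ⊗ D) ≈ s A · s B ∔ s C · s D
        sum-of-products A B C D = ≈-trans (s-⊕ (A ⊗ B) (C ⊗ D)) (+-cong (s-⊗ A B) (s-⊗ C D))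

      -- The cross sum criterion for equality of two formal differences.
      difference-unique : ∀ {x} X Y X′ Y′ → x IsDifferenceOf (X , Y) → x IsDifferenceOf (X′ , Y′) →
                          s (X ⊕ Y′) ≈ s (Y ⊕ X′)
      difference-unique {x} X Y X′ Y′ e e′ = begin
        s (X ⊕ Y′)                  ≈⟨ s-⊕ X Y′ ⟩
        s X ∔ s Y′                  ≈⟨ +-congʳ e ⟨
        x ∔ s Y ∔ s Y′              ≈⟨ +-congʳ (+-comm x (s Y)) ⟩
        s Y ∔ x ∔ s Y′              ≈⟨ +-assoc (s Y) x (s Y′) ⟩
        s Y ∔ (x ∔ s Y′)            ≈⟨ +-congˡ e′ ⟩
        s Y ∔ s X′                  ≈⟨ s-⊕ Y X′ ⟨
        s (Y ⊕ X′)                  ∎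

      difference-self : ∀ X Y → (s X - s Y) IsDifferenceOf (X , Y)
      difference-self X Y = begin
        s X ∔ - s Y ∔ s Y           ≈⟨ +-assoc (s X) (- s Y) (s Y) ⟩
        s X ∔ (- s Y ∔ s Y)         ≈⟨ +-congˡ (-‿inverseˡ (s Y)) ⟩
        s X ∔ 0#                    ≈⟨ +-identityʳ (s X) ⟩
        s X                         ∎

-- Characteristic series, generated ideals and the kernel of `β`

char-↭ : ∀ {A B} → Matching _↭_ A B → char A ≈ˢ char B
char-↭ {A} {B} M a = Size-unique (id , id)
  (Size-map there→
    (λ (x∈ , e) → there-∈ x∈ , λ i → trans (sym (↭⇒occ≡ (related x∈) i)) (e i))
    (λ (x∈ , _) (y∈ , _) e → trans (sym (back∘there x∈)) (trans (cong back e) (back∘there y∈)))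
    (λ y (y∈ , e) → back y , (back-∈ y∈ , λ i → trans (↭⇒occ≡ (related (back-∈ y∈)) i)
      (trans (cong (occurrences i) (there∘back y∈)) (e i))) , there∘back y∈)
    (char-counts A a))
  (char-counts B a)
  where open Matching M

char-∪ : ∀ A B → ⟦ A ⟧ ⊥ ⟦ B ⟧ → char (A ∪ B) ≈ˢ char A +ˢ char B
char-∪ A B A⊥B = Counts-unique ((λ {x} → ∈-∪ A B) , (λ {x} → ∪-∈ A B))
  (char-counts (A ∪ B)) (Counts-⊎ A⊥B (char-counts A) (char-counts B))

char-∅ : ∀ A → (∀ x → ¬ x ∈ ⟦ A ⟧) → char A ≈ˢ 0ˢ
char-∅ A A∅ a = Size-empty⇒0 (λ x (x∈ , _) → A∅ x x∈) (char-counts A a)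

module _ (R : CommutativeRing 0ℓ 0ℓ) (G : Pred (CommutativeRing.Carrier R) 0ℓ) where

  ⟨⟩-isIdeal : IsIdeal R (⟨_⟩ R G)
  ⟨⟩-isIdeal = record { ≈-resp = resp∈ ; 0∈ = zero∈ ; +-closed = sum∈ ; *-closed = mult∈ }

  ⟨⟩-least : ∀ {I : Pred (CommutativeRing.Carrier R) 0ℓ} → IsIdeal R I → G ⊆ I → ⟨_⟩ R G ⊆ I
  ⟨⟩-least {I} isIdeal G⊆I = go
    where
    open IsIdeal isIdeal
    go : ⟨_⟩ R G ⊆ I
    go (gen∈ g)     = G⊆I g
    go (resp∈ e p)  = ≈-resp e (go p)
    go zero∈        = 0∈
    go (sum∈ p q)   = +-closed (go p) (go q)
    go (mult∈ r p)  = *-closed r (go p)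

kerβ : Pred 𝓡 0ℓ
kerβ S = ∀ b → β S b ≡ 0ℤ

β-difference : ∀ S S′ b → (∀ b → β S b ≡ β S′ b) → β (S 𝓡.- S′) b ≡ 0ℤ
β-difference S S′ b e = trans (β-+ S (𝓡.- S′) b)
  (trans (cong₂ _+ᶻ_ (e b) (β-neg S′ b)) (ℤₚ.+-inverseʳ (β S′ b)))

kerβ-isIdeal : IsIdeal 𝓡-ring kerβ
kerβ-isIdeal = record
  { ≈-resp   = λ {S} {S′} e p b → trans (sym (β-cong S S′ e b)) (p b)
  -- Zero is taken as 1 - 1, whose image `β-difference` computes.
  ; 0∈       = λ b → trans (β-cong 𝓡.0# (𝓡.1# 𝓡.- 𝓡.1#) (λ a → sym (ℤₚ.+-inverseʳ (coeff 1ˢ a))) b)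
      (β-difference 𝓡.1# 𝓡.1# b (λ _ → refl))
  ; +-closed = λ {S} {S′} p q b → trans (β-+ S S′ b) (cong₂ _+ᶻ_ (p b) (q b))
  ; *-closed = λ S {S′} p b → trans (β-* S S′ b) (trans (conv-cong (λ _ → refl) p b)
      (trans (conv-comm (β S) (λ _ → 0ℤ) b) (conv-zeroˡ (β S) b)))
  }

t-1∈kerβ : ∀ n → n < 2 → (t n 𝓡.- 𝓡.1#) ∈ kerβ
t-1∈kerβ n n<2 b = β-difference (t n) 𝓡.1# b (β-t n n<2)

-- Only the two variables that `β` sends to 1, which keeps the generated ideal inside the kernel of
-- `β`.
Generator : Pred 𝓡 0ℓ
Generator S = ∃ λ n → n < 2 × S ≡ t n 𝓡.- 𝓡.1#

𝓙 : Pred 𝓡 0ℓ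
𝓙 = ⟨_⟩ 𝓡-ring Generator

𝓙-isIdeal : IsIdeal 𝓡-ring 𝓙
𝓙-isIdeal = ⟨⟩-isIdeal 𝓡-ring Generator

𝓙⊆ : ∀ {I : Pred 𝓡 0ℓ} → IsIdeal 𝓡-ring I → (∀ n → n < 2 → (t n 𝓡.- 𝓡.1#) ∈ I) → 𝓙 ⊆ I
𝓙⊆ isIdeal t∈ = ⟨⟩-least 𝓡-ring Generator isIdeal λ { (n , n<2 , refl) → t∈ n n<2 }

𝓡/𝓙 : CommutativeRing 0ℓ 0ℓ
𝓡/𝓙 = _/_ 𝓡-ring 𝓙-isIdeal

module 𝓡/𝓙 = CommutativeRing 𝓡/𝓙

β-resp-𝓙 : ∀ S S′ → S 𝓡/𝓙.≈ S′ → ∀ b → β S b ≡ β S′ b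
β-resp-𝓙 S S′ e b = ℤₚ.i-j≡0⇒i≡j (β S b) (β S′ b) (begin
  β S b +ᶻ -ᶻ β S′ b       ≡⟨ cong (β S b +ᶻ_) (β-neg S′ b) ⟨
  β S b +ᶻ β (𝓡.- S′) b    ≡⟨ β-+ S (𝓡.- S′) b ⟨
  β (S 𝓡.- S′) b           ≡⟨ 𝓙⊆ kerβ-isIdeal t-1∈kerβ e b ⟩
  0ℤ                       ∎)
  where open ≡-Reasoning

module _ (c : Series-ℕ) (degree : ℕ → ℕ)
         (degree-≤ : ∀ a → (∃ λ n → degree n < a ‼ n) → multiplicity c a ≡ 0) (b : ℕ)
         (bound-≤ : ∀ a → multiplicity c a * product (map _! a) ≤ b * (sum a !)) where

  bounded-ℕ : Bounded (series c)
  bounded-ℕ = record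
    { degree = degree ; degree-≤ = λ a p → cong +_ (degree-≤ a p) ; bound = b ; bound-≤ = bound-≤ }

-- Series modulo `𝓙` as differences of characteristic series

module Representation (em : ExcludedMiddle 0ℓ) where

  open Sets em
  open Classes em

  module _ (J : Pred 𝓡 0ℓ) (isIdeal : IsIdeal 𝓡-ring J) (t∈ : ∀ n → n < 2 → (t n 𝓡.- 𝓡.1#) ∈ J) where

    𝕊-isCharacteristic : IsCharacteristic (_/_ 𝓡-ring isIdeal) 𝕊
    𝕊-isCharacteristic = record
      { s-↭   = λ {A} {B} M → ≈⇒~ 𝓡-ring isIdeal {𝕊 A} {𝕊 B} (char-↭ M)
      ; s-∅   = λ A A∅ → ≈⇒~ 𝓡-ring isIdeal {𝕊 A} {𝓡.0#} (char-∅ A A∅)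
      ; s-∪   = λ A B A⊥B → ≈⇒~ 𝓡-ring isIdeal {𝕊 (A ∪ B)} {𝕊 A 𝓡.+ 𝕊 B} (char-∪ A B A⊥B)
      ; s-×   = λ A B m → ≈⇒~ 𝓡-ring isIdeal {𝕊 (A ×ʷ B)} {𝕊 A 𝓡.* 𝕊 B} (char-×ʷ A B m)
      ; s-｛｝ = λ n n<2 → IsIdeal.≈-resp isIdeal {t n 𝓡.- 𝓡.1#} {𝕊 ｛ n ｝ʷ 𝓡.- 𝓡.1#}
          (λ a → cong (_+ᶻ -ᶻ coeff 1ˢ a) (sym (char-｛｝ n a))) (t∈ n n<2)
      }

  t-1∈𝓙 : ∀ n → n < 2 → (t n 𝓡.- 𝓡.1#) ∈ 𝓙
  t-1∈𝓙 n n<2 = gen∈ (n , n<2 , refl)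

  module 𝕊/𝓙 = IsCharacteristic (𝕊-isCharacteristic 𝓙 𝓙-isIdeal t-1∈𝓙)
  open 𝕊/𝓙 using (_IsDifferenceOf_)

  Representable : Pred 𝓡 0ℓ
  Representable S = ∃₂ λ X Y → S IsDifferenceOf (X , Y)

  representable-resp : ∀ S S′ → S 𝓡/𝓙.≈ S′ → Representable S → Representable S′
  representable-resp S S′ e (X , Y , d) = X , Y , 𝕊/𝓙.difference-resp {S} {S′} (X , Y) e d

  representable-+ : ∀ S S′ → Representable S → Representable S′ → Representable (S 𝓡.+ S′)
  representable-+ S S′ (X , Y , d) (X′ , Y′ , d′) =
    X ⊕ X′ , Y ⊕ Y′ , 𝕊/𝓙.difference-+ {S} {S′} X Y X′ Y′ d d′

  representable-neg : ∀ S → Representable S → Representable (𝓡.- S)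
  representable-neg S (X , Y , d) = Y , X , 𝕊/𝓙.difference-neg {S} X Y d

  representable-𝕊 : ∀ X → Representable (𝕊 X)
  representable-𝕊 X = X , ∅ʷ , 𝕊/𝓙.difference-s X

  module _ (c : Series-ℕ) (c≤ : ∀ a → multiplicity c a ≤ arrangementCount a)
           (p : In𝓡 (series c)) where

    private
      -- A leading 0 excludes the empty tuple and multiplies the series by t₀, which is 1 modulo
      -- `𝓙`.
      Zeroed : Pred Tuple 0ℓ
      Zeroed x = ∃₂ λ a b → a ≡ 0 ∷ [] × Selected c c≤ b × x ≡ a ++ b

      bnd : ∀ n → ∃ λ h → ∀ x → All (_≤ n) x → Zeroed x → length x ≤ h
      bnd n with Selected-bound c c≤ (In𝓡-finitary p) n
      ... | h , q = suc h , λ { _ (_ ∷ x≤) (_ , x , refl , sel , refl) → s≤s (q x x≤ sel) }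

      X : 𝕎
      X = comprehension Zeroed (λ { (_ , _ , refl , _ , ()) }) bnd

      ∈X : ∀ x → x ∈ ⟦ X ⟧ ⇔ Zeroed x
      ∈X = ∈-comprehension Zeroed (λ { (_ , _ , refl , _ , ()) }) bnd

      char-X : char X ≈ˢ proj₁ (t 0) *ˢ series c
      char-X = Counts-unique ((λ {x} → to (∈X x)) , (λ {x} → from (∈X x))) (char-counts X)
        (conv-counts (λ { refl refl _ _ e → refl , Listₚ.∷-injectiveʳ e }) (t-counts 0) (Selected-counts c c≤))

    representable-selection : Representable (series c , p)
    representable-selection = representable-resp (𝕊 X) S (begin
      𝕊 X             ≈⟨ ≈⇒~ 𝓡-ring 𝓙-isIdeal {𝕊 X} {t 0 𝓡.* S} char-X ⟩
      t 0 𝓡.* S       ≈⟨ 𝓡/𝓙.*-cong {t 0} {𝓡.1#} {S} {S} (t-1∈𝓙 0 (s≤s z≤n)) (𝓡/𝓙.refl {S}) ⟩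
      𝓡.1# 𝓡.* S      ≈⟨ 𝓡/𝓙.*-identityˡ S ⟩
      S               ∎) (representable-𝕊 X)
      where
      S : 𝓡
      S = series c , p
      open SetoidReasoning 𝓡/𝓙.setoid

  -- Induction on the multinomial bound. The part of each coefficient up to the number of available
  -- words is a selection of words; since that number times the product of factorials is at least
  -- `sum a !`, the remainder satisfies the bound with b lowered by one.
  representable-ℕ : ∀ b (c : Series-ℕ) degree degree-≤ bound-≤ →
                    Representable (series c , bounded (bounded-ℕ c degree degree-≤ b bound-≤))
  representable-ℕ zero c degree degree-≤ bound-≤ = representable-resp 𝓡.0# S
    (≈⇒~ 𝓡-ring 𝓙-isIdeal {𝓡.0#} {S} λ a → cong +_ (sym (c≡0 a))) (∅ʷ , ∅ʷ , 𝕊/𝓙.difference-0 ∅ʷ)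
    where
    S : 𝓡
    S = series c , bounded (bounded-ℕ c degree degree-≤ 0 bound-≤)
    c≡0 : ∀ a → multiplicity c a ≡ 0
    c≡0 a = ℕₚ.n≤0⇒n≡0 (ℕₚ.≤-trans (ℕₚ.≤-trans (ℕₚ.≤-reflexive (sym (ℕₚ.*-identityʳ _)))
      (ℕₚ.*-monoʳ-≤ (multiplicity c a) (1≤product! a))) (bound-≤ a))
  representable-ℕ (suc b) c degree degree-≤ bound-≤ = representable-resp (S₁ 𝓡.+ S₂) S
    (≈⇒~ 𝓡-ring 𝓙-isIdeal {S₁ 𝓡.+ S₂} {S} λ a → cong +_ (split a))
    (representable-+ S₁ S₂ (representable-selection c₁ (λ a → ℕₚ.m⊓n≤n (n a) (w a)) (proj₂ S₁))
      (representable-ℕ b c₂ degree degree-≤₂ bound-≤₂))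
    where
    n w : 𝐀 → ℕ
    n = multiplicity c
    w = arrangementCount
    c₁ c₂ : Series-ℕ
    c₁ = record { multiplicity = λ a → n a ⊓ w a
                ; resp = λ {a} {a′} e → cong₂ _⊓_ (resp c {a} {a′} e) (arrangementCount-resp {a} {a′} e) }
    c₂ = record { multiplicity = λ a → n a ∸ w a
                ; resp = λ {a} {a′} e → cong₂ _∸_ (resp c {a} {a′} e) (arrangementCount-resp {a} {a′} e) }
    degree-≤₁ : ∀ a → (∃ λ i → degree i < a ‼ i) → n a ⊓ w a ≡ 0
    degree-≤₁ a p = cong (_⊓ w a) (degree-≤ a p)
    degree-≤₂ : ∀ a → (∃ λ i → degree i < a ‼ i) → n a ∸ w a ≡ 0
    degree-≤₂ a p = trans (cong (_∸ w a) (degree-≤ a p)) (ℕₚ.0∸n≡0 (w a))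
    bound-≤₁ : ∀ a → (n a ⊓ w a) * product (map _! a) ≤ suc b * (sum a !)
    bound-≤₁ a = ℕₚ.≤-trans (ℕₚ.*-monoˡ-≤ (product (map _! a)) (ℕₚ.m⊓n≤m (n a) (w a))) (bound-≤ a)
    bound-≤₂ : ∀ a → (n a ∸ w a) * product (map _! a) ≤ b * (sum a !)
    bound-≤₂ a = begin
      (n a ∸ w a) * p!                    ≡⟨ ℕₚ.*-distribʳ-∸ p! (n a) (w a) ⟩
      n a * p! ∸ w a * p!                 ≤⟨ ℕₚ.∸-mono (bound-≤ a) (proj₂ (proj₂ (arrangements a))) ⟩
      sum a ! + b * (sum a !) ∸ sum a !   ≡⟨ ℕₚ.m+n∸m≡n (sum a !) (b * (sum a !)) ⟩
      b * (sum a !)                       ∎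
      where
      open ℕₚ.≤-Reasoning
      p! = product (map _! a)
    S S₁ S₂ : 𝓡
    S  = series c , bounded (bounded-ℕ c degree degree-≤ (suc b) bound-≤)
    S₁ = series c₁ , bounded (bounded-ℕ c₁ degree degree-≤₁ (suc b) bound-≤₁)
    S₂ = series c₂ , bounded (bounded-ℕ c₂ degree degree-≤₂ b bound-≤₂)
    split : ∀ a → (n a ⊓ w a) + (n a ∸ w a) ≡ n a
    split a = trans (cong (_+ (n a ∸ w a)) (ℕₚ.⊓-comm (n a) (w a))) (ℕₚ.m⊓n+n∸m≡n (w a) (n a))

  positivePart negativePart : ℤ → ℕ
  positivePart (+ n)    = n
  positivePart -[1+ n ] = 0
  negativePart (+ n)    = 0
  negativePart -[1+ n ] = suc n

  positive-negative : ∀ z → + positivePart z +ᶻ -ᶻ + negativePart z ≡ z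
  positive-negative (+ n)    = ℤₚ.+-identityʳ (+ n)
  positive-negative -[1+ n ] = refl

  positivePart-≤ : ∀ z → positivePart z ≤ ∣ z ∣
  positivePart-≤ (+ n)    = ℕₚ.≤-refl
  positivePart-≤ -[1+ n ] = z≤n

  negativePart-≤ : ∀ z → negativePart z ≤ ∣ z ∣
  negativePart-≤ (+ n)    = z≤n
  negativePart-≤ -[1+ n ] = ℕₚ.≤-refl

  representable-bounded : ∀ {S} (B : Bounded S) → Representable (S , bounded B)
  representable-bounded {S} B = representable-resp (P 𝓡.- N) (S , bounded B)
    (≈⇒~ 𝓡-ring 𝓙-isIdeal {P 𝓡.- N} {S , bounded B} λ a → positive-negative (coeff S a))
    (representable-+ P (𝓡.- N) (part.representable positivePart refl positivePart-≤)
      (representable-neg N (part.representable negativePart refl negativePart-≤)))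
    where
    open Bounded B
    module part (f : ℤ → ℕ) (f0 : f 0ℤ ≡ 0) (f≤ : ∀ z → f z ≤ ∣ z ∣) where
      c : Series-ℕ
      c = record { multiplicity = λ a → f (coeff S a) ; resp = λ {a} {a′} e → cong f (coeff-resp S {a} {a′} e) }
      deg : ∀ a → (∃ λ i → degree i < a ‼ i) → f (coeff S a) ≡ 0
      deg a p = trans (cong f (degree-≤ a p)) f0
      bnd : ∀ a → f (coeff S a) * product (map _! a) ≤ bound * (sum a !)
      bnd a = ℕₚ.≤-trans (ℕₚ.*-monoˡ-≤ (product (map _! a)) (f≤ (coeff S a))) (bound-≤ a)
      element : 𝓡
      element = series c , bounded (bounded-ℕ c degree deg bound bnd)
      representable : Representable element
      representable = representable-ℕ bound c degree deg bnd
    P N : 𝓡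
    P = part.element positivePart refl positivePart-≤
    N = part.element negativePart refl negativePart-≤

  -- Induction on membership in `𝓡`. A product may violate every multinomial bound, but differences
  -- of sets multiply through `_⊗_`.
  representable : ∀ {S} (p : In𝓡 S) → Representable (S , p)
  representable (bounded B) = representable-bounded B
  representable (char∈ X)   = representable-𝕊 X
  representable (sum∈ {S} {S′} p q)  = representable-+ (S , p) (S′ , q) (representable p) (representable q)
  representable (neg∈ {S} p)         = representable-neg (S , p) (representable p)
  representable (prod∈ {S} {S′} p q) with representable p | representable q
  ... | X , Y , d | X′ , Y′ , d′ =
    X ⊗ X′ ⊕ Y ⊗ Y′ , X ⊗ Y′ ⊕ Y ⊗ X′ , 𝕊/𝓙.difference-* {S , p} {S′ , q} X Y X′ Y′ d d′
  representable (resp∈ {S} {S′} e p) =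
    representable-resp (S , p) (S′ , resp∈ e p) (≈⇒~ 𝓡-ring 𝓙-isIdeal {S , p} {S′ , resp∈ e p} e) (representable p)

  module _ (P : 𝓡) (P≥0 : ∀ a → 0ℤ ≤ᶻ coeff (proj₁ P) a) where

    open Realisation em P P≥0

    -- Equality under `β` is known to imply congruence only for characteristic series. So P is first
    -- written as a difference of X and Y; then X and `Z ⊕ Y` are compared, and the class of Y
    -- cancels.
    𝕊-realisation : P 𝓡/𝓙.≈ 𝕊 realisation
    𝕊-realisation = case representable (proj₂ P) of λ (X , Y , d) → cancel X Y d
      where
      Z = realisation
      open SetoidReasoning 𝓡/𝓙.setoid
      cancel : ∀ X Y → P IsDifferenceOf (X , Y) → P 𝓡/𝓙.≈ 𝕊 Z
      cancel X Y d = RingProperties.+-cancelʳ 𝓡/𝓙.ring (𝕊 Y) P (𝕊 Z) (begin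
        P 𝓡.+ 𝕊 Y       ≈⟨ d ⟩
        𝕊 X             ≈⟨ IsPreEquinumerosity.β≡⇒≈ 𝕊/𝓙.isPreEquinumerosity X (Z ⊕ Y) β≡ ⟩
        𝕊 (Z ⊕ Y)       ≈⟨ 𝕊/𝓙.s-⊕ Z Y ⟩
        𝕊 Z 𝓡.+ 𝕊 Y     ∎)
        where
        β≡ : ∀ b → β (𝕊 X) b ≡ β (𝕊 (Z ⊕ Y)) b
        β≡ b = trans (sym (β-resp-𝓙 (P 𝓡.+ 𝕊 Y) (𝕊 X) d b)) (trans (β-+ P (𝕊 Y) b)
          (trans (cong (_+ᶻ β (𝕊 Y) b) (sym (β-realisation b))) (trans (sym (β-+ (𝕊 Z) (𝕊 Y) b))
          (sym (β-resp-𝓙 (𝕊 (Z ⊕ Y)) (𝕊 Z 𝓡.+ 𝕊 Y) (𝕊/𝓙.s-⊕ Z Y) b)))))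

    -- An empty realisation would give zero image under `β`, which for non-negative P forces P to be
    -- zero.
    realisation-inhabited : ¬ (P 𝓡.≈ 𝓡.0#) → ∃ λ z → z ∈ ⟦ realisation ⟧
    realisation-inhabited P≉0 = inhabited em
      where
      inhabited : Dec (∃ λ z → z ∈ ⟦ realisation ⟧) → ∃ λ z → z ∈ ⟦ realisation ⟧
      inhabited (yes z) = z
      inhabited (no ¬z) = ⊥-elim (P≉0 (β-≡0 P P≥0 λ b → trans (sym (β-realisation b))
        (Size-empty⇒0 (λ x (x∈ , _) → ¬z (x , x∈)) (β-𝕊-counts realisation b))))

-- The order on sets and positivity in the ring

module Order (em : ExcludedMiddle 0ℓ) (Q : CommutativeRing 0ℓ 0ℓ) (s : 𝕎 → CommutativeRing.Carrier Q)
             (isCharacteristic : Classes.IsCharacteristic em Q s) (Pos : Pred (CommutativeRing.Carrier Q) 0ℓ) where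

  open Sets em
  open Classes em
  open CommutativeRing Q
    renaming (refl to ≈-refl; sym to ≈-sym; trans to ≈-trans; _+_ to infixl 6 _∔_; _*_ to infixl 7 _·_)
  open RingProperties ring using (+-cancelˡ)
  open SetoidReasoning setoid
  open IsCharacteristic isCharacteristic hiding (isPreEquinumerosity)
  module Pre = IsPreEquinumerosity (IsCharacteristic.isPreEquinumerosity isCharacteristic)

  Inhabited : Pred 𝕎 0ℓ
  Inhabited Z = ∃ λ z → z ∈ ⟦ Z ⟧

  -- The positive elements are, up to equality in Q, the values at inhabited sets, and none of them
  -- is zero. Comparisons of sets thus become additive equations.
  record IsPositivity : Set where
    field
      pos-≉0 : ∀ {x} → Pos x → ¬ x ≈ 0#
      pos-s  : ∀ Z → Inhabited Z → Pos (s Z)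
      pos⇒s  : ∀ {x} → Pos x → ∃ λ Z → Inhabited Z × x ≈ s Z

  infix 4 _<ᵠ_
  _<ᵠ_ : Rel Carrier 0ℓ
  x <ᵠ y = ∃ λ P → Pos P × y - x ≈ P

  -≈⇒≈+ : ∀ {x y z} → y - x ≈ z → y ≈ x ∔ z
  -≈⇒≈+ {x} {y} {z} e = begin
    y                   ≈⟨ +-identityʳ y ⟨
    y ∔ 0#              ≈⟨ +-congˡ (-‿inverseˡ x) ⟨
    y ∔ (- x ∔ x)       ≈⟨ +-assoc y (- x) x ⟨
    y - x ∔ x           ≈⟨ +-congʳ e ⟩
    z ∔ x               ≈⟨ +-comm z x ⟩
    x ∔ z               ∎

  ≈+⇒-≈ : ∀ {x y z} → y ≈ x ∔ z → y - x ≈ z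
  ≈+⇒-≈ {x} {y} {z} e = begin
    y - x               ≈⟨ +-congʳ e ⟩
    x ∔ z - x           ≈⟨ +-congʳ (+-comm x z) ⟩
    z ∔ x - x           ≈⟨ +-assoc z x (- x) ⟩
    z ∔ (x - x)         ≈⟨ +-congˡ (-‿inverseʳ x) ⟩
    z ∔ 0#              ≈⟨ +-identityʳ z ⟩
    z                   ∎

  ⊂-witness : ∀ A B → ⟦ B ⟧ ⊂ ⟦ A ⟧ → Inhabited (A ∖ʷ B)
  ⊂-witness A B (_ , A⊈B) = witness em
    where
    witness : Dec (Inhabited (A ∖ʷ B)) → Inhabited (A ∖ʷ B)
    witness (yes z) = z
    witness (no ¬z) = ⊥-elim (A⊈B λ {x} x∈A → decide x x∈A (T? (χ B x)))
      where
      decide : ∀ x → x ∈ ⟦ A ⟧ → Dec (x ∈ ⟦ B ⟧) → x ∈ ⟦ B ⟧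
      decide x x∈A (yes x∈B) = x∈B
      decide x x∈A (no  x∉B) = ⊥-elim (¬z (x , ∖-∈ A B x x∈A x∉B))

  s-⊂ : ∀ A B → ⟦ B ⟧ ⊆ ⟦ A ⟧ → s A ≈ s B ∔ s (A ∖ʷ B)
  s-⊂ A B B⊆A = begin
    s A                    ≈⟨ +-identityʳ (s A) ⟨
    s A ∔ 0#               ≈⟨ +-congˡ (s-∅ (B ∖ʷ A) λ x x∈ → proj₂ (∈-∖ B A x x∈) (B⊆A (proj₁ (∈-∖ B A x x∈)))) ⟨
    s A ∔ s (B ∖ʷ A)       ≈⟨ s-∖ A B ⟩
    s B ∔ s (A ∖ʷ B)       ∎

  -- Padding moves Z off X: X has words of bounded length only over the letters of a word.
  superset : ∀ X Z → Inhabited Z → ∃ λ Y → ⟦ X ⟧ ⊂ ⟦ Y ⟧ × s Y ≈ s X ∔ s Z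
  superset X Z (z , z∈) = X ∪ Z′
    , ((λ x∈ → ∪-∈ X Z′ (inj₁ x∈)) , λ ⊆X → disjoint (⊆X (∪-∈ X Z′ (inj₂ z′∈)) , z′∈))
    , ≈-trans (s-∪ X Z′ disjoint) (+-congˡ (Pre.padded-≈ {0} {1} (λ ()) (s≤s z≤n) (s≤s (s≤s z≤n)) long Z))
    where
    long : Tuple → ℕ
    -- `suc (sum a)` bounds every letter of the padded word, including the marker 1 when `sum a` is
    -- 0.
    long a = proj₁ (length-bound X (suc (sum a)))
    open Padding 0 1 (λ ()) long Z using (∈-padded) renaming (padded to Z′)

    z′∈ : padding 0 1 (long z) z ∈ ⟦ Z′ ⟧
    z′∈ = from (∈-padded _) (z , z∈ , refl)

    disjoint : ⟦ X ⟧ ⊥ ⟦ Z′ ⟧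
    disjoint {x} (x∈X , x∈Z′) with to (∈-padded x) x∈Z′
    ... | a , _ , refl = ℕₚ.<-irrefl refl (ℕₚ.<-≤-trans (ℕₚ.m<m+n (long a) (s≤s z≤n))
      (subst (_≤ long a) (length-padding 0 1 (long a) a) (proj₂ (length-bound X (suc (sum a))) _
        (Allₚ.++⁺ (Allₚ.replicate⁺ (long a) z≤n) (s≤s z≤n ∷ All.map (λ m≤ → ℕₚ.m≤n⇒m≤1+n m≤) (All-≤-sum a))) x∈X)))

  module _ (isPositivity : IsPositivity) (_≋_ : Rel 𝕎 0ℓ) (≋⇔ : ∀ X Y → (X ≋ Y) ⇔ s X ≈ s Y) where

    open IsPositivity isPositivity

    infix 4 _≺ʷ_
    _≺ʷ_ : Rel 𝕎 0ℓ
    _≺ʷ_ = flip (Succ _≋_)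

    -- The additive form of the order. Transitivity and monotonicity below are proved in this form
    -- and carried back by `+⇒≺`.
    ≺⇒+ : ∀ {A B} → A ≺ʷ B → ∃ λ Z → Inhabited Z × s B ≈ s A ∔ s Z
    ≺⇒+ {A} {B} (B′ , A′ , A′⊂B′ , B≋B′ , A≋A′) = B′ ∖ʷ A′ , ⊂-witness B′ A′ A′⊂B′ ,
      ≈-trans (to (≋⇔ B B′) B≋B′) (≈-trans (s-⊂ B′ A′ (proj₁ A′⊂B′)) (+-congʳ (≈-sym (to (≋⇔ A A′) A≋A′))))

    -- `Succ` permits replacing both sets by equivalent ones; here A itself stays in place, as
    -- property (3) demands.
    +⇒superset : ∀ {A B} → (∃ λ Z → Inhabited Z × s B ≈ s A ∔ s Z) → ∃ λ B′ → ⟦ A ⟧ ⊂ ⟦ B′ ⟧ × B ≋ B′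
    +⇒superset {A} {B} (Z , z , e) = case superset A Z z of λ
      (B′ , A⊂B′ , e′) → B′ , A⊂B′ , from (≋⇔ B B′) (≈-trans e (≈-sym e′))

    superset⇒≺ : ∀ {A B} → (∃ λ B′ → ⟦ A ⟧ ⊂ ⟦ B′ ⟧ × B ≋ B′) → A ≺ʷ B
    superset⇒≺ {A} (B′ , A⊂B′ , B≋B′) = B′ , A , A⊂B′ , B≋B′ , from (≋⇔ A A) ≈-refl

    +⇒≺ : ∀ {A B} → (∃ λ Z → Inhabited Z × s B ≈ s A ∔ s Z) → A ≺ʷ B
    +⇒≺ p = superset⇒≺ (+⇒superset p)

    ≺⇔superset : ∀ A B → A ≺ʷ B ⇔ (∃ λ B′ → ⟦ A ⟧ ⊂ ⟦ B′ ⟧ × B ≋ B′)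
    ≺⇔superset A B = mk⇔ (λ p → +⇒superset (≺⇒+ p)) superset⇒≺

    ≺⇒<ᵠ : ∀ {A B} → A ≺ʷ B → s A <ᵠ s B
    ≺⇒<ᵠ p with ≺⇒+ p
    ... | Z , z , e = s Z , pos-s Z z , ≈+⇒-≈ e

    <ᵠ⇒≺ : ∀ {A B} → s A <ᵠ s B → A ≺ʷ B
    <ᵠ⇒≺ (P , pos , e) with pos⇒s pos
    ... | Z , z , P≈ = +⇒≺ (Z , z , -≈⇒≈+ (≈-trans e P≈))

    ≺-irrefl : ∀ {A B} → A ≋ B → ¬ A ≺ʷ B
    ≺-irrefl {A} {B} A≋B A≺B with ≺⇒+ A≺B
    ... | Z , z , e = pos-≉0 (pos-s Z z) (+-cancelˡ (s A) _ _
      (≈-trans (≈-sym e) (≈-trans (≈-sym (to (≋⇔ A B) A≋B)) (≈-sym (+-identityʳ (s A))))))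

    ≺-trans : ∀ {A B C} → A ≺ʷ B → B ≺ʷ C → A ≺ʷ C
    ≺-trans {A} A≺B B≺C with ≺⇒+ A≺B | ≺⇒+ B≺C
    ... | Z , z , e | Z′ , z′ , e′ = +⇒≺ (Z ⊕ Z′ , inhabited z
      , ≈-trans e′ (≈-trans (+-congʳ e) (≈-trans (+-assoc (s A) (s Z) (s Z′)) (+-congˡ (≈-sym (s-⊕ Z Z′))))))
      where
      inhabited : Inhabited Z → Inhabited (Z ⊕ Z′)
      inhabited (x , x∈) = 0 ∷ x , ∪-∈ (0 ◁ Z) (1 ◁ Z′) (inj₁ (from (∈-◁ 0 Z _) (x , x∈ , refl)))

    ≺-resp : ∀ {A A′ B B′} → A ≋ A′ → B ≋ B′ → A ≺ʷ B → A′ ≺ʷ B′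
    ≺-resp {A} {A′} {B} {B′} A≋A′ B≋B′ p with ≺⇒+ p
    ... | Z , z , e = +⇒≺ (Z , z , ≈-trans (≈-sym (to (≋⇔ B B′) B≋B′)) (≈-trans e (+-congʳ (to (≋⇔ A A′) A≋A′))))

    ≋-refl : ∀ {A} → A ≋ A
    ≋-refl {A} = from (≋⇔ A A) ≈-refl

    ≋-isEquivalence : IsEquivalence _≋_
    ≋-isEquivalence = record
      { refl  = ≋-refl
      ; sym   = λ {A} {B} p → from (≋⇔ B A) (≈-sym (to (≋⇔ A B) p))
      ; trans = λ {A} {B} {C} p q → from (≋⇔ A C) (≈-trans (to (≋⇔ A B) p) (to (≋⇔ B C) q))
      }

    -- The sign that the gauge condition assigns to the difference of the two values decides which
    -- set is larger.
    ≺-compare : (∀ x → ¬ x ≈ 0# → ∃ λ P → Pos P × (x ∔ P ≈ 0# ⊎ x - P ≈ 0#)) → Trichotomous _≋_ _≺ʷ_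
    ≺-compare gauge A B = decide em
      where
      0<⇒≺ : ∀ {A B P} → Pos P → s A - s B ∔ P ≈ 0# → A ≺ʷ B
      0<⇒≺ {A} {B} {P} pos e = <ᵠ⇒≺ (P , pos , ≈+⇒-≈ (begin
        s B                          ≈⟨ +-identityˡ (s B) ⟨
        0# ∔ s B                     ≈⟨ +-congʳ e ⟨
        s A - s B ∔ P ∔ s B          ≈⟨ +-assoc (s A - s B) P (s B) ⟩
        s A - s B ∔ (P ∔ s B)        ≈⟨ +-congˡ (+-comm P (s B)) ⟩
        s A - s B ∔ (s B ∔ P)        ≈⟨ +-assoc (s A - s B) (s B) P ⟨
        s A - s B ∔ s B ∔ P          ≈⟨ +-congʳ (difference-self A B) ⟩
        s A ∔ P                      ∎))

      <0⇒≺ : ∀ {A B P} → Pos P → s A - s B - P ≈ 0# → B ≺ʷ A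
      <0⇒≺ {A} {B} {P} pos e = <ᵠ⇒≺ (P , pos , ≈-trans (-≈⇒≈+ e) (+-identityʳ P))

      decide : Dec (s A ≈ s B) → Tri (A ≺ʷ B) (A ≋ B) (B ≺ʷ A)
      decide (yes A≈B) = tri≈ (≺-irrefl A≋B) A≋B (≺-irrefl (from (≋⇔ B A) (≈-sym A≈B)))
        where A≋B = from (≋⇔ A B) A≈B
      decide (no A≉B) with gauge (s A - s B) (λ e → A≉B (≈-trans (-≈⇒≈+ e) (+-identityʳ (s B))))
      ... | P , pos , inj₁ e = tri< A≺B (A≉B ∘ to (≋⇔ A B)) (λ B≺A → ≺-irrefl ≋-refl (≺-trans A≺B B≺A))
        where A≺B = 0<⇒≺ pos e
      ... | P , pos , inj₂ e = tri> (λ A≺B → ≺-irrefl ≋-refl (≺-trans A≺B B≺A)) (A≉B ∘ to (≋⇔ A B)) B≺A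
        where B≺A = <0⇒≺ pos e

    ⊕-mono : ∀ C {A B} → A ≺ʷ B → (A ⊕ C) ≺ʷ (B ⊕ C)
    ⊕-mono C {A} {B} p with ≺⇒+ p
    ... | Z , z , e = +⇒≺ (Z , z , (begin
      s (B ⊕ C)              ≈⟨ s-⊕ B C ⟩
      s B ∔ s C              ≈⟨ +-congʳ e ⟩
      s A ∔ s Z ∔ s C        ≈⟨ +-assoc (s A) (s Z) (s C) ⟩
      s A ∔ (s Z ∔ s C)      ≈⟨ +-congˡ (+-comm (s Z) (s C)) ⟩
      s A ∔ (s C ∔ s Z)      ≈⟨ +-assoc (s A) (s C) (s Z) ⟨
      s A ∔ s C ∔ s Z        ≈⟨ +-congʳ (s-⊕ A C) ⟨
      s (A ⊕ C) ∔ s Z        ∎))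

    -- Positivity of C gives an inhabited W with the same value. The product of W with the surplus Z
    -- is inhabited and is the surplus of the product.
    ⊗-mono : ∀ C {A B} → ∅ʷ ≺ʷ C → A ≺ʷ B → (A ⊗ C) ≺ʷ (B ⊗ C)
    ⊗-mono C {A} {B} 0≺C A≺B with ≺⇒+ 0≺C | ≺⇒+ A≺B
    ... | W , w , e′ | Z , z , e = +⇒≺ (Z ⊗ W , inhabited z w , (begin
      s (B ⊗ C)              ≈⟨ s-⊗ B C ⟩
      s B · s C              ≈⟨ *-congʳ e ⟩
      (s A ∔ s Z) · s C      ≈⟨ distribʳ (s C) (s A) (s Z) ⟩
      s A · s C ∔ s Z · s C  ≈⟨ +-cong (≈-sym (s-⊗ A C)) (≈-trans (*-congˡ sC≈sW) (≈-sym (s-⊗ Z W))) ⟩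
      s (A ⊗ C) ∔ s (Z ⊗ W)  ∎))
      where
      sC≈sW : s C ≈ s W
      sC≈sW = ≈-trans e′ (≈-trans (+-congʳ (s-∅ ∅ʷ ∉∅ʷ)) (+-identityˡ (s W)))
      inhabited : Inhabited Z → Inhabited W → Inhabited (Z ⊗ W)
      inhabited (x , x∈) (y , y∈) = padding 0 1 (length x) x ++ y
        , from (∈-×ʷ (encode Z) W (padding 0 1 (length x) x ++ y)) (padding 0 1 (length x) x , y
          , from (Padding.∈-padded 0 1 (λ ()) length Z (padding 0 1 (length x) x)) (x , x∈ , refl) , y∈ , refl)

    open MonoidMorphisms using (IsMonoidMonomorphism)

    𝕎-+-monoid 𝕎-*-monoid : RawMonoid 0ℓ 0ℓ
    𝕎-+-monoid = record { _≈_ = _≋_ ; _∙_ = _⊕_ ; ε = ∅ʷ }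
    𝕎-*-monoid = record { _≈_ = _≋_ ; _∙_ = _⊗_ ; ε = ｛ 0 ｝ʷ }

    +-isMonoidMonomorphism : IsMonoidMonomorphism 𝕎-+-monoid (record { _≈_ = _≈_ ; _∙_ = _∔_ ; ε = 0# }) s
    +-isMonoidMonomorphism = record
      { isMonoidHomomorphism = record
        { isMagmaHomomorphism = record
          { isRelHomomorphism = record { cong = λ {A} {B} → to (≋⇔ A B) } ; homo = s-⊕ }
        ; ε-homo = s-∅ ∅ʷ ∉∅ʷ }
      ; injective = λ {A} {B} → from (≋⇔ A B) }

    *-isMonoidMonomorphism : IsMonoidMonomorphism 𝕎-*-monoid (record { _≈_ = _≈_ ; _∙_ = _·_ ; ε = 1# }) s
    *-isMonoidMonomorphism = record
      { isMonoidHomomorphism = record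
        { isMagmaHomomorphism = record
          { isRelHomomorphism = record { cong = λ {A} {B} → to (≋⇔ A B) } ; homo = s-⊗ }
        ; ε-homo = s-｛｝ 0 (s≤s z≤n) }
      ; injective = λ {A} {B} → from (≋⇔ A B) }

    -- The laws are pulled back from Q: s is injective up to `_≋_` and carries `_⊕_` and `_⊗_` to
    -- the ring operations.
    𝕎-isCommutativeSemiring : IsCommutativeSemiring _≋_ _⊕_ _⊗_ ∅ʷ ｛ 0 ｝ʷ
    𝕎-isCommutativeSemiring = IsCommutativeSemiringˡ.isCommutativeSemiring (record
      { +-isCommutativeMonoid = MonoidMonomorphism.isCommutativeMonoid +-isMonoidMonomorphism +-isCommutativeMonoid
      ; *-isCommutativeMonoid = MonoidMonomorphism.isCommutativeMonoid *-isMonoidMonomorphism *-isCommutativeMonoid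
      ; distribʳ = λ A B C → from (≋⇔ ((B ⊕ C) ⊗ A) (B ⊗ A ⊕ C ⊗ A)) (begin
          s ((B ⊕ C) ⊗ A)            ≈⟨ s-⊗ (B ⊕ C) A ⟩
          s (B ⊕ C) · s A            ≈⟨ *-congʳ (s-⊕ B C) ⟩
          (s B ∔ s C) · s A          ≈⟨ distribʳ (s A) (s B) (s C) ⟩
          s B · s A ∔ s C · s A      ≈⟨ +-cong (s-⊗ B A) (s-⊗ C A) ⟨
          s (B ⊗ A) ∔ s (C ⊗ A)      ≈⟨ s-⊕ (B ⊗ A) (C ⊗ A) ⟨
          s (B ⊗ A ⊕ C ⊗ A)          ∎)
      ; zeroˡ = λ A → from (≋⇔ (∅ʷ ⊗ A) ∅ʷ) (≈-trans (s-⊗ ∅ʷ A) (≈-trans (*-congʳ (s-∅ ∅ʷ ∉∅ʷ))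
          (≈-trans (zeroˡ (s A)) (≈-sym (s-∅ ∅ʷ ∉∅ʷ)))))
      })

    isOrderedSemiring : Trichotomous _≋_ _≺ʷ_ → IsOrderedSemiring _≋_ _≺ʷ_ _⊕_ _⊗_ ∅ʷ ｛ 0 ｝ʷ
    isOrderedSemiring compare = record
      { isCommutativeSemiring = 𝕎-isCommutativeSemiring
      ; isStrictTotalOrder    = record
        { isStrictPartialOrder = record
          { isEquivalence = ≋-isEquivalence
          ; irrefl        = ≺-irrefl
          ; trans         = ≺-trans
          ; <-resp-≈      = (λ e → ≺-resp ≋-refl e) , (λ e → ≺-resp e ≋-refl)
          }
        ; compare = compare
        }
      ; +-monoˡ-< = ⊕-mono
      ; *-monoˡ-< = ⊗-mono
      }

-- The correspondence and the embedding

module Correspondence (em : ExcludedMiddle 0ℓ) where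

  open Sets em
  open Classes em
  open Representation em
  open 𝕊/𝓙 using (_IsDifferenceOf_)

  𝕊-positive : ∀ Z → (∃ λ z → z ∈ ⟦ Z ⟧) → 𝕊 Z ∈ 𝓡⁺
  𝕊-positive Z (z , z∈) =
      (λ 𝕊Z≈0 → Size-0⇒empty (subst (Size _) (𝕊Z≈0 (content z)) (char-counts Z (content z))) z (z∈ , occs∼content z))
    , (λ a → Size-≥0 (char-counts Z a))

  -- The gauge ideal of an equinumerosity

  module FromEquinumerosity (E : Equinumerosity) where

    module E = Equinumerosity E

    isPreEquinumerosity : IsPreEquinumerosity E._≈_
    isPreEquinumerosity = record
      { isEquivalence = E.isEquivalence
      ; extensional   = E.extensional
      ; AP            = E.AP
      ; TP            = E.TP
      ; UP            = λ A n _ → E.UP A n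
      }

    open IsPreEquinumerosity isPreEquinumerosity
      using (≈-refl; ≈-sym; ≈-trans; ⊕-cong; ⊕-cancelʳ; ∪≈⊕; 0◁-≈; 1◁-≈; β≡⇒≈)

    -- Congruence modulo `𝓙` preserves `β`, and every equinumerosity identifies sets with the same
    -- image under `β`.
    𝕊~⇒≈ : ∀ X Y → 𝕊 X 𝓡/𝓙.≈ 𝕊 Y → X E.≈ Y
    𝕊~⇒≈ X Y e = β≡⇒≈ X Y (β-resp-𝓙 (𝕊 X) (𝕊 Y) e)

    -- The encoded left factor makes both pairs multipliable, so (PP) applies to arbitrary B and B′.
    ⊗-congˡ : ∀ A {B B′} → B E.≈ B′ → (A ⊗ B) E.≈ (A ⊗ B′)
    ⊗-congˡ A {B} {B′} e = E.PP (encode A) B (encode A) B′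
      (encode-multipliable A B) (encode-multipliable A B′) ≈-refl e

    𝓘 : Pred 𝓡 0ℓ
    𝓘 S = ∃₂ λ X Y → X E.≈ Y × S IsDifferenceOf (X , Y)

    𝓘-isIdeal : IsIdeal 𝓡-ring 𝓘
    𝓘-isIdeal = record
      { ≈-resp   = λ {S} {S′} e (X , Y , X≈Y , d) →
          X , Y , X≈Y , 𝕊/𝓙.difference-resp {S} {S′} (X , Y) (≈⇒~ 𝓡-ring 𝓙-isIdeal {S} {S′} e) d
      ; 0∈       = ∅ʷ , ∅ʷ , ≈-refl , 𝕊/𝓙.difference-0 ∅ʷ
      ; +-closed = λ {S} {S′} (X , Y , X≈Y , d) (X′ , Y′ , X′≈Y′ , d′) →
          X ⊕ X′ , Y ⊕ Y′ , ⊕-cong X≈Y X′≈Y′ , 𝕊/𝓙.difference-+ {S} {S′} X Y X′ Y′ d d′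
      -- With R as U - V the product is (UX + VY) - (UY + VX), and the two brackets are equivalent
      -- term by term.
      ; *-closed = λ R {S} (X , Y , X≈Y , d) → case representable (proj₂ R) of λ (U , V , d′) →
          U ⊗ X ⊕ V ⊗ Y , U ⊗ Y ⊕ V ⊗ X , ⊕-cong (⊗-congˡ U X≈Y) (⊗-congˡ V (≈-sym X≈Y))
          , 𝕊/𝓙.difference-* {R} {S} U V X Y d′ d
      }

    -- If the difference of X and Y is also that of equivalent X′ and Y′, then `X ⊕ Y′` and `Y ⊕ X′`
    -- are congruent modulo `𝓙`, hence equivalent, and the primed summands cancel.
    𝓘-𝕊 : ∀ X Y → X E.≈ Y ⇔ (𝕊 X 𝓡.- 𝕊 Y) ∈ 𝓘
    𝓘-𝕊 X Y = mk⇔ (λ X≈Y → X , Y , X≈Y , 𝕊/𝓙.difference-self X Y)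
      λ (X′ , Y′ , X′≈Y′ , d) → ⊕-cancelʳ (≈-sym X′≈Y′)
        (𝕊~⇒≈ (X ⊕ Y′) (Y ⊕ X′) (𝕊/𝓙.difference-unique {𝕊 X 𝓡.- 𝕊 Y} X Y X′ Y′ (𝕊/𝓙.difference-self X Y) d))

    𝓘-resp-𝓙 : ∀ S S′ → S 𝓡/𝓙.≈ S′ → S ∈ 𝓘 → S′ ∈ 𝓘
    𝓘-resp-𝓙 S S′ e (X , Y , X≈Y , d) = X , Y , X≈Y , 𝕊/𝓙.difference-resp {S} {S′} (X , Y) e d

    -- The word with letters 0 and n is n with 0 in front, and also 0 with n appended; either letter
    -- can be removed.
    ｛｝-≈ : ∀ n → ｛ n ｝ʷ E.≈ ｛ 0 ｝ʷ
    ｛｝-≈ n = ≈-trans (≈-sym (0◁-≈ ｛ n ｝ʷ)) (≈-trans (E.extensional (◁≐×ʷ 0 ｛ n ｝ʷ)) (E.UP ｛ 0 ｝ʷ n))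

    𝓘₀⊆𝓘 : 𝓘₀ ⊆ 𝓘
    𝓘₀⊆𝓘 = ⟨⟩-least 𝓡-ring _ 𝓘-isIdeal λ { (n , refl) →
      𝓘-resp-𝓙 (𝕊 ｛ n ｝ʷ 𝓡.- 𝕊 ｛ 0 ｝ʷ) (t n 𝓡.- 𝓡.1#)
        (𝓡/𝓙.+-cong {𝕊 ｛ n ｝ʷ} {t n} {𝓡.- 𝕊 ｛ 0 ｝ʷ} {𝓡.- 𝓡.1#}
          (≈⇒~ 𝓡-ring 𝓙-isIdeal {𝕊 ｛ n ｝ʷ} {t n} (char-｛｝ n))
          (𝓡/𝓙.-‿cong {𝕊 ｛ 0 ｝ʷ} {𝓡.1#} (𝕊/𝓙.s-｛｝ 0 (s≤s z≤n))))
        (to (𝓘-𝕊 ｛ n ｝ʷ ｛ 0 ｝ʷ) (｛｝-≈ n)) }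

    ≺-irrefl : ∀ {A B} → A E.≈ B → ¬ Succ E._≈_ A B
    ≺-irrefl {A} {B} A≈B A≻B with E.ZP B A
    ... | tri< _ B≉A _ = B≉A (≈-sym A≈B)
    ... | tri≈ ¬B≺A _ _ = ¬B≺A A≻B
    ... | tri> _ B≉A _ = B≉A (≈-sym A≈B)

    -- If P were the difference of equivalent X and Y, then X would be equivalent to `Z ⊕ Y` with Z
    -- inhabited. This properly contains `1 ◁ Y`, a copy of Y, against (ZP).
    𝓡⁺⊥𝓘 : 𝓡⁺ ⊥ 𝓘
    𝓡⁺⊥𝓘 {P} ((P≉0 , P≥0) , (X , Y , X≈Y , d)) =
      ≺-irrefl X≈Y (Z ⊕ Y , 1 ◁ Y , (Y⊆ , λ ⊆Y → outside (realisation-inhabited P P≥0 P≉0) ⊆Y) , X≈Z⊕Y , ≈-sym (1◁-≈ Y))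
      where
      Z = Realisation.realisation em P P≥0
      open SetoidReasoning 𝓡/𝓙.setoid

      X≈Z⊕Y : X E.≈ (Z ⊕ Y)
      X≈Z⊕Y = 𝕊~⇒≈ X (Z ⊕ Y) (begin
        𝕊 X             ≈⟨ d ⟨
        P 𝓡.+ 𝕊 Y       ≈⟨ 𝓡/𝓙.+-congʳ {𝕊 Y} {P} {𝕊 Z} (𝕊-realisation P P≥0) ⟩
        𝕊 Z 𝓡.+ 𝕊 Y     ≈⟨ 𝕊/𝓙.s-⊕ Z Y ⟨
        𝕊 (Z ⊕ Y)       ∎)

      Y⊆ : ⟦ 1 ◁ Y ⟧ ⊆ ⟦ Z ⊕ Y ⟧
      Y⊆ y∈ = ∪-∈ (0 ◁ Z) (1 ◁ Y) (inj₂ y∈)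

      outside : (∃ λ z → z ∈ ⟦ Z ⟧) → ¬ ⟦ Z ⊕ Y ⟧ ⊆ ⟦ 1 ◁ Y ⟧
      outside (z , z∈) ⊆Y = ◁-⊥ Z Y (λ ()) (0z∈ , ⊆Y (∪-∈ (0 ◁ Z) (1 ◁ Y) (inj₁ 0z∈)))
        where
        0z∈ : 0 ∷ z ∈ ⟦ 0 ◁ Z ⟧
        0z∈ = from (∈-◁ 0 Z (0 ∷ z)) (z , z∈ , refl)

    open Order em 𝓡/𝓙 𝕊 (𝕊-isCharacteristic 𝓙 𝓙-isIdeal t-1∈𝓙) 𝓡⁺ using (⊂-witness)

    ⊕-difference : ∀ {X A B} → X E.≈ B → ⟦ B ⟧ ⊂ ⟦ A ⟧ → (X ⊕ (A ∖ʷ B)) E.≈ A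
    ⊕-difference {X} {A} {B} X≈B (B⊆A , _) = ≈-trans (⊕-cong X≈B ≈-refl)
      (≈-trans (≈-sym (∪≈⊕ B (A ∖ʷ B) λ {x} (x∈B , x∈) → proj₂ (∈-∖ A B x x∈) x∈B)) (E.extensional
        ( (λ {x} x∈ → [ B⊆A , (λ x∈′ → proj₁ (∈-∖ A B x x∈′)) ]′ (∈-∪ B (A ∖ʷ B) x∈))
        , (λ {x} x∈A → ∪-∈ B (A ∖ʷ B) (decide x x∈A (T? (χ B x)))))))
      where
      decide : ∀ x → x ∈ ⟦ A ⟧ → Dec (x ∈ ⟦ B ⟧) → x ∈ ⟦ B ⟧ ⊎ x ∈ ⟦ A ∖ʷ B ⟧
      decide x x∈A (yes x∈B) = inj₁ x∈B
      decide x x∈A (no  x∉B) = inj₂ (∖-∈ A B x x∈A x∉B)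

    ⊕-∅ : ∀ A → (A ⊕ ∅ʷ) E.≈ A
    ⊕-∅ A = ≈-trans (≈-sym (∪≈⊕ A ∅ʷ λ {x} (_ , x∈) → ∉∅ʷ x x∈)) (E.extensional
      ((λ {x} x∈ → [ id , (λ x∈∅ → ⊥-elim (∉∅ʷ x x∈∅)) ]′ (∈-∪ A ∅ʷ x∈)) , (λ x∈ → ∪-∈ A ∅ʷ (inj₁ x∈))))

    -- (ZP) compares the two sets whose difference represents S. The words by which the larger
    -- witness exceeds the smaller form the positive series.
    gauge : ∀ S → S ∉ 𝓘 → ∃ λ P → P ∈ 𝓡⁺ × ((S 𝓡.+ P) ∈ 𝓘 ⊎ (S 𝓡.- P) ∈ 𝓘)
    gauge S S∉ = case representable (proj₂ S) of λ (X , Y , d) → compare X Y d (E.ZP X Y)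
      where
      compare : ∀ X Y → S IsDifferenceOf (X , Y) → Tri (Succ E._≈_ Y X) (X E.≈ Y) (Succ E._≈_ X Y) →
                ∃ λ P → P ∈ 𝓡⁺ × ((S 𝓡.+ P) ∈ 𝓘 ⊎ (S 𝓡.- P) ∈ 𝓘)
      compare X Y d (tri< (A , B , B⊂A , Y≈A , X≈B) _ _) = 𝕊 D , 𝕊-positive D (⊂-witness A B B⊂A) , inj₁
        -- The empty summand appears because `𝕊 D` is represented as the difference of `D` and `∅ʷ`.
        ( X ⊕ D , Y ⊕ ∅ʷ , ≈-trans (⊕-difference X≈B B⊂A) (≈-trans (≈-sym Y≈A) (≈-sym (⊕-∅ Y)))
        , 𝕊/𝓙.difference-+ {S} {𝕊 D} X Y D ∅ʷ d (𝕊/𝓙.difference-s D))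
        where D = A ∖ʷ B
      compare X Y d (tri≈ _ X≈Y _) = ⊥-elim (S∉ (X , Y , X≈Y , d))
      compare X Y d (tri> _ _ (A , B , B⊂A , X≈A , Y≈B)) = 𝕊 D , 𝕊-positive D (⊂-witness A B B⊂A) , inj₂
        ( X ⊕ ∅ʷ , Y ⊕ D , ≈-trans (⊕-∅ X) (≈-trans X≈A (≈-sym (⊕-difference Y≈B B⊂A)))
        , 𝕊/𝓙.difference-+ {S} {𝓡.- 𝕊 D} X Y ∅ʷ D d (𝕊/𝓙.difference-neg {𝕊 D} D ∅ʷ (𝕊/𝓙.difference-s D)))
        where D = A ∖ʷ B

    gaugeIdeal : GaugeIdeal
    gaugeIdeal = record { 𝓘 = 𝓘 ; isIdeal = 𝓘-isIdeal ; 𝓘₀⊆𝓘 = 𝓘₀⊆𝓘 ; 𝓡⁺⊥𝓘 = 𝓡⁺⊥𝓘 ; gauge = gauge }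

  -- The equinumerosity of a gauge ideal

  module FromGaugeIdeal (I : GaugeIdeal) where

    open GaugeIdeal I

    t-1∈𝓘 : ∀ n → (t n 𝓡.- 𝓡.1#) ∈ 𝓘
    t-1∈𝓘 n = 𝓘₀⊆𝓘 (gen∈ (n , refl))

    𝓙⊆𝓘 : 𝓙 ⊆ 𝓘
    𝓙⊆𝓘 = 𝓙⊆ isIdeal λ n _ → t-1∈𝓘 n

    isCharacteristic : IsCharacteristic 𝓡/𝓘 𝕊
    isCharacteristic = 𝕊-isCharacteristic 𝓘 isIdeal λ n _ → t-1∈𝓘 n

    open IsCharacteristic isCharacteristic using (isPreEquinumerosity; s-×)
    open Order em 𝓡/𝓘 𝕊 isCharacteristic 𝓡⁺ public

    -0∈⇒∈ : ∀ S → S 𝓡/𝓘.≈ 𝓡.0# → S ∈ 𝓘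
    -0∈⇒∈ S = IsIdeal.≈-resp isIdeal {S 𝓡.- 𝓡.0#} {S} λ a → ℤₚ.+-identityʳ (coeff (proj₁ S) a)

    ∈⇒-0∈ : ∀ S → S ∈ 𝓘 → S 𝓡/𝓘.≈ 𝓡.0#
    ∈⇒-0∈ S = IsIdeal.≈-resp isIdeal {S} {S 𝓡.- 𝓡.0#} λ a → sym (ℤₚ.+-identityʳ (coeff (proj₁ S) a))

    isPositivity : IsPositivity
    isPositivity = record
      { pos-≉0 = λ {P} P∈ P≈0 → 𝓡⁺⊥𝓘 {P} (P∈ , -0∈⇒∈ P P≈0)
      ; pos-s  = 𝕊-positive
      ; pos⇒s  = λ {P} (P≉0 , P≥0) → Realisation.realisation em P P≥0
                   , realisation-inhabited P P≥0 P≉0 , 𝓙⊆𝓘 (𝕊-realisation P P≥0)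
      }

    gauge-≈0 : ∀ S → ¬ S 𝓡/𝓘.≈ 𝓡.0# → ∃ λ P → P ∈ 𝓡⁺ × ((S 𝓡.+ P) 𝓡/𝓘.≈ 𝓡.0# ⊎ (S 𝓡.- P) 𝓡/𝓘.≈ 𝓡.0#)
    gauge-≈0 S S≉0 = case gauge S (λ S∈ → S≉0 (∈⇒-0∈ S S∈)) of λ
      { (P , P∈ , inj₁ e) → P , P∈ , inj₁ (∈⇒-0∈ (S 𝓡.+ P) e)
      ; (P , P∈ , inj₂ e) → P , P∈ , inj₂ (∈⇒-0∈ (S 𝓡.- P) e) }

    infix 4 _≈ᴵ_
    _≈ᴵ_ : Rel 𝕎 0ℓ
    X ≈ᴵ Y = (𝕊 X 𝓡.- 𝕊 Y) ∈ 𝓘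

    equinumerosity : Equinumerosity
    equinumerosity = record
      { _≈_              = _≈ᴵ_
      ; isEquinumerosity = record
        { isEquivalence = Pre′.isEquivalence
        ; extensional   = Pre′.extensional
        ; AP            = Pre′.AP
        ; ZP            = ≺-compare isPositivity _≈ᴵ_ (λ X Y → mk⇔ id id) gauge-≈0
        ; TP            = Pre′.TP
        ; UP            = λ A n → begin
            𝕊 (A ×ʷ ｛ n ｝ʷ)         ≈⟨ s-× A ｛ n ｝ʷ (｛｝-multipliableʳ A n) ⟩
            𝕊 A 𝓡.* 𝕊 ｛ n ｝ʷ       ≈⟨ 𝓡/𝓘.*-cong {𝕊 A} {𝕊 A} {𝕊 ｛ n ｝ʷ} {t n} (𝓡/𝓘.refl {𝕊 A})
                                         (≈⇒~ 𝓡-ring isIdeal {𝕊 ｛ n ｝ʷ} {t n} (char-｛｝ n)) ⟩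
            𝕊 A 𝓡.* t n               ≈⟨ 𝓡/𝓘.*-cong {𝕊 A} {𝕊 A} {t n} {𝓡.1#} (𝓡/𝓘.refl {𝕊 A}) (t-1∈𝓘 n) ⟩
            𝕊 A 𝓡.* 𝓡.1#              ≈⟨ 𝓡/𝓘.*-identityʳ (𝕊 A) ⟩
            𝕊 A                       ∎
        ; PP            = λ A B A′ B′ m m′ A≈A′ B≈B′ → begin
            𝕊 (A ×ʷ B)                ≈⟨ s-× A B m ⟩
            𝕊 A 𝓡.* 𝕊 B               ≈⟨ 𝓡/𝓘.*-cong {𝕊 A} {𝕊 A′} {𝕊 B} {𝕊 B′} A≈A′ B≈B′ ⟩
            𝕊 A′ 𝓡.* 𝕊 B′             ≈⟨ s-× A′ B′ m′ ⟨
            𝕊 (A′ ×ʷ B′)              ∎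
        }
      }
      where
      module Pre′ = IsPreEquinumerosity isPreEquinumerosity
      open SetoidReasoning 𝓡/𝓘.setoid

  Φ : Bijection equinumerositySetoid gaugeIdealSetoid
  Φ = record
    { to        = FromEquinumerosity.gaugeIdeal
    ; cong      = λ {E} {F} e →
        (λ {S} (X , Y , X≈Y , d) → X , Y , to (e X Y) X≈Y , d)
      , (λ {S} (X , Y , X≈Y , d) → X , Y , from (e X Y) X≈Y , d)
    ; bijective = (λ {E} {F} → injective E F) , λ I → FromGaugeIdeal.equinumerosity I , λ {E} → surjective I E
    }
    where
    injective : ∀ E F → FromEquinumerosity.𝓘 E ≐ FromEquinumerosity.𝓘 F →
                ∀ X Y → Equinumerosity._≈_ E X Y ⇔ Equinumerosity._≈_ F X Y
    injective E F (E⊆F , F⊆E) X Y = mk⇔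
      (λ e → from (FromEquinumerosity.𝓘-𝕊 F X Y) (E⊆F (to (FromEquinumerosity.𝓘-𝕊 E X Y) e)))
      (λ e → from (FromEquinumerosity.𝓘-𝕊 E X Y) (F⊆E (to (FromEquinumerosity.𝓘-𝕊 F X Y) e)))

    -- Surjectivity in `Bijection` concerns every E equivalent to the chosen preimage, hence the
    -- hypothesis that E is given by the ideal only up to logical equivalence.
    surjective : ∀ I E → (∀ A B → Equinumerosity._≈_ E A B ⇔ (𝕊 A 𝓡.- 𝕊 B) ∈ GaugeIdeal.𝓘 I) →
                 FromEquinumerosity.𝓘 E ≐ GaugeIdeal.𝓘 I
    surjective I E e = (λ {S} (X , Y , X≈Y , d) → in-𝓘 S X Y d (to (e X Y) X≈Y))
      , λ {S} S∈ → case representable (proj₂ S) of λ (X , Y , d) → X , Y , from (e X Y) (out-𝓘 S X Y d S∈) , d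
      where
      open GaugeIdeal I
      open FromGaugeIdeal I using (𝓙⊆𝓘)
      open RingProperties 𝓡/𝓘.ring using (+-cancelʳ)
      open SetoidReasoning 𝓡/𝓘.setoid

      -- As `𝓙` lies in the gauge ideal, a representation modulo `𝓙` may be used there too.
      shifted : ∀ S X Y → S IsDifferenceOf (X , Y) → S 𝓡/𝓘.≈ (𝕊 X 𝓡.- 𝕊 Y)
      shifted S X Y d = +-cancelʳ (𝕊 Y) S (𝕊 X 𝓡.- 𝕊 Y) (begin
        S 𝓡.+ 𝕊 Y                  ≈⟨ 𝓙⊆𝓘 d ⟩
        𝕊 X                        ≈⟨ 𝓙⊆𝓘 (𝕊/𝓙.difference-self X Y) ⟨
        (𝕊 X 𝓡.- 𝕊 Y) 𝓡.+ 𝕊 Y      ∎)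

      in-𝓘 : ∀ S X Y → S IsDifferenceOf (X , Y) → (𝕊 X 𝓡.- 𝕊 Y) ∈ 𝓘 → S ∈ 𝓘
      in-𝓘 S X Y d p = FromGaugeIdeal.-0∈⇒∈ I S (begin
        S                    ≈⟨ shifted S X Y d ⟩
        𝕊 X 𝓡.- 𝕊 Y          ≈⟨ FromGaugeIdeal.∈⇒-0∈ I (𝕊 X 𝓡.- 𝕊 Y) p ⟩
        𝓡.0#                 ∎)

      out-𝓘 : ∀ S X Y → S IsDifferenceOf (X , Y) → S ∈ 𝓘 → (𝕊 X 𝓡.- 𝕊 Y) ∈ 𝓘
      out-𝓘 S X Y d p = FromGaugeIdeal.-0∈⇒∈ I (𝕊 X 𝓡.- 𝕊 Y) (begin
        𝕊 X 𝓡.- 𝕊 Y          ≈⟨ shifted S X Y d ⟨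
        S                    ≈⟨ FromGaugeIdeal.∈⇒-0∈ I S p ⟩
        𝓡.0#                 ∎)

  -- Numerosities in the quotient ring

  module Corresponding (E : Equinumerosity) (I : GaugeIdeal) (𝓘≐ : FromEquinumerosity.𝓘 E ≐ GaugeIdeal.𝓘 I) where

    open Equinumerosity E
    open GaugeIdeal I
    open FromGaugeIdeal I using (isCharacteristic; isPositivity; 𝓙⊆𝓘; ≺⇒<ᵠ; <ᵠ⇒≺; ≺⇔superset; isOrderedSemiring)
    open IsCharacteristic isCharacteristic
    module F = FromEquinumerosity E

    ≈⇔ : ∀ X Y → X ≈ Y ⇔ (𝕊 X 𝓡.- 𝕊 Y) ∈ 𝓘
    ≈⇔ X Y = mk⇔ (λ e → proj₁ 𝓘≐ (to (F.𝓘-𝕊 X Y) e)) (λ e → from (F.𝓘-𝕊 X Y) (proj₂ 𝓘≐ e))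

    -- Both quotients keep the original carriers, so `𝕊` itself serves as the map. It is onto
    -- because every positive class is the class of a realisation.
    embedding : IsNumerosityEmbedding E I 𝕊
    embedding = record
      { isOrderMonomorphism = record
        { isOrderHomomorphism = record
          { cong = λ {X} {Y} → to (≈⇔ X Y)
          ; mono = ≺⇒<ᵠ isPositivity _≈_ ≈⇔
          }
        ; injective = λ {X} {Y} → from (≈⇔ X Y)
        ; cancel    = <ᵠ⇒≺ isPositivity _≈_ ≈⇔
        }
      ; onto     = (λ {S} (X , e) → nonNegative S X e em) , λ {S} → hit S
      ; commutes = λ X → 𝓡/𝓘.refl {𝕊 X}
      }
      where
      nonNegative : ∀ S X → 𝕊 X 𝓡/𝓘.≈ S → Dec (∃ λ x → x ∈ ⟦ X ⟧) → NonNegative S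
      nonNegative S X e (yes x)  = inj₁ (𝕊 X , 𝕊-positive X x , 𝓡/𝓘.sym {𝕊 X} {S} e)
      nonNegative S X e (no X∅) = inj₂ (𝓡/𝓘.trans {S} {𝕊 X} {𝓡.0#} (𝓡/𝓘.sym {𝕊 X} {S} e) (s-∅ X λ x x∈ → X∅ (x , x∈)))

      hit : ∀ S → NonNegative S → ∃ λ X → 𝕊 X 𝓡/𝓘.≈ S
      hit S (inj₁ (P , (_ , P≥0) , e)) = Realisation.realisation em P P≥0
        , 𝓡/𝓘.sym {S} {𝕊 _} (𝓡/𝓘.trans {S} {P} {𝕊 (Realisation.realisation em P P≥0)} e (𝓙⊆𝓘 (𝕊-realisation P P≥0)))
      hit S (inj₂ e) = ∅ʷ , 𝓡/𝓘.trans {𝕊 ∅ʷ} {𝓡.0#} {S} (s-∅ ∅ʷ ∉∅ʷ) (𝓡/𝓘.sym {S} {𝓡.0#} e)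

    -- `𝔫` is the identity on carriers, so `commutes` determines the map everywhere.
    embedding-unique : ∃! (λ j j′ → ∀ u → j u 𝓡/𝓘.≈ j′ u) (IsNumerosityEmbedding E I)
    embedding-unique = 𝕊 , embedding , λ {j} isEmbedding u →
      𝓡/𝓘.sym {j u} {𝕊 u} (IsNumerosityEmbedding.commutes isEmbedding u)

    module _ (j : 𝕎 → 𝓡) (isEmbedding : IsNumerosityEmbedding E I j) where

      open IsNumerosityEmbedding isEmbedding
      open SetoidReasoning 𝓡/𝓘.setoid

      -- `commutes` replaces any admissible j by `𝕊`, so the same operations serve for all of them.
      inducedSemiring : InducedSemiring E I j
      inducedSemiring = record
        { _+ᴺ_ = _⊕_ ; _*ᴺ_ = _⊗_ ; 0ᴺ = ∅ʷ ; 1ᴺ = ｛ 0 ｝ʷ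
        ; isOrderedSemiring = isOrderedSemiring isPositivity _≈_ ≈⇔ ZP
        ; isSemiringHomomorphism = record
          { isNearSemiringHomomorphism = record
            { +-isMonoidHomomorphism = record
              { isMagmaHomomorphism = record
                { isRelHomomorphism = record { cong = cong-j }
                ; homo = λ X Y → begin
                    j (X ⊕ Y)          ≈⟨ commutes (X ⊕ Y) ⟩
                    𝕊 (X ⊕ Y)          ≈⟨ s-⊕ X Y ⟩
                    𝕊 X 𝓡.+ 𝕊 Y        ≈⟨ 𝓡/𝓘.+-cong {j X} {𝕊 X} {j Y} {𝕊 Y} (commutes X) (commutes Y) ⟨
                    j X 𝓡.+ j Y        ∎
                }
              ; ε-homo = begin
                  j ∅ʷ      ≈⟨ commutes ∅ʷ ⟩
                  𝕊 ∅ʷ      ≈⟨ s-∅ ∅ʷ ∉∅ʷ ⟩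
                  𝓡.0#      ∎
              }
            ; *-homo = λ X Y → begin
                j (X ⊗ Y)          ≈⟨ commutes (X ⊗ Y) ⟩
                𝕊 (X ⊗ Y)          ≈⟨ s-⊗ X Y ⟩
                𝕊 X 𝓡.* 𝕊 Y        ≈⟨ 𝓡/𝓘.*-cong {j X} {𝕊 X} {j Y} {𝕊 Y} (commutes X) (commutes Y) ⟨
                j X 𝓡.* j Y        ∎
            }
          ; 1#-homo = begin
              j ｛ 0 ｝ʷ       ≈⟨ commutes ｛ 0 ｝ʷ ⟩
              𝕊 ｛ 0 ｝ʷ       ≈⟨ s-｛｝ 0 (s≤s z≤n) ⟩
              𝓡.1#             ∎
          }
        }
        where
        cong-j : ∀ {X Y} → X ≈ Y → j X 𝓡/𝓘.≈ j Y
        cong-j {X} {Y} e = begin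
          j X      ≈⟨ commutes X ⟩
          𝕊 X      ≈⟨ to (≈⇔ X Y) e ⟩
          𝕊 Y      ≈⟨ commutes Y ⟨
          j Y      ∎

    ⊕≈∪ʷ : ∀ X Y → ⟦ X ⟧ ⊥ ⟦ Y ⟧ → (X ⊕ Y) ≈ (X ∪ʷ Y)
    ⊕≈∪ʷ X Y X⊥Y = IsEquivalence.trans isEquivalence
      (IsEquivalence.sym isEquivalence (IsPreEquinumerosity.∪≈⊕ F.isPreEquinumerosity X Y X⊥Y))
      (extensional (∪≐∪ʷ X Y))

    ⊗≈×ʷ : ∀ X Y → Multipliable X Y → (X ⊗ Y) ≈ (X ×ʷ Y)
    ⊗≈×ʷ X Y m = from (≈⇔ (X ⊗ Y) (X ×ʷ Y)) (𝓡/𝓘.trans {𝕊 (X ⊗ Y)} {𝕊 X 𝓡.* 𝕊 Y} {𝕊 (X ×ʷ Y)} (s-⊗ X Y)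
      (𝓡/𝓘.sym {𝕊 (X ×ʷ Y)} {𝕊 X 𝓡.* 𝕊 Y} (s-× X Y m)))

    ≺⇔⊂ : ∀ X Y → X ≺ Y ⇔ (∃ λ Y′ → ⟦ X ⟧ ⊂ ⟦ Y′ ⟧ × Y ≈ Y′)
    ≺⇔⊂ = ≺⇔superset isPositivity _≈_ ≈⇔

theorem1p13 :
    ExcludedMiddle 0ℓ →
    Σ (Bijection equinumerositySetoid gaugeIdealSetoid) λ Φ →
    ∀ (E : Equinumerosity) (I : GaugeIdeal) →
    Setoid._≈_ gaugeIdealSetoid (Bijection.to Φ E) I →
    let open Equinumerosity E
        open GaugeIdeal I
    in
      (∀ X Y → X ≈ Y ⇔ (𝕊 X 𝓡.- 𝕊 Y) ∈ 𝓘)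
      × ∃! (λ j j′ → ∀ u → j u 𝓡/𝓘.≈ j′ u) (IsNumerosityEmbedding E I)
      × (∀ j → IsNumerosityEmbedding E I j →
         Σ (InducedSemiring E I j) λ N →
         let open InducedSemiring N in
           (∀ X Y → ⟦ X ⟧ ⊥ ⟦ Y ⟧ → (𝔫 X +ᴺ 𝔫 Y) ≈ 𝔫 (X ∪ʷ Y))
           × (∀ X Y → Multipliable X Y → (𝔫 X *ᴺ 𝔫 Y) ≈ 𝔫 (X ×ʷ Y))
           × (∀ X Y → 𝔫 X ≺ 𝔫 Y ⇔ (∃ λ Y′ → ⟦ X ⟧ ⊂ ⟦ Y′ ⟧ × Y ≈ Y′)))
theorem1p13 em = Φ , λ E I 𝓘≐ →
  let open Corresponding E I 𝓘≐ in
    ≈⇔ , embedding-unique , λ j isEmbedding → inducedSemiring j isEmbedding , ⊕≈∪ʷ , ⊗≈×ʷ , ≺⇔⊂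
  where open Correspondence em
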